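{- Let $c_0(S_n)$, $\widetilde c_0(S_n)$, $c_0(\mathcal T(S_n))$, $c_0(\mathcal O(S_n))$ denote the numbers of connected components of $P_0(S_n)$, $\widetilde P_0(S_n)$, $P_0(\mathcal T(S_n))$, $\mathcal O_0(S_n)$ respectively. Then $c_0(S_n)=\widetilde c_0(S_n)$ and: (i) for $2\le n\le 7$: $c_0(S_n)=1,4,13,31,83,128$; $c_0(\mathcal T(S_n))=1,2,3,3,4,3$; $c_0(\mathcal O(S_n))=1,2,2,2,2,2$ for $n=2,3,4,5,6,7$ respectively; (ii) for $n\ge 8$: if $n$ is prime then $c_0(S_n)=(n-2)!+1$ and $c_0(\mathcal T(S_n))=c_0(\mathcal O(S_n))=2$; if $n=p+1$ with $p$ prime then $c_0(S_n)=n(n-3)!+1$ and $c_0(\mathcal T(S_n))=c_0(\mathcal O(S_n))=2$; if neither $n$ nor $n-1$ is prime then $c_0(S_n)=c_0(\mathcal T(S_n))=c_0(\mathcal O(S_n))=1$.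
   Context: For a finite group $G$, $G_0=G\setminus\{1\}$. $P_0(G)$: vertex set $G_0$, distinct $x,y$ adjacent iff one is a positive power of the other. $\widetilde P_0(G)$: vertex set $\{[x]:x\in G_0\}$ with $[x]=\{y:\langle y\rangle=\langle x\rangle\}$, distinct $[x],[y]$ adjacent iff some representatives are one a positive power of the other. $\mathcal O_0(G)$: vertex set $\{o(g):g\in G_0\}$ (element orders other than $1$), distinct $m,m'$ adjacent iff one divides the other. For $\psi\in S_n$, $T_\psi$ is the partition of $n$ given by the orbit lengths of $\langle\psi\rangle$ on $\{1,\dots,n\}$; for a partition $T=[m_1^{t_1},\dots,m_k^{t_k}]$ and $a\in\mathbb N$, $T^a=[(m_i/\gcd(a,m_i))^{t_i\gcd(a,m_i)}]_{i}$. $P_0(\mathcal T(S_n))$: vertex set the set of partitions of $n$ other than $[1^n]$, distinct $T,T'$ adjacent iff one is a power of the other. -}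

module Defs where

open import Algebra.Bundles using (Group)
import Algebra.Definitions.RawMonoid
open import Data.Fin.Base using (Fin)
import Data.Fin.Permutation as Perm
open import Data.Fin.Properties using (injective⇒≤)
open import Data.Integer.Base as ℤ using (ℤ; -[1+_])
open import Data.List.Base using (List; []; _∷_; sum; replicate; concatMap)
open import Data.List.Properties using (sum-++)
open import Data.List.Relation.Binary.Permutation.Propositional using (↭-setoid)
open import Data.List.Relation.Unary.All using (All; []; _∷_)
open import Data.List.Relation.Unary.All.Properties using (++⁺; replicate⁺)
open import Data.Nat.Base
  using (ℕ; zero; suc; _+_; _*_; _/_; _≤_; _<_; z<s; NonZero; >-nonZero; ≢-nonZero; ≢-nonZero⁻¹)
open import Data.Nat.DivMod using (m*[n/m]≡n; m≥n⇒m/n>0)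
open import Data.Nat.Divisibility using (_∣_; ∣⇒≤)
open import Data.Nat.GCD using (gcd; gcd[m,n]≢0; gcd[m,n]∣n)
open import Data.Nat.Properties using (≤-antisym; *-identityʳ)
open import Data.Product.Base using (Σ; ∃; ∃₂; _×_; _,_; proj₁; proj₂)
open import Data.Sum.Base using (_⊎_; inj₁; swap)
open import Function.Base using (_∘_; _on_)
open import Function.Bundles using (Bijection)
open import Level using (Level; _⊔_; 0ℓ) renaming (suc to ℓsuc)
open import Relation.Binary.Bundles using (Setoid)
open import Relation.Binary.Core using (Rel)
open import Relation.Binary.Definitions using (Symmetric; Irreflexive)
import Relation.Binary.Construct.Closure.Equivalence as EqClosure
import Relation.Binary.Construct.On as On
open import Relation.Binary.PropositionalEquality
  using (_≡_; refl; sym; trans; cong; cong₂)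
import Relation.Binary.PropositionalEquality.Properties as ≡
open import Relation.Nullary.Negation using (¬_)
open import Relation.Unary using (Pred; _≐_)
open import Relation.Unary.Relation.Binary.Equality using (≐-setoid)

private
  variable
    c ℓ e : Level

record Graph c ℓ e : Set (ℓsuc (c ⊔ ℓ ⊔ e)) where
  field
    vertices   : Setoid c ℓ
  open Setoid vertices public using (_≈_) renaming (Carrier to Vertex)
  field
    Adj        : Rel Vertex e
    adj-sym    : Symmetric Adj
    adj-irrefl : Irreflexive _≈_ Adj

comparabilityGraph : (S : Setoid c ℓ) → Rel (Setoid.Carrier S) e → Graph c ℓ (ℓ ⊔ e)
comparabilityGraph S R = record
  { vertices   = S
  ; Adj        = λ x y → ¬ (x ≈ y) × (R x y ⊎ R y x)
  ; adj-sym    = λ (x≉y , r) → (λ y≈x → x≉y (Setoid.sym S y≈x)) , swap r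
  ; adj-irrefl = λ x≈y (x≉y , _) → x≉y x≈y
  }
  where open Setoid S using (_≈_)

-- The vertices up to being joined by a walk.  A walk may also replace a
-- vertex by an ≈-equal one, since these represent the same vertex.
components : Graph c ℓ e → Setoid c (c ⊔ ℓ ⊔ e)
components G = EqClosure.setoid (λ x y → (x ≈ y) ⊎ Adj x y)
  where open Graph G

infix 4 _HasComponents_

_HasComponents_ : Graph c ℓ e → ℕ → Set (c ⊔ ℓ ⊔ e)
G HasComponents k = Bijection (components G) (≡.setoid (Fin k))

HasComponents-unique : (G : Graph c ℓ e) {k l : ℕ} →
                       G HasComponents k → G HasComponents l → k ≡ l
HasComponents-unique G f g = ≤-antisym (bound f g) (bound g f)
  where
  bound : ∀ {k l} → G HasComponents k → G HasComponents l → k ≤ l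
  bound f g = injective⇒≤ {f = G.to ∘ F.to⁻} λ {i} {j} eq →
    trans (sym (to∘to⁻ i)) (trans (F.cong (G.injective eq)) (to∘to⁻ j))
    where
    module F = Bijection f
    module G = Bijection g
    to∘to⁻ : ∀ i → F.to (F.to⁻ i) ≡ i
    to∘to⁻ i = proj₂ (F.strictlySurjective i)

module _ (G : Group c ℓ) where
  open Group G using (Carrier; _≈_; ε; _⁻¹; rawMonoid; setoid)

  infixr 8 _^^_ _^ᶻ_

  _^^_ : Carrier → ℕ → Carrier
  x ^^ k = k Power.× x
    where module Power = Algebra.Definitions.RawMonoid rawMonoid

  _^ᶻ_ : Carrier → ℤ → Carrier
  x ^ᶻ (ℤ.+ k)  = x ^^ k
  x ^ᶻ -[1+ k ] = (x ^^ suc k) ⁻¹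

  ⟨_⟩ : Carrier → Pred Carrier ℓ
  ⟨ x ⟩ y = ∃ λ k → y ≈ x ^ᶻ k

  _IsPositivePowerOf_ : Rel Carrier ℓ
  x IsPositivePowerOf y = ∃ λ k → 0 < k × x ≈ y ^^ k

  HasOrder : Carrier → ℕ → Set ℓ
  HasOrder x m = 0 < m × x ^^ m ≈ ε × (∀ k → 0 < k → x ^^ k ≈ ε → m ≤ k)

  G₀ : Set (c ⊔ ℓ)
  G₀ = Σ Carrier λ x → ¬ (x ≈ ε)

  P₀ : Graph (c ⊔ ℓ) ℓ ℓ
  P₀ = comparabilityGraph
    (On.setoid setoid (proj₁ {B = λ x → ¬ (x ≈ ε)}))
    (_IsPositivePowerOf_ on proj₁)

  _∈[_] : Rel Carrier (c ⊔ ℓ)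
  y ∈[ x ] = ⟨ y ⟩ ≐ ⟨ x ⟩

  -- The vertex [x] is represented by x, and [x] = [y] amounts to ⟨x⟩ = ⟨y⟩.
  P̃₀ : Graph (c ⊔ ℓ) (c ⊔ ℓ) (c ⊔ ℓ)
  P̃₀ = comparabilityGraph
    (On.setoid (≐-setoid Carrier ℓ) (⟨_⟩ ∘ proj₁ {B = λ x → ¬ (x ≈ ε)}))
    (λ (x , _) (y , _) → ∃₂ λ x′ y′ →
      x′ ∈[ x ] × y′ ∈[ y ] × x′ IsPositivePowerOf y′)

  O₀ : Graph (c ⊔ ℓ) 0ℓ 0ℓ
  O₀ = comparabilityGraph
    (On.setoid (≡.setoid ℕ) (proj₁ {B = λ m → Σ G₀ λ (g , _) → HasOrder g m}))
    (_∣_ on proj₁)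

Sym : ℕ → Group 0ℓ 0ℓ
Sym n = record
  { Carrier = Perm.Permutation′ n
  ; _≈_     = Perm._≈_
  ; _∙_     = Perm._∘ₚ_
  ; ε       = Perm.id
  ; _⁻¹     = Perm.flip
  ; isGroup = record
    { isMonoid = record
      { isSemigroup = record
        { isMagma = record
          { isEquivalence = record
            { refl  = λ _ → refl
            ; sym   = λ p i → sym (p i)
            ; trans = λ p q i → trans (p i) (q i)
            }
          ; ∙-cong = λ {_} {_} {ρ} p q i → trans (cong (ρ Perm.⟨$⟩ʳ_) (p i)) (q _)
          }
        ; assoc = λ _ _ _ _ → refl
        }
      ; identity = (λ _ _ → refl) , (λ _ _ → refl)
      }
    ; inverse = (λ π _ → Perm.inverseʳ π) , (λ π _ → Perm.inverseˡ π)
    ; ⁻¹-cong = λ {π} {ρ} p i → trans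
        (sym (Perm.inverseˡ ρ))
        (cong (ρ Perm.⟨$⟩ˡ_) (trans (sym (p _)) (Perm.inverseʳ π)))
    }
  }

-- A partition is the multiset of its parts: a list up to permutation.
record Partition (n : ℕ) : Set where
  field
    parts     : List ℕ
    positive  : All (0 <_) parts
    sum-parts : sum parts ≡ n
open Partition public

partitions : ℕ → Setoid 0ℓ 0ℓ
partitions n = On.setoid ↭-setoid (parts {n})

private
  sum-replicate : ∀ k m → sum (replicate k m) ≡ k * m
  sum-replicate zero    m = refl
  sum-replicate (suc k) m = cong (m +_) (sum-replicate k m)

[1^_] : ∀ n → Partition n
[1^ n ] = record
  { parts     = replicate n 1
  ; positive  = replicate⁺ n z<s
  ; sum-parts = trans (sum-replicate n 1) (*-identityʳ n)
  }

module _ (a : ℕ) .{{_ : NonZero a}} where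

  private instance
    gcd-nonZero : ∀ {m} → NonZero (gcd a m)
    gcd-nonZero {m} = ≢-nonZero (gcd[m,n]≢0 a m (inj₁ (≢-nonZero⁻¹ a)))

  -- The a-th power of an m-cycle consists of gcd(a,m) cycles of length
  -- m/gcd(a,m); repeated parts are treated one copy at a time.
  powerOfPart : ℕ → List ℕ
  powerOfPart m = replicate (gcd a m) (m / gcd a m)

  private
    positive-powerOfPart : ∀ {m} → 0 < m → All (0 <_) (powerOfPart m)
    positive-powerOfPart {m} m>0 = replicate⁺ (gcd a m)
      (m≥n⇒m/n>0 (∣⇒≤ {{>-nonZero m>0}} (gcd[m,n]∣n a m)))

    sum-powerOfPart : ∀ m → sum (powerOfPart m) ≡ m
    sum-powerOfPart m =
      trans (sum-replicate (gcd a m) _) (m*[n/m]≡n (gcd[m,n]∣n a m))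

    positive-power : ∀ {ms} → All (0 <_) ms → All (0 <_) (concatMap powerOfPart ms)
    positive-power []           = []
    positive-power (m>0 ∷ ms>0) = ++⁺ (positive-powerOfPart m>0) (positive-power ms>0)

    sum-power : ∀ ms → sum (concatMap powerOfPart ms) ≡ sum ms
    sum-power []       = refl
    sum-power (m ∷ ms) = trans (sum-++ (powerOfPart m) _)
      (cong₂ _+_ (sum-powerOfPart m) (sum-power ms))

  power : ∀ {n} → Partition n → Partition n
  power T = record
    { parts     = concatMap powerOfPart (parts T)
    ; positive  = positive-power (positive T)
    ; sum-parts = trans (sum-power (parts T)) (sum-parts T)
    }

module _ (n : ℕ) where
  open Setoid (partitions n) using (_≈_)

  _IsPowerOf_ : Rel (Partition n) 0ℓ
  T IsPowerOf U = ∃ λ a → Σ (0 < a) λ a>0 → T ≈ power a {{>-nonZero a>0}} U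

  P₀𝒯 : Graph 0ℓ 0ℓ 0ℓ
  P₀𝒯 = comparabilityGraph
    (On.setoid (partitions n) (proj₁ {B = λ T → ¬ (T ≈ [1^ n ])}))
    (_IsPowerOf_ on proj₁)

{-# OPTIONS --safe #-}
module Submission where

-- Commuting elements of coprime orders lie in one component of P₀, and every non-identity element has a
-- power of prime order, so it suffices to connect the elements y of prime order p.  If y fixes r points, or
-- has r orbits of length p, for a prime r ≠ p, then rotating these points or orbits is an element of order r
-- that commutes with y.  For n ≥ 8 such steps lead from y to a transposition unless p is n or n - 1.  In that
-- case y is a p-cycle with centralizer ⟨y⟩, so its component is ⟨y⟩ without 1; on p points ⟨y⟩ has a unique
-- generator mapping 0 to 1, and these generators correspond to the (p - 2)! orderings of the other points.
-- The order map carries components of P₀ to components of O₀, and the same steps can be made on partitions.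
-- For n ≤ 7 the remaining components are found by evaluation over all permutations; for n = 7 those outside
-- the component of the transpositions come from the point stabilizers, i.e. from n = 6.

open import Algebra.Bundles using (Group)
import Algebra.Properties.Group
import Algebra.Properties.Monoid.Mult
open import Data.Bool.Base using (if_then_else_)
open import Data.Empty using (⊥)
open import Data.Fin.Base using (Fin; zero; suc; toℕ; fromℕ<; inject≤; punchIn; punchOut; combine; remQuot)
import Data.Fin.Permutation as Perm
open import Data.Fin.Permutation using (_⟨$⟩ʳ_; _⟨$⟩ˡ_)
import Data.Fin.Properties as Finₚ
open import Data.Integer.Base as ℤ using (ℤ; -[1+_])
import Data.List.Base as List
open import Data.List.Base
  using (List; []; _∷_; length; _++_; map; tabulate; replicate; allFin; upTo; concatMap; filter; foldl)
open import Data.List.Membership.DecPropositional using () renaming (_∈?_ to member)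
open import Data.List.Membership.Propositional using (_∈_; _∉_; find; lose)
open import Data.List.Membership.Propositional.Properties
  using (∈-tabulate⁺; ∈-++⁺ˡ; ∈-++⁺ʳ; ∈-allFin; ∈-map⁺; ∈-concatMap⁺; ∈-concatMap⁻; ∈-upTo⁺; ∈-∃++)
import Data.List.Membership.Setoid.Properties as Memberₚ
open import Data.List.Properties using (length-tabulate)
import Data.List.Relation.Binary.Permutation.Propositional as Perm↭
open import Data.List.Relation.Binary.Permutation.Propositional
  using (_↭_; ↭-refl; ↭-prep; ↭-sym; ↭-trans; ↭-reflexive)
open import Data.List.Relation.Binary.Permutation.Propositional.Properties
  using (∈-resp-↭; All-resp-↭; ¬x∷xs↭[]; drop-∷)
  renaming (shift to ↭-shift; shifts to ↭-shifts; ++⁺ˡ to ↭-++⁺ˡ)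
import Data.List.Relation.Unary.All as All
open import Data.List.Relation.Unary.All using (All; []; _∷_)
import Data.List.Relation.Unary.All.Properties as Allₚ
import Data.List.Relation.Unary.Any as Any
open import Data.List.Relation.Unary.Any using (Any; here; there; index)
import Data.List.Relation.Unary.Any.Properties as Anyₚ
import Data.Maybe.Base as Maybe
open import Data.Nat.Base
open import Data.Nat.Coprimality
  using (Coprime; coprime-Bézout; prime⇒coprime; coprime-divisor; coprime-/gcd; coprime⇒gcd≡1)
  renaming (sym to Coprime-sym)
open import Data.Nat.Divisibility
open import Data.Nat.DivMod
open import Data.Nat.GCD
open import Data.Nat.Induction using (<-rec)
open import Data.Nat.ListAction using (sum; product)
open import Data.Nat.ListAction.Properties using (sum-↭; ∈⇒∣product)
open import Data.Nat.Primality
open import Data.Nat.Primality.Factorisation using (factorise)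
import Data.Nat.Properties as ℕₚ
open import Data.Product.Base using (Σ; ∃; ∃₂; _×_; _,_; proj₁; proj₂; uncurry)
open import Data.Sum.Base using (_⊎_; inj₁; inj₂; [_,_]′)
open import Data.Sum.Function.Propositional using (_⊎-↔_)
open import Data.Unit.Base using (⊤; tt)
import Data.Vec.Base as Vec
open import Data.Vec.Base using (Vec)
import Data.Vec.Properties as Vecₚ
open import Defs
open import Function.Base using (_∘_; id; case_of_)
open import Function.Bundles using (Bijection; Inverse; _↔_; mk↔ₛ′)
open import Function.Construct.Composition using (_↔-∘_)
open import Function.Construct.Identity using (↔-id)
open import Function.Construct.Symmetry using (↔-sym)
open import Function.Definitions using (Injective)
open import Level using (Level)
open import Relation.Binary.Bundles using (Setoid)
import Relation.Binary.Construct.Closure.Equivalence as EqClosure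
open import Relation.Binary.Core using (Rel)
open import Relation.Binary.Definitions using (Decidable; tri<; tri≈; tri>)
import Relation.Binary.PropositionalEquality.Properties as ≡ₚ
open import Relation.Binary.PropositionalEquality
  using (_≡_; _≢_; refl; sym; trans; cong; cong₂; subst; module ≡-Reasoning)
import Relation.Binary.Reasoning.Setoid
open import Relation.Nullary.Decidable
  using (Dec; yes; no; does; ¬?; map′; _×-dec_; _⊎-dec_; _→-dec_; toWitness; from-no)
open import Relation.Nullary.Negation using (¬_; contradiction)

-- The bound 8 comes from the involutions with three 2-cycles: rotating these cycles gives an
-- element of order 3 on six points, and two more points are needed to go on to a transposition. In
-- degree 6 they are missing, and the cycle types 2,2,2 and 3,3 and 6 form a component of their own;
-- degree 7 has one copy of it for each fixed point. Hence 83 = 6 * 3! + 2 + 45, where each of the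
-- 45 double transpositions stands for a component, and 128 = 5! + 7 + 1. In degrees 3 to 5 each
-- involution stands for a component, next to those of the elements of order p: 4 = 1 + 3, 13 = 4 +
-- 9, 31 = 6 + 25. A count is certified by a label that is constant along powers, a representative
-- of each label, and a walk from every element to the representative of its label. If p is n or n -
-- 1, an element with a power of order p has order p itself, so labels can be given separately on
-- the elements of order p and on the others, and then added. The generators of one cyclic group are
-- powers of each other. The quotient graph therefore merges vertices only within components, and
-- its count is the same.

private
  variable
    ℓ₁ ℓ₂ ℓ₃ : Level

-- Counting components by a complete invariant

module _ {G : Graph ℓ₁ ℓ₂ ℓ₃} {k : ℕ} {L : Set} (bij : L ↔ Fin k) where
  open Graph G
  private
    _∼_ = Setoid._≈_ (components G)

  -- A label constant along edges separates components, and a walk from every vertex to the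
  -- representative of its label joins the vertices that share one. `L` may be any type in bijection
  -- with `Fin k`, so labels can be sums and products.
  hasComponents-by :
    (label : Vertex → L) → (∀ {x y} → x ≈ y → label x ≡ label y) →
    (∀ {x y} → Adj x y → label x ≡ label y) →
    (rep : L → Vertex) → (∀ l → label (rep l) ≡ l) → (∀ x → x ∼ rep (label x)) →
    G HasComponents k
  hasComponents-by label label-≈ label-Adj rep label-rep connect = record
    { to        = Inverse.to bij ∘ label
    ; cong      = cong (Inverse.to bij) ∘ label-cong
    ; bijective = injective
      , λ i → rep (Inverse.from bij i) , λ z∼ →
          trans (cong (Inverse.to bij) (trans (label-cong z∼) (label-rep _)))
                (Inverse.strictlyInverseˡ bij i)
    }
    where
    label-cong : ∀ {x y} → x ∼ y → label x ≡ label y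
    label-cong = EqClosure.gfold ≡ₚ.isEquivalence label
      λ { (inj₁ x≈y) → label-≈ x≈y ; (inj₂ adj) → label-Adj adj }
    injective : ∀ {x y} → Inverse.to bij (label x) ≡ Inverse.to bij (label y) → x ∼ y
    injective {x} {y} eq = Setoid.trans (components G) (connect x)
      (subst (λ l → rep l ∼ y)
        (sym (trans (sym (Inverse.strictlyInverseʳ bij _))
          (trans (cong (Inverse.from bij) eq) (Inverse.strictlyInverseʳ bij _))))
        (Setoid.sym (components G) (connect y)))

-- Primes and coprimality

prime>1 : ∀ {p} → Prime p → 1 < p
prime>1 pr = nonTrivial⇒n>1 _ where instance _ = prime⇒nonTrivial pr

prime>0 : ∀ {p} → Prime p → 0 < p
prime>0 pr = ℕₚ.<-trans z<s (prime>1 pr)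

primeDivisor : ∀ n → 1 < n → ∃ λ p → Prime p × p ∣ n
primeDivisor 1 (s≤s ())
primeDivisor n@(2+ _) _ with factorise n
... | record { factors = [] ; isFactorisation = () }
... | record { factors = p ∷ ps ; isFactorisation = eq ; factorsPrime = pr All.∷ _ } =
  p , pr , divides (product ps) (trans eq (ℕₚ.*-comm p _))

prime-∣-prime : ∀ {p q} → Prime p → Prime q → p ∣ q → p ≡ q
prime-∣-prime pp pq p∣q with prime⇒irreducible pq p∣q
... | inj₁ refl = contradiction pp ¬prime[1]
... | inj₂ eq   = eq

∤⇒coprime : ∀ {p m} → Prime p → ¬ p ∣ m → Coprime p m
∤⇒coprime pp p∤m (d∣p , d∣m) with prime⇒irreducible pp d∣p
... | inj₁ d≡1  = d≡1
... | inj₂ refl = contradiction d∣m p∤m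

prime[3] : Prime 3
prime[3] = toWitness {a? = prime? 3} _

prime[5] : Prime 5
prime[5] = toWitness {a? = prime? 5} _

prime[7] : Prime 7
prime[7] = toWitness {a? = prime? 7} _

primes-coprime : ∀ {p q} → Prime p → Prime q → p ≢ q → Coprime p q
primes-coprime pp pq p≢q = ∤⇒coprime pp (p≢q ∘ prime-∣-prime pp pq)

module _ {P : ℕ → Set ℓ₁} (P? : ∀ k → Dec (P k)) where

  minimal : ∀ m → P m → ∃ λ k → P k × (∀ j → P j → k ≤ j)
  minimal = <-rec _ λ m rec Pm → case ℕₚ.anyUpTo? P? m of λ
    { (yes (j , j<m , Pj)) → rec j<m Pj
    ; (no ∄)               → m , Pm , λ j Pj → ℕₚ.≮⇒≥ λ j<m → ∄ (j , j<m , Pj)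
    }

-- Powers and components in groups of finite exponent

module Powers (G : Group ℓ₁ ℓ₂) where
  open Group G renaming (refl to ≈-refl; sym to ≈-sym; trans to ≈-trans)
  open Algebra.Properties.Monoid.Mult monoid using (×-congʳ; ×-congˡ; ×-homo-+; ×-assocˡ)
  open Algebra.Properties.Group G using (∙-cancelˡ; inverseʳ-unique)
  open Relation.Binary.Reasoning.Setoid setoid

  infixr 8 _^′_
  _^′_ : Carrier → ℕ → Carrier
  _^′_ = _^^_ G

  ^-cong : ∀ {x y} k → x ≈ y → x ^′ k ≈ y ^′ k
  ^-cong k = ×-congʳ k

  ^-≡ : ∀ x {j k} → j ≡ k → x ^′ j ≈ x ^′ k
  ^-≡ x refl = ≈-refl

  ^-+ : ∀ x m n → x ^′ (m + n) ≈ x ^′ m ∙ x ^′ n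
  ^-+ = ×-homo-+

  ^-* : ∀ x m n → (x ^′ n) ^′ m ≈ x ^′ (m * n)
  ^-* = ×-assocˡ

  ^-1 : ∀ x → x ^′ 1 ≈ x
  ^-1 = identityʳ

  ε^ : ∀ k → ε ^′ k ≈ ε
  ε^ zero    = ≈-refl
  ε^ (suc k) = ≈-trans (identityˡ _) (ε^ k)

  ^-ε : ∀ {x} k → x ≈ ε → x ^′ k ≈ ε
  ^-ε k x≈ε = ≈-trans (^-cong k x≈ε) (ε^ k)

  ^-∣ : ∀ {x m n} → m ∣ n → x ^′ m ≈ ε → x ^′ n ≈ ε
  ^-∣ {x} {m} (divides q refl) e = ≈-trans (≈-sym (^-* x q m)) (^-ε q e)

  ^-swap : ∀ x m n → (x ^′ m) ^′ n ≈ (x ^′ n) ^′ m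
  ^-swap x m n = begin
    (x ^′ m) ^′ n ≈⟨ ^-* x n m ⟩
    x ^′ (n * m)  ≈⟨ ^-≡ x (ℕₚ.*-comm n m) ⟩
    x ^′ (m * n)  ≈⟨ ^-* x m n ⟨
    (x ^′ n) ^′ m ∎

  ^-% : ∀ {x} N .{{_ : NonZero N}} k → x ^′ N ≈ ε → x ^′ k ≈ x ^′ (k % N)
  ^-% {x} N k e = begin
    x ^′ k                           ≈⟨ ^-≡ x (m≡m%n+[m/n]*n k N) ⟩
    x ^′ (k % N + (k / N) * N)       ≈⟨ ^-+ x (k % N) _ ⟩
    x ^′ (k % N) ∙ x ^′ ((k / N) * N) ≈⟨ ∙-congˡ (^-∣ {x} (divides (k / N) refl) e) ⟩
    x ^′ (k % N) ∙ ε                 ≈⟨ identityʳ _ ⟩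
    x ^′ (k % N)                     ∎

  commute-^ : ∀ {x z} k → x ∙ z ≈ z ∙ x → x ^′ k ∙ z ≈ z ∙ x ^′ k
  commute-^ zero    _ = ≈-trans (identityˡ _) (≈-sym (identityʳ _))
  commute-^ {x} {z} (suc k) xz≈zx = begin
    (x ∙ x ^′ k) ∙ z ≈⟨ assoc _ _ _ ⟩
    x ∙ (x ^′ k ∙ z) ≈⟨ ∙-congˡ (commute-^ k xz≈zx) ⟩
    x ∙ (z ∙ x ^′ k) ≈⟨ assoc _ _ _ ⟨
    (x ∙ z) ∙ x ^′ k ≈⟨ ∙-congʳ xz≈zx ⟩
    (z ∙ x) ∙ x ^′ k ≈⟨ assoc _ _ _ ⟩
    z ∙ (x ∙ x ^′ k) ∎

  ∙-^ : ∀ {x z} k → x ∙ z ≈ z ∙ x → (x ∙ z) ^′ k ≈ x ^′ k ∙ z ^′ k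
  ∙-^ zero    _ = ≈-sym (identityˡ ε)
  ∙-^ {x} {z} (suc k) xz≈zx = begin
    (x ∙ z) ∙ (x ∙ z) ^′ k          ≈⟨ ∙-congˡ (∙-^ k xz≈zx) ⟩
    (x ∙ z) ∙ (x ^′ k ∙ z ^′ k)     ≈⟨ assoc _ _ _ ⟩
    x ∙ (z ∙ (x ^′ k ∙ z ^′ k))     ≈⟨ ∙-congˡ (assoc _ _ _) ⟨
    x ∙ ((z ∙ x ^′ k) ∙ z ^′ k)     ≈⟨ ∙-congˡ (∙-congʳ (commute-^ k xz≈zx)) ⟨
    x ∙ ((x ^′ k ∙ z) ∙ z ^′ k)     ≈⟨ ∙-congˡ (assoc _ _ _) ⟩
    x ∙ (x ^′ k ∙ (z ∙ z ^′ k))     ≈⟨ assoc _ _ _ ⟨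
    (x ∙ x ^′ k) ∙ (z ∙ z ^′ k)     ∎

  -- Bézout over ℕ gives `1 + v * b ≡ u * a` or its mirror image, and both multiples kill `x`.
  coprime-trivial : ∀ {x a b} → Coprime a b → x ^′ a ≈ ε → x ^′ b ≈ ε → x ≈ ε
  coprime-trivial {x} {a} {b} cop xa xb with coprime-Bézout cop
  ... | Bézout.+- u v eq = begin
    x                     ≈⟨ identityʳ x ⟨
    x ∙ ε                 ≈⟨ ∙-congˡ (^-∣ {x} (divides v refl) xb) ⟨
    x ∙ x ^′ (v * b)      ≈⟨ ^-≡ x eq ⟩
    x ^′ (u * a)          ≈⟨ ^-∣ {x} (divides u refl) xa ⟩
    ε                     ∎
  ... | Bézout.-+ u v eq = begin
    x                     ≈⟨ identityʳ x ⟨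
    x ∙ ε                 ≈⟨ ∙-congˡ (^-∣ {x} (divides u refl) xa) ⟨
    x ∙ x ^′ (u * a)      ≈⟨ ^-≡ x eq ⟩
    x ^′ (v * b)          ≈⟨ ^-∣ {x} (divides v refl) xb ⟩
    ε                     ∎

  order-∣ : ∀ {x m k} → HasOrder G x m → x ^′ k ≈ ε → m ∣ k
  order-∣ {x} {m} {k} (m>0 , xm , least) xk = m%n≡0⇒n∣m k m (helper (k % m) refl)
    where
    instance
      m≢0 : NonZero m
      m≢0 = >-nonZero m>0
    helper : ∀ r → k % m ≡ r → r ≡ 0
    helper zero    _  = refl
    helper (suc r) eq = contradiction
      (ℕₚ.≤-<-trans (least (suc r) z<s (≈-trans (^-≡ x (sym eq)) (≈-trans (≈-sym (^-% m k xm)) xk)))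
        (subst (_< m) eq (m%n<n k m)))
      (ℕₚ.<-irrefl refl)

  order-unique : ∀ {x y m n} → x ≈ y → HasOrder G x m → HasOrder G y n → m ≡ n
  order-unique {m = m} {n} x≈y ox@(_ , xm , _) oy@(_ , yn , _) = ∣-antisym
    (order-∣ {k = n} ox (≈-trans (^-cong n x≈y) yn))
    (order-∣ {k = m} oy (≈-trans (^-cong m (≈-sym x≈y)) xm))

  prime-order : ∀ {x p} → Prime p → ¬ x ≈ ε → x ^′ p ≈ ε → HasOrder G x p
  prime-order {x} {p} pp x≉ε xp = prime>0 pp , xp , λ k k>0 xk → ℕₚ.≮⇒≥ λ k<p →
    x≉ε (coprime-trivial (prime⇒coprime pp {{>-nonZero k>0}} k<p) xp xk)

  module FiniteOrder (_≟_ : Decidable _≈_)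
                     (torsion : ∀ x → ∃ λ N → 0 < N × x ^′ N ≈ ε) where

    infix 4 _∼_
    _∼_ : Rel (G₀ G) _
    _∼_ = Setoid._≈_ (components (P₀ G))

    open Setoid (components (P₀ G)) public
      using () renaming (refl to ∼-refl; sym to ∼-sym; trans to ∼-trans; reflexive to ∼-reflexive)

    ≈⇒∼ : {x y : G₀ G} → proj₁ x ≈ proj₁ y → x ∼ y
    ≈⇒∼ x≈y = EqClosure.return (inj₁ x≈y)

    power⇒∼ : {x y : G₀ G} → _IsPositivePowerOf_ G (proj₁ x) (proj₁ y) → x ∼ y
    power⇒∼ {x} {y} xy with proj₁ x ≟ proj₁ y
    ... | yes x≈y = ≈⇒∼ x≈y
    ... | no  x≉y = EqClosure.return (inj₂ (x≉y , inj₁ xy))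

    positive-^ : ∀ {x} k → ¬ x ^′ k ≈ ε → 0 < k
    positive-^ zero    ¬e = contradiction ≈-refl ¬e
    positive-^ (suc k) _  = z<s

    ^⇒∼ : ∀ {x} (x≉ε : ¬ x ≈ ε) k (xk≉ε : ¬ x ^′ k ≈ ε) → (x , x≉ε) ∼ (x ^′ k , xk≉ε)
    ^⇒∼ {x} x≉ε k xk≉ε = ∼-sym (power⇒∼ (k , positive-^ k xk≉ε , ≈-refl))

    -- As `a` and `b` are coprime, `x ^′ b` is non-trivial, and it equals `(x ∙ z) ^′ b`; likewise
    -- `z ^′ a` equals `(x ∙ z) ^′ a`. The walk is `x`, `x ^′ b`, `x ∙ z`, `z ^′ a`, `z`.
    commuting⇒∼ : ∀ {x z a b} → Coprime a b → x ^′ a ≈ ε → z ^′ b ≈ ε → x ∙ z ≈ z ∙ x →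
                  (x≉ε : ¬ x ≈ ε) (z≉ε : ¬ z ≈ ε) → (x , x≉ε) ∼ (z , z≉ε)
    commuting⇒∼ {x} {z} {a} {b} cop xa zb xz≈zx x≉ε z≉ε = ∼-trans (toProduct b x≉ε xb≉ε eqx)
        (∼-sym (toProduct a z≉ε za≉ε eqz))
      where
      xb≉ε : ¬ x ^′ b ≈ ε
      xb≉ε = x≉ε ∘ coprime-trivial cop xa
      za≉ε : ¬ z ^′ a ≈ ε
      za≉ε za = z≉ε (coprime-trivial cop za zb)
      eqx : (x ∙ z) ^′ b ≈ x ^′ b
      eqx = ≈-trans (∙-^ b xz≈zx) (≈-trans (∙-congˡ zb) (identityʳ _))
      eqz : (x ∙ z) ^′ a ≈ z ^′ a
      eqz = ≈-trans (∙-^ a xz≈zx) (≈-trans (∙-congʳ xa) (identityˡ _))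
      xz≉ε : ¬ x ∙ z ≈ ε
      xz≉ε e = xb≉ε (≈-trans (≈-sym eqx) (^-ε b e))
      toProduct : ∀ {w} k (w≉ε : ¬ w ≈ ε) → (wk≉ε : ¬ w ^′ k ≈ ε) → (x ∙ z) ^′ k ≈ w ^′ k →
                  (w , w≉ε) ∼ (x ∙ z , xz≉ε)
      toProduct k w≉ε wk≉ε eq = ∼-trans (^⇒∼ w≉ε k wk≉ε)
        (power⇒∼ (k , positive-^ k wk≉ε , ≈-sym eq))

    PrimePower : Carrier → Set _
    PrimePower x = ∃₂ λ p k → Prime p × ¬ x ^′ k ≈ ε × (x ^′ k) ^′ p ≈ ε

    -- Descent on an exponent `m` that kills `x`: for `m ≡ j * p` with `p` prime, either `x ^′ j` is
    -- the required power or `j` is a smaller exponent that kills `x`.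
    primePower : ∀ {x} → ¬ x ≈ ε → PrimePower x
    primePower {x} x≉ε = let N , N>0 , xN = torsion x in
        <-rec (λ m → 0 < m → x ^′ m ≈ ε → PrimePower x) step N N>0 xN
      where
      step : ∀ m → (∀ {j} → j < m → 0 < j → x ^′ j ≈ ε → PrimePower x) →
             0 < m → x ^′ m ≈ ε → PrimePower x
      step 1 _ _ x1 = contradiction (≈-trans (≈-sym (^-1 x)) x1) x≉ε
      step m@(2+ _) rec _ xm with primeDivisor m (s≤s (s≤s z≤n))
      ... | p , pp , divides j eq with (x ^′ j) ≟ ε
      ...   | no  xj≉ε = p , j , pp , xj≉ε ,
                ≈-trans (^-* x p j) (≈-trans (^-≡ x (trans (ℕₚ.*-comm p j) (sym eq))) xm)
      ...   | yes xj = rec j<m (>-nonZero⁻¹ j) xj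
        where
        instance
          j≢0 : NonZero j
          j≢0 = ≢-nonZero λ { refl → case eq of λ () }
        j<m : j < m
        j<m = subst (j <_) (sym eq) (ℕₚ.m<m*n j p (prime>1 pp))

    order : ∀ x → ∃ (HasOrder G x)
    order x = let N , N>0 , xN = torsion x
                  k , (k>0 , xk) , least = minimal (λ k → (1 ≤? k) ×-dec ((x ^′ k) ≟ ε)) N (N>0 , xN)
              in k , k>0 , xk , λ j j>0 xj → least j (j>0 , xj)
      where open ℕₚ using (_≤?_)

    ordersVertex : Set _
    ordersVertex = Graph.Vertex (O₀ G)

    infix 4 _∼ₒ_
    _∼ₒ_ : Rel ordersVertex _
    _∼ₒ_ = Setoid._≈_ (components (O₀ G))

    open Setoid (components (O₀ G)) public
      using () renaming (refl to ∼ₒ-refl; sym to ∼ₒ-sym; trans to ∼ₒ-trans)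

    ∣⇒∼ₒ : {u v : ordersVertex} → proj₁ u ∣ proj₁ v → u ∼ₒ v
    ∣⇒∼ₒ {u} {v} d with proj₁ u ℕₚ.≟ proj₁ v
    ... | yes eq = EqClosure.return (inj₁ eq)
    ... | no neq = EqClosure.return (inj₂ (neq , inj₁ d))

    power⇒order-∣ : ∀ {x y m n} → _IsPositivePowerOf_ G x y → HasOrder G x m → HasOrder G y n → m ∣ n
    power⇒order-∣ {x} {y} {n = n} (k , _ , x≈yk) ox (_ , yn , _) = order-∣ {k = n} ox
      (≈-trans (^-cong n x≈yk) (≈-trans (^-swap y k n) (^-ε k yn)))

    -- The order of a power divides the order of its base, so walks of elements are carried to walks
    -- of orders. `vertex` uses the order computed by `order`, and `same` compares it with the one
    -- that is given.
    ∼⇒∼ₒ : ∀ {x y m n} → x ∼ y → (ox : HasOrder G (proj₁ x) m) (oy : HasOrder G (proj₁ y) n) →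
           (m , x , ox) ∼ₒ (n , y , oy)
    ∼⇒∼ₒ {x} {y} x∼y ox oy =
      ∼ₒ-trans (same x ox)
        (∼ₒ-trans (EqClosure.gfold (Setoid.isEquivalence (components (O₀ G))) vertex step x∼y)
          (∼ₒ-sym (same y oy)))
      where
      vertex : G₀ G → ordersVertex
      vertex x = _ , x , proj₂ (order (proj₁ x))
      same : ∀ {m} x (ox : HasOrder G (proj₁ x) m) → (m , x , ox) ∼ₒ vertex x
      same x ox = EqClosure.return (inj₁ (order-unique ≈-refl ox (proj₂ (order (proj₁ x)))))
      step : ∀ {x y} → Graph._≈_ (P₀ G) x y ⊎ Graph.Adj (P₀ G) x y → vertex x ∼ₒ vertex y
      step {x} {y} (inj₁ x≈y) = EqClosure.return
        (inj₁ (order-unique x≈y (proj₂ (order (proj₁ x))) (proj₂ (order (proj₁ y)))))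
      step {x} {y} (inj₂ (_ , inj₁ xy)) = ∣⇒∼ₒ
        (power⇒order-∣ xy (proj₂ (order (proj₁ x))) (proj₂ (order (proj₁ y))))
      step {x} {y} (inj₂ (_ , inj₂ yx)) = ∼ₒ-sym (∣⇒∼ₒ
        (power⇒order-∣ yx (proj₂ (order (proj₁ y))) (proj₂ (order (proj₁ x)))))

    P₀-hasComponents : ∀ {k} {L : Set} → L ↔ Fin k → (label : G₀ G → L) →
      (∀ x y → _IsPositivePowerOf_ G (proj₁ x) (proj₁ y) → label x ≡ label y) →
      (rep : L → G₀ G) → (∀ l → label (rep l) ≡ l) → (∀ x → x ∼ rep (label x)) →
      P₀ G HasComponents k
    P₀-hasComponents bij label label-power = hasComponents-by {G = P₀ G} bij label
      (λ {x} {y} x≈y → label-power x y (1 , z<s , ≈-trans x≈y (≈-sym (^-1 _))))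
      λ { {x} {y} (_ , inj₁ xy) → label-power x y xy
        ; {x} {y} (_ , inj₂ yx) → sym (label-power y x yx) }

    infix 4 _∼̃_
    _∼̃_ : Rel (G₀ G) _
    _∼̃_ = Setoid._≈_ (components (P̃₀ G))

    open Setoid (components (P̃₀ G)) using ()
      renaming (refl to ∼̃-refl; sym to ∼̃-sym; trans to ∼̃-trans)

    positivePower : ∀ {x y} → ⟨_⟩ G x y → _IsPositivePowerOf_ G y x
    positivePower {x} {y} (k , eq) = let N , N>0 , xN = torsion x in helper N N>0 xN k eq
      where
      helper : ∀ N → 0 < N → x ^′ N ≈ ε → ∀ k → y ≈ _^ᶻ_ G x k → _IsPositivePowerOf_ G y x
      -- The added period keeps the exponent positive when `k` is 0.
      helper N N>0 xN (ℤ.+ k) eq = k + N , ℕₚ.<-≤-trans N>0 (ℕₚ.m≤n+m N k) ,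
        ≈-trans eq (≈-sym (≈-trans (^-+ x k N) (≈-trans (∙-congˡ xN) (identityʳ _))))
      -- This exponent plus `suc k` makes `suc (suc k)` periods of length `suc N`, so the power is
      -- the inverse of `x ^′ suc k`.
      helper (suc N) _ xN -[1+ k ] eq = suc k * N + suc N , ℕₚ.<-≤-trans z<s (ℕₚ.m≤n+m _ (suc k * N)) ,
        ≈-trans eq (≈-sym (inverseʳ-unique (x ^′ suc k) _
          (≈-trans (≈-sym (^-+ x (suc k) (suc k * N + suc N)))
            (^-∣ {x} {suc N} (divides (suc (suc k))
               (trans (sym (ℕₚ.+-assoc (suc k) (suc k * N) (suc N)))
                 (trans (cong (_+ suc N) (sym (ℕₚ.*-suc (suc k) N))) (ℕₚ.+-comm _ (suc N))))) xN))))

    self : ∀ x → ⟨_⟩ G x x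
    self x = ℤ.+ 1 , ≈-sym (^-1 x)

    member? : ∀ x y → Dec (⟨_⟩ G x y)
    member? x y = let N , N>0 , xN = torsion x in helper N N>0 xN
      where
      helper : ∀ N → 0 < N → x ^′ N ≈ ε → Dec (⟨_⟩ G x y)
      helper N@(suc _) _ xN = map′
        (λ (k , _ , eq) → ℤ.+ k , eq)
        (λ m → let k , _ , eq = positivePower m in k % N , m%n<n k N , ≈-trans eq (^-% N k xN))
        (ℕₚ.anyUpTo? (λ k → y ≟ (x ^′ k)) N)

    private
      ℤ-≈ : ∀ {x y} → x ≈ y → ∀ k → _^ᶻ_ G x k ≈ _^ᶻ_ G y k
      ℤ-≈ x≈y (ℤ.+ k)   = ^-cong k x≈y
      ℤ-≈ x≈y -[1+ k ]  = ⁻¹-cong (^-cong (suc k) x≈y)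

      ⟨⟩-≈ : ∀ {x y} → x ≈ y → ∀ {z} → ⟨_⟩ G x z → ⟨_⟩ G y z
      ⟨⟩-≈ x≈y (k , eq) = k , ≈-trans eq (ℤ-≈ x≈y k)

      subgroup : ∀ {x y} → ⟨_⟩ G y x → ∀ {z} → ⟨_⟩ G x z → ⟨_⟩ G y z
      subgroup {x} {y} x∈y z∈x =
        let j , _ , x≈ = positivePower x∈y
            k , _ , z≈ = positivePower z∈x
        in ℤ.+ (k * j) , ≈-trans z≈ (≈-trans (^-cong k x≈) (^-* y k j))

    -- Both graphs have the elements of `G₀ G` as carrier, and the two component relations on it
    -- coincide, so the given bijection serves again.
    P̃₀-hasComponents : ∀ {k} → P₀ G HasComponents k → P̃₀ G HasComponents k
    P̃₀-hasComponents f = record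
      { to        = F.to
      ; cong      = F.cong ∘ backward
      ; bijective = forward ∘ F.injective
        , λ i → let x , ok = F.surjective i in x , ok ∘ backward
      }
      where
      module F = Bijection f
      sameGroup : ∀ {x y} → Graph._≈_ (P̃₀ G) x y → x ∼ y
      sameGroup {x} {y} (x⊆y , _) = power⇒∼ (positivePower (x⊆y (self (proj₁ x))))
      representative : ∀ {x} (x₀ : G₀ G) → _∈[_] G x (proj₁ x₀) → Σ (¬ x ≈ ε) λ x≉ε → (x , x≉ε) ∼ x₀
      representative {x} (x₀ , x₀≉ε) (⊆ , ⊇) = x≉ε , sameGroup (⊆ , ⊇)
        where
        x≉ε : ¬ x ≈ ε
        x≉ε e = let k , _ , eq = positivePower (⊇ (self x₀)) in x₀≉ε (≈-trans eq (^-ε k e))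
      adjacent : ∀ {x y} → (∃₂ λ x′ y′ → _∈[_] G x′ (proj₁ x) × _∈[_] G y′ (proj₁ y) × _IsPositivePowerOf_ G x′ y′) →
                 x ∼ y
      adjacent {x} {y} (x′ , y′ , x′∈ , y′∈ , pow) =
        ∼-trans (∼-sym (proj₂ (representative x x′∈)))
          (∼-trans (power⇒∼ pow) (proj₂ (representative y y′∈)))
      backward : ∀ {x y} → x ∼̃ y → x ∼ y
      backward = EqClosure.fold (Setoid.isEquivalence (components (P₀ G))) λ
        { (inj₁ eq)            → sameGroup eq
        ; (inj₂ (_ , inj₁ xy)) → adjacent xy
        ; (inj₂ (_ , inj₂ yx)) → ∼-sym (adjacent yx)
        }
      sameVertex : ∀ {x y} → Graph._≈_ (P̃₀ G) x y → x ∼̃ y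
      sameVertex eq = EqClosure.return (inj₁ eq)
      ∈-refl : ∀ x → _∈[_] G x x
      ∈-refl x = (λ z∈ → z∈) , λ z∈ → z∈
      powers : ∀ {x y} → _IsPositivePowerOf_ G (proj₁ x) (proj₁ y) → x ∼̃ y
      -- If `y` is in turn a power of `x`, the two are one vertex of `P̃₀` and no edge can join
      -- them.
      powers {x} {y} pow@(k , _ , x≈) with member? (proj₁ x) (proj₁ y)
      ... | yes y∈x = sameVertex (subgroup (ℤ.+ k , x≈) , subgroup y∈x)
      ... | no  y∉x = EqClosure.return (inj₂
              ( (λ (_ , y⊆x) → y∉x (y⊆x (self (proj₁ y))))
              , inj₁ (proj₁ x , proj₁ y , ∈-refl (proj₁ x) , ∈-refl (proj₁ y) , pow) ))
      forward : ∀ {x y} → x ∼ y → x ∼̃ y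
      forward = EqClosure.fold (Setoid.isEquivalence (components (P̃₀ G))) λ
        { (inj₁ x≈y)           → sameVertex (⟨⟩-≈ x≈y , ⟨⟩-≈ (≈-sym x≈y))
        ; (inj₂ (_ , inj₁ xy)) → powers xy
        ; (inj₂ (_ , inj₂ yx)) → ∼̃-sym (powers yx)
        }

-- Permutations

Inj : {A B : Set} → (A → B) → Set
Inj = Injective _≡_ _≡_

∉-head : ∀ {A : Set} {x y : A} {xs} → x ∉ y ∷ xs → x ≢ y
∉-head x∉ refl = x∉ (here refl)

∉-tail : ∀ {A : Set} {x y : A} {xs} → x ∉ y ∷ xs → x ∉ xs
∉-tail x∉ x∈ = x∉ (there x∈)

-- `σ` is applied before the remaining iterations, as in `_^^_`, since `_∘ₚ_` composes from left to
-- right.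
iterate : {A : Set} → ℕ → (A → A) → A → A
iterate zero    σ a = a
iterate (suc k) σ a = iterate k σ (σ a)

iterate≡^ : ∀ {r} (σ : Perm.Permutation′ r) k i → iterate k (σ ⟨$⟩ʳ_) i ≡ _^^_ (Sym r) σ k ⟨$⟩ʳ i
iterate≡^ σ zero    i = refl
iterate≡^ σ (suc k) i = iterate≡^ σ k (σ ⟨$⟩ʳ i)

module _ {n : ℕ} where

  -- If `xs` contained every point, the positions in `xs` would embed `Fin n` into
  -- `Fin (length xs)`.
  fresh : (xs : List (Fin n)) → length xs < n → ∃ λ b → b ∉ xs
  fresh xs l<n with Finₚ.any? (λ b → ¬? (member Finₚ._≟_ b xs))
  ... | yes found = found
  ... | no  none  = contradiction l<n (ℕₚ.≤⇒≯ (Finₚ.injective⇒≤ {f = λ b → index (all∈ b)}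
          (λ {b} {b′} → Memberₚ.index-injective (≡ₚ.setoid (Fin n)) (all∈ b) (all∈ b′))))
    where
    all∈ : ∀ b → b ∈ xs
    all∈ b with member Finₚ._≟_ b xs
    ... | yes b∈ = b∈
    ... | no  b∉ = contradiction (b , b∉) none

  freshes : ∀ k (xs : List (Fin n)) → length xs + k ≤ n →
            Σ (Fin k → Fin n) λ a → Inj a × (∀ i → a i ∉ xs)
  freshes zero    xs l≤n = (λ ()) , (λ { {()} }) , λ ()
  freshes (suc k) xs l≤n = a , a-inj , a∉
    where
    b : ∃ λ b → b ∉ xs
    b = fresh xs (ℕₚ.<-≤-trans (ℕₚ.m<m+n (length xs) z<s) l≤n)
    rest : Σ (Fin k → Fin n) λ a → Inj a × (∀ i → a i ∉ (proj₁ b ∷ xs))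
    rest = freshes k (proj₁ b ∷ xs) (subst (_≤ n) (ℕₚ.+-suc (length xs) k) l≤n)
    a : Fin (suc k) → Fin n
    a zero    = proj₁ b
    a (suc i) = proj₁ rest i
    a-inj : Inj a
    a-inj {zero}  {zero}  _  = refl
    a-inj {zero}  {suc j} eq = contradiction (here (sym eq)) (proj₂ (proj₂ rest) j)
    a-inj {suc i} {zero}  eq = contradiction (here eq) (proj₂ (proj₂ rest) i)
    a-inj {suc i} {suc j} eq = cong suc (proj₁ (proj₂ rest) eq)
    a∉ : ∀ i → a i ∉ xs
    a∉ zero    = proj₂ b
    a∉ (suc i) = ∉-tail (proj₂ (proj₂ rest) i)

  -- A missed point, put in front, would extend `f` to an injection of `suc n` points into `n`.
  injective⇒surjective : (f : Fin n → Fin n) → Inj f → ∀ j → ∃ λ i → f i ≡ j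
  injective⇒surjective f f-inj j with Finₚ.any? (λ i → f i Finₚ.≟ j)
  ... | yes found = found
  ... | no  none  = contradiction (Finₚ.injective⇒≤ {f = extended} extended-inj) ℕₚ.1+n≰n
    where
    extended : Fin (suc n) → Fin n
    extended zero    = j
    extended (suc i) = f i
    extended-inj : Inj extended
    extended-inj {zero}  {zero}  _  = refl
    extended-inj {zero}  {suc i} eq = contradiction (i , sym eq) none
    extended-inj {suc i} {zero}  eq = contradiction (i , eq) none
    extended-inj {suc i} {suc k} eq = cong suc (f-inj eq)

  fromInjection : (f : Fin n → Fin n) → Inj f → Perm.Permutation′ n
  fromInjection f f-inj = mk↔ₛ′ f (proj₁ ∘ onto) (proj₂ ∘ onto) (λ i → f-inj (proj₂ (onto (f i))))
    where
    onto = injective⇒surjective f f-inj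

-- The rotation of n points

%-absorb : ∀ a b n .{{_ : NonZero n}} → (a % n + b) % n ≡ (a + b) % n
%-absorb a b n = begin
  (a % n + b) % n             ≡⟨ %-distribˡ-+ (a % n) b n ⟩
  (a % n % n + b % n) % n     ≡⟨ cong (λ r → (r + b % n) % n) (m%n%n≡m%n a n) ⟩
  (a % n + b % n) % n         ≡⟨ %-distribˡ-+ a b n ⟨
  (a + b) % n                 ∎
  where open ≡-Reasoning

module _ {n : ℕ} .{{_ : NonZero n}} where

  private
    residue : ℕ → Fin n
    residue k = fromℕ< (m%n<n k n)

    toℕ-residue : ∀ k → toℕ (residue k) ≡ k % n
    toℕ-residue k = Finₚ.toℕ-fromℕ< (m%n<n k n)

    next previous : Fin n → Fin n
    next i     = residue (1 + toℕ i)
    previous i = residue (pred n + toℕ i)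

    toℕ-+n : ∀ (i : Fin n) → (suc (pred n) + toℕ i) % n ≡ toℕ i
    toℕ-+n i = begin
      (suc (pred n) + toℕ i) % n ≡⟨ cong (λ m → (m + toℕ i) % n) (ℕₚ.suc-pred n) ⟩
      (n + toℕ i) % n            ≡⟨ cong (_% n) (ℕₚ.+-comm n (toℕ i)) ⟩
      (toℕ i + n) % n            ≡⟨ [m+n]%n≡m%n (toℕ i) n ⟩
      toℕ i % n                  ≡⟨ m<n⇒m%n≡m (Finₚ.toℕ<n i) ⟩
      toℕ i                      ∎
      where open ≡-Reasoning

    residue-+ : ∀ a b (i : Fin n) → toℕ (residue (a + toℕ (residue (b + toℕ i)))) ≡ ((b + a) + toℕ i) % n
    residue-+ a b i = begin
      toℕ (residue (a + toℕ (residue (b + toℕ i)))) ≡⟨ toℕ-residue _ ⟩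
      (a + toℕ (residue (b + toℕ i))) % n          ≡⟨ cong (λ r → (a + r) % n) (toℕ-residue _) ⟩
      (a + (b + toℕ i) % n) % n                    ≡⟨ cong (_% n) (ℕₚ.+-comm a _) ⟩
      ((b + toℕ i) % n + a) % n                    ≡⟨ %-absorb (b + toℕ i) a n ⟩
      (b + toℕ i + a) % n                          ≡⟨ cong (_% n) (trans (ℕₚ.+-assoc b (toℕ i) a) (cong (b +_) (ℕₚ.+-comm (toℕ i) a))) ⟩
      (b + (a + toℕ i)) % n                        ≡⟨ cong (_% n) (ℕₚ.+-assoc b a (toℕ i)) ⟨
      ((b + a) + toℕ i) % n                        ∎
      where open ≡-Reasoning

  shift : Perm.Permutation′ n
  shift = mk↔ₛ′ next previous
    (λ i → Finₚ.toℕ-injective (trans (residue-+ 1 (pred n) i)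
      (trans (cong (λ m → (m + toℕ i) % n) (ℕₚ.+-comm (pred n) 1)) (toℕ-+n i))))
    (λ i → Finₚ.toℕ-injective (trans (residue-+ (pred n) 1 i) (toℕ-+n i)))

  toℕ-shift-^ : ∀ k i → toℕ (_^^_ (Sym n) shift k ⟨$⟩ʳ i) ≡ (k + toℕ i) % n
  toℕ-shift-^ zero    i = sym (m<n⇒m%n≡m (Finₚ.toℕ<n i))
  toℕ-shift-^ (suc k) i = begin
    toℕ (_^^_ (Sym n) shift k ⟨$⟩ʳ next i) ≡⟨ toℕ-shift-^ k (next i) ⟩
    (k + toℕ (next i)) % n                 ≡⟨ cong (λ r → (k + r) % n) (toℕ-residue _) ⟩
    (k + (1 + toℕ i) % n) % n              ≡⟨ cong (_% n) (ℕₚ.+-comm k _) ⟩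
    ((1 + toℕ i) % n + k) % n              ≡⟨ %-absorb (1 + toℕ i) k n ⟩
    (1 + toℕ i + k) % n                    ≡⟨ cong (λ r → suc r % n) (ℕₚ.+-comm (toℕ i) k) ⟩
    (suc k + toℕ i) % n                    ∎
    where open ≡-Reasoning

  shift-^n : ∀ i → _^^_ (Sym n) shift n ⟨$⟩ʳ i ≡ i
  shift-^n i = Finₚ.toℕ-injective (trans (toℕ-shift-^ n i)
    (trans (cong (λ m → (m + toℕ i) % n) (sym (ℕₚ.suc-pred n))) (toℕ-+n i)))

-- Periods of points and extension of permutations

module Permutations (n : ℕ) where

  Π : Set
  Π = Perm.Permutation′ n

  open Powers (Sym n) public
  open Group (Sym n) public using (_≈_; _∙_; ε)

  infix 4 _≟_
  _≟_ : Decidable _≈_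
  π ≟ ρ = Finₚ.all? λ i → (π ⟨$⟩ʳ i) Finₚ.≟ (ρ ⟨$⟩ʳ i)

  ⟨$⟩-inj : (x : Π) → Inj (x ⟨$⟩ʳ_)
  ⟨$⟩-inj x eq = trans (sym (Perm.inverseˡ x)) (trans (cong (x ⟨$⟩ˡ_) eq) (Perm.inverseˡ x))

  ^-period-* : ∀ {x : Π} {d a} q → x ^′ d ⟨$⟩ʳ a ≡ a → x ^′ (q * d) ⟨$⟩ʳ a ≡ a
  ^-period-* zero e = refl
  ^-period-* {x} {d} {a} (suc q) e = trans (^-+ x d (q * d) a)
    (trans (cong (x ^′ (q * d) ⟨$⟩ʳ_) e) (^-period-* {x} q e))

  fixed-^ : ∀ {x : Π} k {a} → x ⟨$⟩ʳ a ≡ a → x ^′ k ⟨$⟩ʳ a ≡ a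
  fixed-^ zero        xa = refl
  fixed-^ {x} (suc k) xa = trans (cong (x ^′ k ⟨$⟩ʳ_) xa) (fixed-^ {x} k xa)

  ^-suc : ∀ (x : Π) j a → x ^′ suc j ⟨$⟩ʳ a ≡ x ⟨$⟩ʳ (x ^′ j ⟨$⟩ʳ a)
  ^-suc x j a = trans (^-≡ x (ℕₚ.+-comm 1 j) a) (^-+ x j 1 a)

  ^-period-consecutive : ∀ {x : Π} {j k a} → 1 + j ≡ k →
                         x ^′ j ⟨$⟩ʳ a ≡ a → x ^′ k ⟨$⟩ʳ a ≡ a → x ⟨$⟩ʳ a ≡ a
  ^-period-consecutive {x} {j} {a = a} refl ej ek = trans (cong (x ⟨$⟩ʳ_) (sym ej)) (trans (sym (^-suc x j a)) ek)

  -- Bézout turns the periods `d` and `e` of `a` into two consecutive ones, and these differ by one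
  -- application of `x`.
  ^-period-coprime : ∀ {x : Π} {d e a} → Coprime d e →
                     x ^′ d ⟨$⟩ʳ a ≡ a → x ^′ e ⟨$⟩ʳ a ≡ a → x ⟨$⟩ʳ a ≡ a
  ^-period-coprime {x} {d} {e} {a} cop xd xe with coprime-Bézout cop
  ... | Bézout.+- u v eq = ^-period-consecutive {x} eq (^-period-* {x} v xe) (^-period-* {x} u xd)
  ... | Bézout.-+ u v eq = ^-period-consecutive {x} eq (^-period-* {x} u xd) (^-period-* {x} v xe)

  ^-difference : ∀ (x : Π) {j k a} → j ≤ k → x ^′ j ⟨$⟩ʳ a ≡ x ^′ k ⟨$⟩ʳ a → x ^′ (k ∸ j) ⟨$⟩ʳ a ≡ a
  ^-difference x {j} {k} {a} j≤k eq = ⟨$⟩-inj (x ^′ j) (begin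
    x ^′ j ⟨$⟩ʳ (x ^′ (k ∸ j) ⟨$⟩ʳ a) ≡⟨ ^-+ x (k ∸ j) j a ⟨
    x ^′ (k ∸ j + j) ⟨$⟩ʳ a           ≡⟨ ^-≡ x (ℕₚ.m∸n+n≡m j≤k) a ⟩
    x ^′ k ⟨$⟩ʳ a                     ≡⟨ eq ⟨
    x ^′ j ⟨$⟩ʳ a                     ∎)
    where open ≡-Reasoning

  -- By pigeonhole among `n + 1` iterates every point has a period of at most `n`, which divides
  -- `n !`; so one exponent serves all points.
  torsion : ∀ x → ∃ λ N → 0 < N × x ^′ N ≈ ε
  torsion x = n ! , >-nonZero⁻¹ (n !) {{n ℕₚ.!≢0}} , λ i →
    let j , k , j<k , eq = Finₚ.pigeonhole (ℕₚ.n<1+n n) (λ j → x ^′ toℕ j ⟨$⟩ʳ i)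
        d>0 = ℕₚ.m<n⇒0<n∸m j<k
        divides q q≡ = ∣-trans (m∣m! d>0) (m≤n⇒m!∣n! (ℕₚ.≤-trans (ℕₚ.m∸n≤m (toℕ k) (toℕ j)) (ℕₚ.≤-pred (Finₚ.toℕ<n k))))
    in trans (^-≡ x q≡ i) (^-period-* {x} q (^-difference x (ℕₚ.<⇒≤ j<k) eq))
    where
    m∣m! : ∀ {m} → 0 < m → m ∣ m !
    m∣m! {suc m} _ = m∣m*n (m !)

  open FiniteOrder _≟_ torsion public

  ≉⇒moved : ∀ {x} → ¬ x ≈ ε → ∃ λ a → x ⟨$⟩ʳ a ≢ a
  ≉⇒moved {x} x≉ε = Finₚ.¬∀⟶∃¬ n _ (λ a → (x ⟨$⟩ʳ a) Finₚ.≟ a) x≉ε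

  module _ {y : Π} {p : ℕ} (pp : Prime p) (yp : y ^′ p ≈ ε) where

    -- The difference of two distinct exponents below `p` is coprime to `p`, so a coincidence would
    -- make `a` a fixed point.
    orbit-inj : ∀ {a j k} → y ⟨$⟩ʳ a ≢ a → j < p → k < p →
                y ^′ j ⟨$⟩ʳ a ≡ y ^′ k ⟨$⟩ʳ a → j ≡ k
    orbit-inj {a} {j} {k} ya≢a j<p k<p eq with ℕₚ.<-cmp j k
    ... | tri≈ _ j≡k _ = j≡k
    ... | tri< j<k _ _ = contradiction (^-period-coprime {y}
            (prime⇒coprime pp {{>-nonZero (ℕₚ.m<n⇒0<n∸m j<k)}} (ℕₚ.≤-<-trans (ℕₚ.m∸n≤m k j) k<p))
            (yp a) (^-difference y (ℕₚ.<⇒≤ j<k) eq)) ya≢a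
    ... | tri> _ _ k<j = contradiction (^-period-coprime {y}
            (prime⇒coprime pp {{>-nonZero (ℕₚ.m<n⇒0<n∸m k<j)}} (ℕₚ.≤-<-trans (ℕₚ.m∸n≤m j k) j<p))
            (yp a) (^-difference y (ℕₚ.<⇒≤ k<j) (sym eq))) ya≢a

  infix 4 _commutesWith_
  _commutesWith_ : Rel Π _
  x commutesWith z = x ∙ z ≈ z ∙ x

  -- A permutation of `A` is transported along `f` and completed by the identity. `A` is left open
  -- so that it can index points (`Fin r`) as well as the points of several orbits
  -- (`Fin p × Fin r`).
  module Extension {A : Set} (f : A → Fin n) (f-inj : Inj f)
                   (image? : ∀ i → Dec (∃ λ a → f a ≡ i)) where

    extendFun : (A → A) → Fin n → Fin n
    extendFun σ i with image? i
    ... | yes (a , _) = f (σ a)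
    ... | no  _       = i

    extendFun-image : ∀ σ a → extendFun σ (f a) ≡ f (σ a)
    extendFun-image σ a with image? (f a)
    ... | yes (b , fb≡fa) = cong (f ∘ σ) (f-inj fb≡fa)
    ... | no  ∄           = contradiction (a , refl) ∄

    extendFun-outside : ∀ σ {i} → ¬ (∃ λ a → f a ≡ i) → extendFun σ i ≡ i
    extendFun-outside σ {i} ∄ with image? i
    ... | yes ∃a = contradiction ∃a ∄
    ... | no  _  = refl

    extendFun-inverse : ∀ {σ τ} → (∀ a → σ (τ a) ≡ a) → ∀ i → extendFun σ (extendFun τ i) ≡ i
    extendFun-inverse {σ} {τ} inv i with image? i
    ... | yes (a , refl) = trans (extendFun-image σ (τ a)) (cong f (inv a))
    ... | no  ∄          = extendFun-outside σ ∄

    extend : A ↔ A → Π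
    extend σ = mk↔ₛ′ (extendFun (Inverse.to σ)) (extendFun (Inverse.from σ))
      (extendFun-inverse (Inverse.strictlyInverseˡ σ)) (extendFun-inverse (Inverse.strictlyInverseʳ σ))

    module _ (σ : A ↔ A) where

      extend-^-image : ∀ k a → extend σ ^′ k ⟨$⟩ʳ f a ≡ f (iterate k (Inverse.to σ) a)
      extend-^-image zero    a = refl
      extend-^-image (suc k) a =
        trans (cong (extend σ ^′ k ⟨$⟩ʳ_) (extendFun-image (Inverse.to σ) a)) (extend-^-image k _)

      extend-^-outside : ∀ k {i} → ¬ (∃ λ a → f a ≡ i) → extend σ ^′ k ⟨$⟩ʳ i ≡ i
      extend-^-outside zero    ∄ = refl
      extend-^-outside (suc k) ∄ =
        trans (cong (extend σ ^′ k ⟨$⟩ʳ_) (extendFun-outside (Inverse.to σ) ∄)) (extend-^-outside k ∄)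

      extend-^-ε : ∀ k → (∀ a → iterate k (Inverse.to σ) a ≡ a) → extend σ ^′ k ≈ ε
      extend-^-ε k e i with image? i
      ... | yes (a , refl) = trans (extend-^-image k a) (cong f (e a))
      ... | no  ∄          = extend-^-outside k ∄

      -- On the image `y` acts as `η`, which commutes with `σ`. As `η` is onto, `y` also preserves
      -- the complement of the image, where `extend σ` is the identity.
      extend-commutes : ∀ {y} (η : A ↔ A) → (∀ a → y ⟨$⟩ʳ f a ≡ f (Inverse.to η a)) →
        (∀ a → Inverse.to η (Inverse.to σ a) ≡ Inverse.to σ (Inverse.to η a)) →
        y commutesWith extend σ
      extend-commutes {y} η yf ησ i with image? i
      ... | yes (a , refl) = trans (cong (extendFun (Inverse.to σ)) (yf a))
              (trans (extendFun-image (Inverse.to σ) _) (trans (cong f (sym (ησ a))) (sym (yf _))))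
      ... | no  ∄ = extendFun-outside (Inverse.to σ) λ (a , fa≡yi) →
              ∄ (Inverse.from η a , ⟨$⟩-inj y (trans (yf _) (trans (cong f (Inverse.strictlyInverseˡ η a)) fa≡yi)))

-- Commuting rotations of points and orbits

pair : ∀ {A : Set} → A → A → Fin 2 → A
pair x y zero    = x
pair x y (suc _) = y

pair-inj : ∀ {A : Set} {x y : A} → x ≢ y → Inj (pair x y)
pair-inj x≢y {zero}     {zero}     _  = refl
pair-inj x≢y {zero}     {suc zero} eq = contradiction eq x≢y
pair-inj x≢y {suc zero} {zero}     eq = contradiction (sym eq) x≢y
pair-inj x≢y {suc zero} {suc zero} _  = refl

module Rotations (n : ℕ) where
  open Permutations n public

  shift-moves : ∀ {r} → shift {2+ r} ⟨$⟩ʳ zero ≢ zero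
  shift-moves ()

  module Cycle {r : ℕ} (a : Fin (2+ r) → Fin n) (a-inj : Inj a) where
    open Extension a a-inj (λ j → Finₚ.any? λ i → a i Finₚ.≟ j)

    cycle : Π
    cycle = extend shift

    cycle-^ : cycle ^′ (2+ r) ≈ ε
    cycle-^ = extend-^-ε shift (2+ r) λ i → trans (iterate≡^ shift (2+ r) i) (shift-^n i)

    cycle≉ε : ¬ cycle ≈ ε
    cycle≉ε e = shift-moves {r} (a-inj (trans (sym (extendFun-image _ zero)) (e (a zero))))

    cycle₀ : G₀ (Sym n)
    cycle₀ = cycle , cycle≉ε

    cycle-outside : ∀ {j} → (∀ i → a i ≢ j) → cycle ⟨$⟩ʳ j ≡ j
    cycle-outside ∉ = extendFun-outside _ λ (i , eq) → ∉ i eq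

    fixing⇒∼cycle : ∀ {y p} → Coprime p (2+ r) → y ^′ p ≈ ε → (y≉ε : ¬ y ≈ ε) →
                    (∀ i → y ⟨$⟩ʳ a i ≡ a i) → (y , y≉ε) ∼ cycle₀
    fixing⇒∼cycle {y} cop yp y≉ε fix = commuting⇒∼ cop yp cycle-^
      (extend-commutes shift {y} Perm.id fix λ _ → refl) y≉ε cycle≉ε

  open Cycle public using (cycle; cycle₀; cycle-^; cycle≉ε; cycle-outside; fixing⇒∼cycle)

  -- The orbits of the points `a i` form a grid whose coordinates are the exponent and the index of
  -- the orbit. `y` shifts the first coordinate and `rotation` the second, so they commute.
  module OrbitRotation {y : Π} {p : ℕ} (pp : Prime p) (yp : y ^′ p ≈ ε) {r : ℕ}
                       (a : Fin (2+ r) → Fin n) (moved : ∀ i → y ⟨$⟩ʳ a i ≢ a i)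
                       (apart : ∀ {i j} k → y ^′ k ⟨$⟩ʳ a i ≡ a j → i ≡ j) where

    private
      instance
        p≢0 : NonZero p
        p≢0 = >-nonZero (prime>0 pp)

      A : Set
      A = Fin p × Fin (2+ r)

      f : A → Fin n
      f (k , i) = y ^′ toℕ k ⟨$⟩ʳ a i

      f-inj : Inj f
      -- Applying `y ^′ (p ∸ toℕ k)` to both sides returns one of them to `a i`, so `a i` lies in
      -- the orbit of `a j`.
      f-inj {k , i} {l , j} eq with apart (toℕ l + (p ∸ toℕ k)) (begin
          y ^′ (toℕ l + (p ∸ toℕ k)) ⟨$⟩ʳ a j        ≡⟨ ^-+ y (toℕ l) (p ∸ toℕ k) (a j) ⟩
          y ^′ (p ∸ toℕ k) ⟨$⟩ʳ (y ^′ toℕ l ⟨$⟩ʳ a j) ≡⟨ cong (y ^′ (p ∸ toℕ k) ⟨$⟩ʳ_) eq ⟨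
          y ^′ (p ∸ toℕ k) ⟨$⟩ʳ (y ^′ toℕ k ⟨$⟩ʳ a i) ≡⟨ ^-+ y (toℕ k) (p ∸ toℕ k) (a i) ⟨
          y ^′ (toℕ k + (p ∸ toℕ k)) ⟨$⟩ʳ a i        ≡⟨ ^-≡ y (ℕₚ.m+[n∸m]≡n (ℕₚ.<⇒≤ (Finₚ.toℕ<n k))) (a i) ⟩
          y ^′ p ⟨$⟩ʳ a i                            ≡⟨ yp (a i) ⟩
          a i ∎)
        where open ≡-Reasoning
      ... | refl = cong (_, i) (Finₚ.toℕ-injective
                     (orbit-inj {y} pp yp (moved i) (Finₚ.toℕ<n k) (Finₚ.toℕ<n l) eq))

      image? : ∀ j → Dec (∃ λ a → f a ≡ j)
      image? j = map′ (λ (k , i , eq) → (k , i) , eq) (λ ((k , i) , eq) → k , i , eq)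
        (Finₚ.any? λ k → Finₚ.any? λ i → f (k , i) Finₚ.≟ j)

      open Extension f f-inj image?

      alongOrbits acrossOrbits : A ↔ A
      alongOrbits  = mk↔ₛ′ (λ (k , i) → shift ⟨$⟩ʳ k , i) (λ (k , i) → shift ⟨$⟩ˡ k , i)
        (λ (k , i) → cong (_, i) (Perm.inverseʳ shift)) (λ (k , i) → cong (_, i) (Perm.inverseˡ shift))
      acrossOrbits = mk↔ₛ′ (λ (k , i) → k , shift ⟨$⟩ʳ i) (λ (k , i) → k , shift ⟨$⟩ˡ i)
        (λ (k , i) → cong (k ,_) (Perm.inverseʳ (shift {2+ r}))) (λ (k , i) → cong (k ,_) (Perm.inverseˡ (shift {2+ r})))

      iterate-across : ∀ m k i → iterate m (Inverse.to acrossOrbits) (k , i) ≡ (k , _^^_ (Sym (2+ r)) shift m ⟨$⟩ʳ i)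
      iterate-across zero    k i = refl
      iterate-across (suc m) k i = iterate-across m k (shift ⟨$⟩ʳ i)

      y-along : ∀ b → y ⟨$⟩ʳ f b ≡ f (Inverse.to alongOrbits b)
      y-along (k , i) = begin
        y ⟨$⟩ʳ (y ^′ toℕ k ⟨$⟩ʳ a i)        ≡⟨ ^-suc y (toℕ k) (a i) ⟨
        y ^′ suc (toℕ k) ⟨$⟩ʳ a i           ≡⟨ ^-% {y} p (suc (toℕ k)) yp (a i) ⟩
        y ^′ (suc (toℕ k) % p) ⟨$⟩ʳ a i     ≡⟨ ^-≡ y (toℕ-shift-^ 1 k) (a i) ⟨
        y ^′ toℕ (shift ⟨$⟩ʳ k) ⟨$⟩ʳ a i    ∎
        where open ≡-Reasoning

    rotation : Π
    rotation = extend acrossOrbits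

    rotation-^ : rotation ^′ (2+ r) ≈ ε
    rotation-^ = extend-^-ε acrossOrbits (2+ r) λ (k , i) →
      trans (iterate-across (2+ r) k i) (cong (k ,_) (shift-^n i))

    rotation≉ε : ¬ rotation ≈ ε
    rotation≉ε e = shift-moves {r} (cong proj₂ (f-inj {0p , shift ⟨$⟩ʳ zero} {0p , zero} (trans (sym (extendFun-image _ (0p , zero))) (e (f (0p , zero))))))
      where
      0p : Fin p
      0p = fromℕ< (prime>0 pp)

    rotation₀ : G₀ (Sym n)
    rotation₀ = rotation , rotation≉ε

    rotation-outside : ∀ {j} → (∀ k i → y ^′ toℕ {p} k ⟨$⟩ʳ a i ≢ j) → rotation ⟨$⟩ʳ j ≡ j
    rotation-outside ∉ = extendFun-outside _ λ ((k , i) , eq) → ∉ k i eq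

    ∼rotation : Coprime p (2+ r) → (y≉ε : ¬ y ≈ ε) → (y , y≉ε) ∼ rotation₀
    ∼rotation cop y≉ε = commuting⇒∼ cop yp rotation-^
      (extend-commutes acrossOrbits {y} alongOrbits y-along λ _ → refl) y≉ε rotation≉ε

  orbit-sym : ∀ {y p} → Prime p → y ^′ p ≈ ε → ∀ k {a b} → y ^′ k ⟨$⟩ʳ b ≡ a → ∃ λ l → y ^′ l ⟨$⟩ʳ a ≡ b
  orbit-sym {y} {p} pp yp k {a} {b} eq = p ∸ k′ , (begin
      y ^′ (p ∸ k′) ⟨$⟩ʳ a                   ≡⟨ cong (y ^′ (p ∸ k′) ⟨$⟩ʳ_) (trans (sym eq) (^-% {y} p k yp b)) ⟩
      y ^′ (p ∸ k′) ⟨$⟩ʳ (y ^′ k′ ⟨$⟩ʳ b)    ≡⟨ ^-+ y k′ (p ∸ k′) b ⟨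
      y ^′ (k′ + (p ∸ k′)) ⟨$⟩ʳ b            ≡⟨ ^-≡ y (ℕₚ.m+[n∸m]≡n (ℕₚ.<⇒≤ (m%n<n k p))) b ⟩
      y ^′ p ⟨$⟩ʳ b                          ≡⟨ yp b ⟩
      b                                      ∎)
    where
    open ≡-Reasoning
    instance
      p≢0 : NonZero p
      p≢0 = >-nonZero (prime>0 pp)
    k′ = k % p

  orbit : Π → ℕ → Fin n → List (Fin n)
  orbit y p a = tabulate λ (k : Fin p) → y ^′ toℕ k ⟨$⟩ʳ a

  ∈-orbit : ∀ {y p} → Prime p → y ^′ p ≈ ε → ∀ k {a} → (y ^′ k ⟨$⟩ʳ a) ∈ orbit y p a
  ∈-orbit {y} {p} pp yp k {a} = subst (_∈ orbit y p a)
      (trans (^-≡ y (Finₚ.toℕ-fromℕ< (m%n<n k p)) a) (sym (^-% {y} p k yp a)))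
      (∈-tabulate⁺ {f = λ (k : Fin p) → y ^′ toℕ k ⟨$⟩ʳ a} (fromℕ< (m%n<n k p)))
    where
    instance
      p≢0 : NonZero p
      p≢0 = >-nonZero (prime>0 pp)

  -- Beside the orbit of a moved point there are two further points. If `y` fixes both, their
  -- transposition commutes with `y`; otherwise one of them starts a second orbit of length `p`, and
  -- exchanging the two orbits is the involution.
  oddPrime∼involution : ∀ {y p} → Prime p → p ≢ 2 → p + 2 ≤ n → y ^′ p ≈ ε → (y≉ε : ¬ y ≈ ε) →
    ∃ λ (z : G₀ (Sym n)) → proj₁ z ^′ 2 ≈ ε × (y , y≉ε) ∼ z
  oddPrime∼involution {y} {p} pp p≢2 p+2≤n yp y≉ε
    with ≉⇒moved {y} y≉ε
  ... | a , ya≢a with freshes 2 (orbit y p a) (subst (λ l → l + 2 ≤ n) (sym (length-tabulate _)) p+2≤n)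
  ... | b , b-inj , b∉ with Finₚ.all? (λ i → (y ⟨$⟩ʳ b i) Finₚ.≟ b i)
  ... | yes fixed = cycle₀ b b-inj , cycle-^ b b-inj , fixing⇒∼cycle b b-inj {y} (primes-coprime pp prime[2] p≢2) yp y≉ε fixed
  ... | no ¬fixed with Finₚ.¬∀⟶∃¬ 2 _ (λ i → (y ⟨$⟩ʳ b i) Finₚ.≟ b i) ¬fixed
  ... | i , moved = rotation₀ , rotation-^ , ∼rotation (primes-coprime pp prime[2] p≢2) y≉ε
    where
    apart : ∀ {j k} m → y ^′ m ⟨$⟩ʳ pair a (b i) j ≡ pair a (b i) k → j ≡ k
    apart {zero}     {zero}     _ _  = refl
    apart {zero}     {suc zero} m eq = contradiction (subst (_∈ orbit y p a) eq (∈-orbit {y} pp yp m)) (b∉ i)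
    apart {suc zero} {zero}     m eq = let l , eq′ = orbit-sym {y} pp yp m eq in
      contradiction (subst (_∈ orbit y p a) eq′ (∈-orbit {y} pp yp l)) (b∉ i)
    apart {suc zero} {suc zero} _ _  = refl
    pair-moved : ∀ j → y ⟨$⟩ʳ pair a (b i) j ≢ pair a (b i) j
    pair-moved zero       = ya≢a
    pair-moved (suc zero) = moved
    open OrbitRotation {y} pp yp (pair a (b i)) pair-moved apart

  -- An involution with at most two 2-cycles fixes three points.
  data InvolutionShape (y : Π) : Set where
    fixesThree  : (a : Fin 3 → Fin n) → Inj a → (∀ i → y ⟨$⟩ʳ a i ≡ a i) → InvolutionShape y
    threeCycles : (a : Fin 3 → Fin n) → (∀ i → y ⟨$⟩ʳ a i ≢ a i) →
                  (∀ {i j} k → y ^′ k ⟨$⟩ʳ a i ≡ a j → i ≡ j) → InvolutionShape y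

  involutionShape : ∀ {y} → 7 ≤ n → y ^′ 2 ≈ ε → ¬ y ≈ ε → InvolutionShape y
  involutionShape {y} 7≤n y2 y≉ε = let a , ya≢a = ≉⇒moved {y} y≉ε in one a ya≢a (movedOutside (a ∷ (y ⟨$⟩ʳ a) ∷ []))
    where
    movedOutside : ∀ xs → Dec (∃ λ b → y ⟨$⟩ʳ b ≢ b × b ∉ xs)
    movedOutside xs = Finₚ.any? λ b → ¬? ((y ⟨$⟩ʳ b) Finₚ.≟ b) ×-dec ¬? (member Finₚ._≟_ b xs)
    fixed : ∀ xs → length xs + 3 ≤ n → ¬ (∃ λ b → y ⟨$⟩ʳ b ≢ b × b ∉ xs) → InvolutionShape y
    fixed xs l ∄ = let b , b-inj , b∉ = freshes 3 xs l in fixesThree b b-inj λ i →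
      case (y ⟨$⟩ʳ b i) Finₚ.≟ b i of λ { (yes e) → e ; (no ne) → contradiction (b i , ne , b∉ i) ∄ }
    three : ∀ a b c → y ⟨$⟩ʳ a ≢ a → y ⟨$⟩ʳ b ≢ b → y ⟨$⟩ʳ c ≢ c →
            b ∉ (a ∷ (y ⟨$⟩ʳ a) ∷ []) → c ∉ (a ∷ (y ⟨$⟩ʳ a) ∷ b ∷ (y ⟨$⟩ʳ b) ∷ []) → InvolutionShape y
    three a b c ya≢a yb≢b yc≢c b∉ c∉ = threeCycles t t-moved (λ {i} {j} → apart i j)
      where
      t : Fin 3 → Fin n
      t zero          = a
      t (suc zero)    = b
      t (suc (suc _)) = c
      t-moved : ∀ i → y ⟨$⟩ʳ t i ≢ t i
      t-moved zero          = ya≢a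
      t-moved (suc zero)    = yb≢b
      t-moved (suc (suc _)) = yc≢c
      ^-cases : ∀ k x → y ^′ k ⟨$⟩ʳ x ≡ x ⊎ y ^′ k ⟨$⟩ʳ x ≡ y ⟨$⟩ʳ x
      ^-cases zero    x = inj₁ refl
      ^-cases (suc k) x with ^-cases k (y ⟨$⟩ʳ x)
      ... | inj₁ eq = inj₂ eq
      ... | inj₂ eq = inj₁ (trans eq (y2 x))
      different : ∀ x z k → x ≢ z → z ≢ y ⟨$⟩ʳ x → y ^′ k ⟨$⟩ʳ x ≢ z
      different x z k x≢z z≢yx eq with ^-cases k x
      ... | inj₁ e = x≢z (trans (sym e) eq)
      ... | inj₂ e = z≢yx (trans (sym eq) e)
      flip-≢ : ∀ {x z} → z ≢ y ⟨$⟩ʳ x → x ≢ y ⟨$⟩ʳ z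
      flip-≢ {x} {z} z≢yx x≡yz = z≢yx (trans (sym (y2 z)) (cong (y ⟨$⟩ʳ_) (sym x≡yz)))
      b≢a  = ∉-head b∉
      b≢ya = ∉-head (∉-tail b∉)
      c≢a  = ∉-head c∉
      c≢ya = ∉-head (∉-tail c∉)
      c≢b  = ∉-head (∉-tail (∉-tail c∉))
      c≢yb = ∉-head (∉-tail (∉-tail (∉-tail c∉)))
      apart : ∀ i j k → y ^′ k ⟨$⟩ʳ t i ≡ t j → i ≡ j
      apart zero             zero             k _ = refl
      apart zero             (suc zero)       k e = contradiction e (different a b k (b≢a ∘ sym) b≢ya)
      apart zero             (suc (suc zero)) k e = contradiction e (different a c k (c≢a ∘ sym) c≢ya)
      apart (suc zero)       zero             k e = contradiction e (different b a k b≢a (flip-≢ b≢ya))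
      apart (suc zero)       (suc zero)       k _ = refl
      apart (suc zero)       (suc (suc zero)) k e = contradiction e (different b c k (c≢b ∘ sym) c≢yb)
      apart (suc (suc zero)) zero             k e = contradiction e (different c a k c≢a (flip-≢ c≢ya))
      apart (suc (suc zero)) (suc zero)       k e = contradiction e (different c b k c≢b (flip-≢ c≢yb))
      apart (suc (suc zero)) (suc (suc zero)) k _ = refl
    two : ∀ a b → y ⟨$⟩ʳ a ≢ a → y ⟨$⟩ʳ b ≢ b → b ∉ (a ∷ (y ⟨$⟩ʳ a) ∷ []) →
          Dec (∃ λ c → y ⟨$⟩ʳ c ≢ c × c ∉ (a ∷ (y ⟨$⟩ʳ a) ∷ b ∷ (y ⟨$⟩ʳ b) ∷ [])) → InvolutionShape y
    two a b ya≢a yb≢b b∉ (yes (c , yc≢c , c∉)) = three a b c ya≢a yb≢b yc≢c b∉ c∉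
    -- The bound 7 is the four points of two 2-cycles plus three fixed points.
    two a b ya≢a yb≢b b∉ (no ∄) = fixed _ 7≤n ∄
    one : ∀ a → y ⟨$⟩ʳ a ≢ a → Dec (∃ λ b → y ⟨$⟩ʳ b ≢ b × b ∉ (a ∷ (y ⟨$⟩ʳ a) ∷ [])) → InvolutionShape y
    one a ya≢a (yes (b , yb≢b , b∉)) = two a b ya≢a yb≢b b∉ (movedOutside _)
    one a ya≢a (no ∄) = fixed _ (ℕₚ.≤-trans (ℕₚ.m≤n+m 5 2) 7≤n) ∄

  2⊥3 : Coprime 2 3
  2⊥3 = primes-coprime prime[2] prime[3] λ ()

  3⊥2 : Coprime 3 2
  3⊥2 = primes-coprime prime[3] prime[2] λ ()

  -- A 3-cycle on three points outside `xs` commutes with both transpositions, and its order is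
  -- coprime to 2.
  cycles-∼ : ∀ (xs : List (Fin n)) → length xs + 3 ≤ n → ∀ {a b : Fin 2 → Fin n} (a-inj : Inj a) (b-inj : Inj b) →
             (∀ i → a i ∈ xs) → (∀ i → b i ∈ xs) → cycle₀ a a-inj ∼ cycle₀ b b-inj
  cycles-∼ xs l {a} {b} a-inj b-inj a∈ b∈ = ∼-trans (to-c a-inj a∈) (∼-sym (to-c b-inj b∈))
    where
    fr = freshes 3 xs l
    c = proj₁ fr
    c-inj = proj₁ (proj₂ fr)
    to-c : ∀ {a} (a-inj : Inj a) → (∀ i → a i ∈ xs) → cycle₀ a a-inj ∼ cycle₀ c c-inj
    to-c {a} a-inj a∈ = fixing⇒∼cycle c c-inj {cycle a a-inj} 2⊥3 (cycle-^ a a-inj) (cycle≉ε a a-inj) λ i →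
      cycle-outside a a-inj λ j aj≡ci → proj₂ (proj₂ fr) i (subst (_∈ xs) aj≡ci (a∈ j))

  -- In the chain `(a0 a1)`, `(a0 c)`, `(b0 c)`, `(b0 b1)` neighbours share a point. Their supports
  -- lie within three points, which leaves the three points that `cycles-∼` needs.
  transpositions-∼ : 6 ≤ n → ∀ {a b : Fin 2 → Fin n} (a-inj : Inj a) (b-inj : Inj b) →
                     cycle₀ a a-inj ∼ cycle₀ b b-inj
  transpositions-∼ 6≤n {a} {b} a-inj b-inj =
      ∼-trans (cycles-∼ (a zero ∷ a (suc zero) ∷ c ∷ []) 6≤n a-inj (pair-inj (c≢a0 ∘ sym))
                (λ { zero → here refl ; (suc zero) → there (here refl) })
                (λ { zero → here refl ; (suc zero) → there (there (here refl)) }))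
        (∼-trans (cycles-∼ (a zero ∷ b zero ∷ c ∷ []) 6≤n (pair-inj (c≢a0 ∘ sym)) (pair-inj (c≢b0 ∘ sym))
                (λ { zero → here refl ; (suc zero) → there (there (here refl)) })
                (λ { zero → there (here refl) ; (suc zero) → there (there (here refl)) }))
          (cycles-∼ (b zero ∷ b (suc zero) ∷ c ∷ []) 6≤n (pair-inj (c≢b0 ∘ sym)) b-inj
                (λ { zero → here refl ; (suc zero) → there (there (here refl)) })
                (λ { zero → here refl ; (suc zero) → there (here refl) })))
    where
    fr = fresh (a zero ∷ b zero ∷ []) (ℕₚ.≤-trans (s≤s (s≤s (s≤s z≤n))) 6≤n)
    c = proj₁ fr
    c≢a0 : c ≢ a zero
    c≢a0 = ∉-head (proj₂ fr)
    c≢b0 : c ≢ b zero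
    c≢b0 = ∉-head (∉-tail (proj₂ fr))

  module Main (6≤n : 6 ≤ n) where

    abstract
      base-points : Σ (Fin 2 → Fin n) λ a → Inj a × (∀ i → a i ∉ [])
      base-points = freshes 2 [] (ℕₚ.≤-trans (s≤s (s≤s z≤n)) 6≤n)

      transposition₀ : G₀ (Sym n)
      transposition₀ = cycle₀ (proj₁ base-points) (proj₁ (proj₂ base-points))

      transposition-^2 : proj₁ transposition₀ ^′ 2 ≈ ε
      transposition-^2 = cycle-^ (proj₁ base-points) (proj₁ (proj₂ base-points))

      transposition-fixesTwo : Σ (Fin 2 → Fin n) λ a → Inj a × (∀ i → proj₁ transposition₀ ⟨$⟩ʳ a i ≡ a i)
      transposition-fixesTwo =
        let b = proj₁ base-points
            a , a-inj , a∉ = freshes 2 (tabulate b) (ℕₚ.≤-trans (ℕₚ.m≤n+m 4 2) 6≤n)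
        in a , a-inj , λ i → cycle-outside b (proj₁ (proj₂ base-points)) λ j bj≡ai → a∉ i (subst (_∈ tabulate b) bj≡ai (∈-tabulate⁺ {f = b} j))

      fixesTwo⇒∼ : ∀ {y p} → Coprime p 2 → y ^′ p ≈ ε → (y≉ε : ¬ y ≈ ε) → (a : Fin 2 → Fin n) → Inj a →
                   (∀ i → y ⟨$⟩ʳ a i ≡ a i) → (y , y≉ε) ∼ transposition₀
      fixesTwo⇒∼ {y} cop yp y≉ε a a-inj fix =
        ∼-trans (fixing⇒∼cycle a a-inj {y} cop yp y≉ε fix) (transpositions-∼ 6≤n {a} {proj₁ base-points} a-inj _)

    -- The 3-cycle on the three fixed points commutes with `y` and itself fixes two points of the
    -- rest, whose transposition comes next.
    fixesThree⇒∼ : ∀ {y} → y ^′ 2 ≈ ε → (y≉ε : ¬ y ≈ ε) → (a : Fin 3 → Fin n) → Inj a →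
                   (∀ i → y ⟨$⟩ʳ a i ≡ a i) → (y , y≉ε) ∼ transposition₀
    fixesThree⇒∼ {y} y2 y≉ε a a-inj fix = ∼-trans (fixing⇒∼cycle a a-inj {y} 2⊥3 y2 y≉ε fix)
        (fixesTwo⇒∼ {cycle a a-inj} 3⊥2 (cycle-^ a a-inj) (cycle≉ε a a-inj) (proj₁ fr) (proj₁ (proj₂ fr)) λ i →
          cycle-outside a a-inj λ j aj≡bi → proj₂ (proj₂ fr) i (subst (_∈ tabulate a) aj≡bi (∈-tabulate⁺ {f = a} j)))
      where
      fr = freshes 2 (tabulate a) (ℕₚ.≤-trans (ℕₚ.m≤n+m 5 1) 6≤n)

  module Large (8≤n : 8 ≤ n) where
    open Main (ℕₚ.≤-trans (ℕₚ.m≤n+m 6 2) 8≤n)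

    module _ {y : Π} (y2 : y ^′ 2 ≈ ε) (y≉ε : ¬ y ≈ ε) (a : Fin 3 → Fin n)
             (moved : ∀ i → y ⟨$⟩ʳ a i ≢ a i) (apart : ∀ {i j} k → y ^′ k ⟨$⟩ʳ a i ≡ a j → i ≡ j) where
      private
        module R = OrbitRotation {y} prime[2] y2 a moved apart
        moving : List (Fin n)
        moving = tabulate a ++ tabulate (λ i → y ⟨$⟩ʳ a i)
        ∈-moving : ∀ (k : Fin 2) j → (y ^′ toℕ k ⟨$⟩ʳ a j) ∈ moving
        ∈-moving zero       j = ∈-++⁺ˡ (∈-tabulate⁺ {f = a} j)
        ∈-moving (suc zero) j = ∈-++⁺ʳ (tabulate a) (∈-tabulate⁺ {f = λ i → y ⟨$⟩ʳ a i} j)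
        fr : Σ (Fin 2 → Fin n) λ b → Inj b × (∀ i → b i ∉ moving)
        fr = freshes 2 moving 8≤n
        fixes : ∀ i → R.rotation ⟨$⟩ʳ proj₁ fr i ≡ proj₁ fr i
        fixes i = R.rotation-outside λ k j eq → proj₂ (proj₂ fr) i (subst (_∈ moving) eq (∈-moving k j))
        step₁ : (y , y≉ε) ∼ R.rotation₀
        step₁ = R.∼rotation 2⊥3 y≉ε
        step₂ : R.rotation₀ ∼ transposition₀
        step₂ = fixesTwo⇒∼ {R.rotation} 3⊥2 R.rotation-^ R.rotation≉ε (proj₁ fr) (proj₁ (proj₂ fr)) fixes

      -- The rotation of the three 2-cycles has order 3 and moves only points in `moving`; `8 ≤ n`
      -- provides two points outside these six.
      threeCycles⇒∼ : (y , y≉ε) ∼ transposition₀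
      threeCycles⇒∼ = ∼-trans step₁ step₂

    shape⇒∼ : ∀ {y} → y ^′ 2 ≈ ε → (y≉ε : ¬ y ≈ ε) → InvolutionShape y → (y , y≉ε) ∼ transposition₀
    shape⇒∼ {y} y2 y≉ε (fixesThree a a-inj fix)    = fixesThree⇒∼ {y} y2 y≉ε a a-inj fix
    shape⇒∼ {y} y2 y≉ε (threeCycles a moved apart) = threeCycles⇒∼ {y} y2 y≉ε a moved apart

    involution∼transposition : ∀ {y} → y ^′ 2 ≈ ε → (y≉ε : ¬ y ≈ ε) → (y , y≉ε) ∼ transposition₀
    involution∼transposition {y} y2 y≉ε =
      shape⇒∼ {y} y2 y≉ε (involutionShape {y} (ℕₚ.≤-trans (ℕₚ.n≤1+n 7) 8≤n) y2 y≉ε)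

    large⇒∼ : ∀ {y p} → Prime p → p + 2 ≤ n → y ^′ p ≈ ε → (y≉ε : ¬ y ≈ ε) → Dec (p ≡ 2) →
              (y , y≉ε) ∼ transposition₀
    large⇒∼ {y} pp p+2≤n yp y≉ε (yes refl) = involution∼transposition {y} yp y≉ε
    large⇒∼ {y} pp p+2≤n yp y≉ε (no p≢2)   =
      let z , z2 , y∼z = oddPrime∼involution {y} pp p≢2 p+2≤n yp y≉ε
      in ∼-trans {y , y≉ε} {z} y∼z (involution∼transposition {proj₁ z} z2 (proj₂ z))

    ∼transposition : ∀ {y p} → Prime p → p + 2 ≤ n → y ^′ p ≈ ε → (y≉ε : ¬ y ≈ ε) → (y , y≉ε) ∼ transposition₀
    ∼transposition {y} {p} pp p+2≤n yp y≉ε = large⇒∼ {y} pp p+2≤n yp y≉ε (p ℕₚ.≟ 2)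

  primeOrder≤n : ∀ {y p} → Prime p → y ^′ p ≈ ε → ¬ y ≈ ε → p ≤ n
  primeOrder≤n {y} {p} pp yp y≉ε = let a , ya≢a = ≉⇒moved {y} y≉ε in
    Finₚ.injective⇒≤ {f = λ (k : Fin p) → y ^′ toℕ k ⟨$⟩ʳ a} λ {j} {k} eq →
      Finₚ.toℕ-injective (orbit-inj {y} pp yp ya≢a (Finₚ.toℕ<n j) (Finₚ.toℕ<n k) eq)

-- Labelling components

-- A complete invariant of components among the non-identity elements satisfying Q.
record Labelling (n : ℕ) (Q : Perm.Permutation′ n → Set) (L : Set) : Set where
  open Permutations n
  field
    label       : ∀ x → ¬ x ≈ ε → Q x → L
    label-power : ∀ {x y} k → x ≈ y ^′ k → ∀ x≉ε qx y≉ε qy → label x x≉ε qx ≡ label y y≉ε qy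
    rep         : L → Π
    rep≉ε       : ∀ l → ¬ rep l ≈ ε
    rep-Q       : ∀ l → Q (rep l)
    label-rep   : ∀ l → label (rep l) (rep≉ε l) (rep-Q l) ≡ l
    connect     : ∀ x x≉ε qx → (x , x≉ε) ∼ (rep (label x x≉ε qx) , rep≉ε _)

Everything : ∀ {n} → Perm.Permutation′ n → Set
Everything _ = ⊤

module _ {n : ℕ} where
  open Permutations n
  open Labelling

  labelling⇒hasComponents : ∀ {L k} → Labelling n Everything L → L ↔ Fin k → P₀ (Sym n) HasComponents k
  labelling⇒hasComponents Λ bij = P₀-hasComponents bij
    (λ (x , x≉ε) → label Λ x x≉ε tt)
    (λ (x , x≉ε) (y , y≉ε) (k , _ , x≈yk) → label-power Λ k x≈yk x≉ε tt y≉ε tt)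
    (λ l → rep Λ l , rep≉ε Λ l) (label-rep Λ)
    (λ (x , x≉ε) → connect Λ x x≉ε tt)

  module _ {R Q Q′ : Π → Set} (split : ∀ x → ¬ x ≈ ε → R x → Q x ⊎ Q′ x)
           (Q⇒R : ∀ {x} → Q x → R x) (Q′⇒R : ∀ {x} → Q′ x → R x)
           (apart  : ∀ {x y} k → x ≈ y ^′ k → ¬ x ≈ ε → Q x → ¬ Q′ y)
           (apart′ : ∀ {x y} k → x ≈ y ^′ k → ¬ x ≈ ε → Q′ x → ¬ Q y)
           {L L′ : Set} (Λ : Labelling n Q L) (Λ′ : Labelling n Q′ L′) where

    -- By `apart` and `apart′` no power relation crosses between `Q` and `Q′`, so no component meets
    -- both and the labels add up.
    labelling-⊎ : Labelling n R (L ⊎ L′)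
    labelling-⊎ = record
      { label       = λ x x≉ε r → label⊎ x x≉ε (split x x≉ε r)
      ; label-power = λ {x} {y} k x≈yk x≉ε r y≉ε s → power⊎ {x} {y} k x≈yk x≉ε y≉ε (split x x≉ε r) (split y y≉ε s)
      ; rep         = rep⊎
      ; rep≉ε       = rep⊎≉ε
      ; rep-Q       = rep⊎-R
      ; label-rep   = λ l → label-rep⊎ l (split (rep⊎ l) (rep⊎≉ε l) (rep⊎-R l))
      ; connect     = λ x x≉ε r → connect⊎ x x≉ε (split x x≉ε r)
      }
      where
      label⊎ : ∀ x → ¬ x ≈ ε → Q x ⊎ Q′ x → L ⊎ L′
      label⊎ x x≉ε (inj₁ q)  = inj₁ (label Λ x x≉ε q)
      label⊎ x x≉ε (inj₂ q′) = inj₂ (label Λ′ x x≉ε q′)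
      rep⊎ : L ⊎ L′ → Π
      rep⊎ = [ rep Λ , rep Λ′ ]′
      rep⊎≉ε : ∀ l → ¬ rep⊎ l ≈ ε
      rep⊎≉ε (inj₁ l)  = rep≉ε Λ l
      rep⊎≉ε (inj₂ l′) = rep≉ε Λ′ l′
      rep⊎-R : ∀ l → R (rep⊎ l)
      rep⊎-R (inj₁ l)  = Q⇒R (rep-Q Λ l)
      rep⊎-R (inj₂ l′) = Q′⇒R (rep-Q Λ′ l′)
      power⊎ : ∀ {x y} k → x ≈ y ^′ k → ∀ x≉ε y≉ε dx dy → label⊎ x x≉ε dx ≡ label⊎ y y≉ε dy
      power⊎ k e x≉ε y≉ε (inj₁ q)  (inj₁ r)  = cong inj₁ (label-power Λ k e x≉ε q y≉ε r)
      power⊎ k e x≉ε y≉ε (inj₂ q′) (inj₂ r′) = cong inj₂ (label-power Λ′ k e x≉ε q′ y≉ε r′)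
      power⊎ {x} {y} k e x≉ε y≉ε (inj₁ q)  (inj₂ r′) = contradiction r′ (apart {x} {y} k e x≉ε q)
      power⊎ {x} {y} k e x≉ε y≉ε (inj₂ q′) (inj₁ r)  = contradiction r (apart′ {x} {y} k e x≉ε q′)
      label-rep⊎ : ∀ l d → label⊎ (rep⊎ l) (rep⊎≉ε l) d ≡ l
      -- A label depends on the proofs supplied with the element; `label-power` with exponent 1
      -- exchanges them.
      label-rep⊎ (inj₁ l)  (inj₁ q)  = cong inj₁ (trans (label-power Λ 1 (λ _ → refl) _ q _ (rep-Q Λ l)) (label-rep Λ l))
      label-rep⊎ (inj₂ l′) (inj₂ q′) = cong inj₂ (trans (label-power Λ′ 1 (λ _ → refl) _ q′ _ (rep-Q Λ′ l′)) (label-rep Λ′ l′))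
      label-rep⊎ (inj₁ l)  (inj₂ q′) = contradiction q′ (apart {rep Λ l} {rep Λ l} 1 (λ _ → refl) (rep≉ε Λ l) (rep-Q Λ l))
      label-rep⊎ (inj₂ l′) (inj₁ q)  = contradiction q (apart′ {rep Λ′ l′} {rep Λ′ l′} 1 (λ _ → refl) (rep≉ε Λ′ l′) (rep-Q Λ′ l′))
      connect⊎ : ∀ x x≉ε d → (x , x≉ε) ∼ (rep⊎ (label⊎ x x≉ε d) , rep⊎≉ε (label⊎ x x≉ε d))
      connect⊎ x x≉ε (inj₁ q)  = connect Λ x x≉ε q
      connect⊎ x x≉ε (inj₂ q′) = connect Λ′ x x≉ε q′

-- Point stabilizers

module Insertion {m : ℕ} (b : Fin (suc m)) where
  private
    module S = Permutations m
    module T = Permutations (suc m)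

  -- The isomorphism of `Sym m` with the stabilizer of `b` in `Sym (suc m)`.
  ι : S.Π → T.Π
  ι = Perm.insert b b

  ι-b : ∀ π → ι π ⟨$⟩ʳ b ≡ b
  ι-b π with b Finₚ.≟ b
  ... | yes _  = refl
  ... | no b≢b = contradiction refl b≢b

  ι-punchIn : ∀ π j → ι π ⟨$⟩ʳ punchIn b j ≡ punchIn b (π ⟨$⟩ʳ j)
  ι-punchIn = Perm.insert-punchIn b b

  data View : Fin (suc m) → Set where
    at-b  : View b
    other : ∀ j → View (punchIn b j)

  view : ∀ i → View i
  view i with b Finₚ.≟ i
  ... | yes refl = at-b
  ... | no  b≢i  = subst View (Finₚ.punchIn-punchOut b≢i) (other (punchOut b≢i))

  ≈-byView : ∀ {x y : T.Π} → x ⟨$⟩ʳ b ≡ y ⟨$⟩ʳ b →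
             (∀ j → x ⟨$⟩ʳ punchIn b j ≡ y ⟨$⟩ʳ punchIn b j) → x T.≈ y
  ≈-byView eb eo i with view i
  ... | at-b    = eb
  ... | other j = eo j

  ι-cong : ∀ {π ρ} → π S.≈ ρ → ι π T.≈ ι ρ
  ι-cong {π} {ρ} eq = ≈-byView {ι π} {ι ρ} (trans (ι-b π) (sym (ι-b ρ)))
    λ j → trans (ι-punchIn π j) (trans (cong (punchIn b) (eq j)) (sym (ι-punchIn ρ j)))

  ι-injective : ∀ {π ρ} → ι π T.≈ ι ρ → π S.≈ ρ
  ι-injective {π} {ρ} eq j = Finₚ.punchIn-injective b _ _
    (trans (sym (ι-punchIn π j)) (trans (eq (punchIn b j)) (ι-punchIn ρ j)))

  ι-^-b : ∀ k π → ι π T.^′ k ⟨$⟩ʳ b ≡ b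
  ι-^-b zero    π = refl
  ι-^-b (suc k) π = trans (cong (ι π T.^′ k ⟨$⟩ʳ_) (ι-b π)) (ι-^-b k π)

  ι-^-punchIn : ∀ k π j → ι π T.^′ k ⟨$⟩ʳ punchIn b j ≡ punchIn b (π S.^′ k ⟨$⟩ʳ j)
  ι-^-punchIn zero    π j = refl
  ι-^-punchIn (suc k) π j = trans (cong (ι π T.^′ k ⟨$⟩ʳ_) (ι-punchIn π j)) (ι-^-punchIn k π (π ⟨$⟩ʳ j))

  ι-^ : ∀ k π → ι (π S.^′ k) T.≈ ι π T.^′ k
  ι-^ k π = ≈-byView {ι (π S.^′ k)} {ι π T.^′ k} (trans (ι-b (π S.^′ k)) (sym (ι-^-b k π)))
    λ j → trans (ι-punchIn (π S.^′ k) j) (sym (ι-^-punchIn k π j))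

  ι-ε : ι S.ε T.≈ T.ε
  ι-ε = ι-^ 0 S.ε

  ι-≉ε : ∀ {π} → ¬ π S.≈ S.ε → ¬ ι π T.≈ T.ε
  ι-≉ε {π} π≉ε e = π≉ε (ι-injective {π} {S.ε} λ i → trans (e i) (sym (ι-ε i)))

  ι-∼ : ∀ {π ρ} (π≉ε : ¬ π S.≈ S.ε) (ρ≉ε : ¬ ρ S.≈ S.ε) → (π , π≉ε) S.∼ (ρ , ρ≉ε) →
        (ι π , ι-≉ε {π} π≉ε) T.∼ (ι ρ , ι-≉ε {ρ} ρ≉ε)
  ι-∼ _ _ = EqClosure.gfold (Setoid.isEquivalence (components (P₀ (Sym (suc m)))))
      (λ (π , π≉ε) → ι π , ι-≉ε {π} π≉ε)
      λ { (inj₁ π≈ρ)                      → T.≈⇒∼ (ι-cong π≈ρ)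
        ; (inj₂ (_ , inj₁ (k , k>0 , e))) → T.power⇒∼ (k , k>0 , powers k e)
        ; (inj₂ (_ , inj₂ (k , k>0 , e))) → T.∼-sym (T.power⇒∼ (k , k>0 , powers k e)) }
    where
    powers : ∀ {π ρ} k → π S.≈ ρ S.^′ k → ι π T.≈ ι ρ T.^′ k
    powers {π} {ρ} k e i = trans (ι-cong {π} {ρ S.^′ k} e i) (ι-^ k ρ i)

  -- Inverse to `ι` on the stabilizer of `b` only.
  restrict : T.Π → S.Π
  restrict = Perm.remove b

  ι-restrict : ∀ {x} → x ⟨$⟩ʳ b ≡ b → ι (restrict x) T.≈ x
  ι-restrict {x} xb i = trans (cong (λ c → Perm.insert b c (restrict x) ⟨$⟩ʳ i) (sym xb)) (Perm.insert-remove b x i)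

  restrict-ι : ∀ π → restrict (ι π) S.≈ π
  restrict-ι = Perm.remove-insert b b

  restrict-≈^ : ∀ {x y} k → x T.≈ y T.^′ k → x ⟨$⟩ʳ b ≡ b → y ⟨$⟩ʳ b ≡ b → restrict x S.≈ restrict y S.^′ k
  restrict-≈^ {x} {y} k e xb yb = ι-injective {restrict x} {restrict y S.^′ k} λ i →
    trans (ι-restrict {x} xb i) (trans (e i)
      (sym (trans (ι-^ k (restrict y) i) (T.^-cong {ι (restrict y)} {y} k (ι-restrict {y} yb) i))))

  restrict-≉ε : ∀ {x} → x ⟨$⟩ʳ b ≡ b → ¬ x T.≈ T.ε → ¬ restrict x S.≈ S.ε
  restrict-≉ε {x} xb x≉ε e = x≉ε λ i →
    trans (sym (ι-restrict {x} xb i)) (trans (ι-cong {restrict x} {S.ε} e i) (ι-ε i))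

  restrict-^ε : ∀ {x} k → x ⟨$⟩ʳ b ≡ b → x T.^′ k T.≈ T.ε → restrict x S.^′ k S.≈ S.ε
  restrict-^ε {x} k xb e = ι-injective {restrict x S.^′ k} {S.ε} λ i →
    trans (ι-^ k (restrict x) i) (trans (T.^-cong {ι (restrict x)} {x} k (ι-restrict {x} xb) i) (trans (e i) (sym (ι-ε i))))

  ι-^ε : ∀ {π} k → π S.^′ k S.≈ S.ε → ι π T.^′ k T.≈ T.ε
  ι-^ε {π} k e i = trans (sym (ι-^ k π i)) (trans (ι-cong {π S.^′ k} {S.ε} e i) (ι-ε i))

-- Numbering the permutations by a Lehmer code: the image of 0, then the code of what remains

permIndex : ∀ m → Perm.Permutation′ m → Fin (m !)
permIndex zero    _ = zero
permIndex (suc m) π = combine (π ⟨$⟩ʳ zero) (permIndex m (Perm.remove zero π))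

indexPerm : ∀ m → Fin (m !) → Perm.Permutation′ m
indexPerm zero    _ = Perm.id
indexPerm (suc m) i = uncurry (λ j k → Perm.insert zero j (indexPerm m k)) (remQuot {suc m} (m !) i)

remove-cong : ∀ {m} {π ρ : Perm.Permutation′ (suc m)} → π Perm.≈ ρ → Perm.remove zero π Perm.≈ Perm.remove zero ρ
remove-cong {π = π} {ρ} e j = Finₚ.punchIn-injective (π ⟨$⟩ʳ zero) _ _ (begin
  punchIn (π ⟨$⟩ʳ zero) (Perm.remove zero π ⟨$⟩ʳ j) ≡⟨ Perm.punchIn-permute π zero j ⟨
  π ⟨$⟩ʳ suc j                                      ≡⟨ e (suc j) ⟩
  ρ ⟨$⟩ʳ suc j                                      ≡⟨ Perm.punchIn-permute ρ zero j ⟩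
  punchIn (ρ ⟨$⟩ʳ zero) (Perm.remove zero ρ ⟨$⟩ʳ j) ≡⟨ cong (λ i → punchIn i (Perm.remove zero ρ ⟨$⟩ʳ j)) (e zero) ⟨
  punchIn (π ⟨$⟩ʳ zero) (Perm.remove zero ρ ⟨$⟩ʳ j) ∎)
  where open ≡-Reasoning

insert-cong : ∀ {m} i {π ρ : Perm.Permutation′ m} → π Perm.≈ ρ → Perm.insert zero i π Perm.≈ Perm.insert zero i ρ
insert-cong i e zero    = refl
insert-cong i e (suc j) = cong (punchIn i) (e j)

permIndex-cong : ∀ m {π ρ} → π Perm.≈ ρ → permIndex m π ≡ permIndex m ρ
permIndex-cong zero    _ = refl
permIndex-cong (suc m) {π} {ρ} e = cong₂ combine (e zero) (permIndex-cong m (remove-cong {π = π} {ρ} e))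

permIndex-indexPerm : ∀ m i → permIndex m (indexPerm m i) ≡ i
permIndex-indexPerm zero    zero = refl
permIndex-indexPerm (suc m) i = trans
  (cong (combine j) (trans (permIndex-cong m (Perm.remove-insert zero j (indexPerm m k))) (permIndex-indexPerm m k)))
  (Finₚ.combine-remQuot {suc m} (m !) i)
  where
  j = proj₁ (remQuot {suc m} (m !) i)
  k = proj₂ (remQuot {suc m} (m !) i)

indexPerm-permIndex : ∀ m π → indexPerm m (permIndex m π) Perm.≈ π
indexPerm-permIndex zero    π ()
indexPerm-permIndex (suc m) π i = begin
  indexPerm (suc m) (combine j (permIndex m π′)) ⟨$⟩ʳ i
    ≡⟨ cong (λ q → uncurry (λ j k → Perm.insert zero j (indexPerm m k)) q ⟨$⟩ʳ i) (Finₚ.remQuot-combine {suc m} {m !} j _) ⟩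
  Perm.insert zero j (indexPerm m (permIndex m π′)) ⟨$⟩ʳ i
    ≡⟨ insert-cong j {indexPerm m (permIndex m π′)} {π′} (indexPerm-permIndex m π′) i ⟩
  Perm.insert zero j π′ ⟨$⟩ʳ i
    ≡⟨ Perm.insert-remove zero π i ⟩
  π ⟨$⟩ʳ i ∎
  where
  open ≡-Reasoning
  j  = π ⟨$⟩ʳ zero
  π′ = Perm.remove zero π

-- Elements of order p in degrees p and p + 1

module Exceptional {n p : ℕ} (pp : Prime p) (n≤1+p : n ≤ suc p) where
  open Rotations n

  module _ {y : Π} (yp : y ^′ p ≈ ε) {a : Fin n} (ya≢a : y ⟨$⟩ʳ a ≢ a) where

    Reached Missed : Fin n → Set
    Reached b = ∃ λ k → y ^′ k ⟨$⟩ʳ a ≡ b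
    Missed  b = ∀ k → y ^′ k ⟨$⟩ʳ a ≢ b

    reached-or-missed : ∀ b → Reached b ⊎ Missed b
    reached-or-missed b with Finₚ.any? {n = p} (λ k → (y ^′ toℕ k ⟨$⟩ʳ a) Finₚ.≟ b)
    ... | yes (k , eq) = inj₁ (toℕ k , eq)
    ... | no ∄         = inj₂ λ k eq → ∄ (fromℕ< (m%n<n k p) ,
            trans (^-≡ y (Finₚ.toℕ-fromℕ< (m%n<n k p)) a) (trans (sym (^-% {y} p k yp a)) eq))
      where
      instance
        p≢0 : NonZero p
        p≢0 = >-nonZero (prime>0 pp)

    -- Two missed points and the `p` points of the orbit would be `p + 2` distinct points, more than
    -- `n`.
    missed-unique : ∀ {b b′} → Missed b → Missed b′ → b ≡ b′
    missed-unique {b} {b′} mb mb′ with b Finₚ.≟ b′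
    ... | yes eq  = eq
    ... | no b≢b′ = contradiction (ℕₚ.≤-trans (Finₚ.injective⇒≤ {f = f} f-inj) n≤1+p) ℕₚ.1+n≰n
      where
      f : Fin (2+ p) → Fin n
      f zero          = b
      f (suc zero)    = b′
      f (suc (suc k)) = y ^′ toℕ k ⟨$⟩ʳ a
      f-inj : Inj f
      f-inj {zero}        {zero}        _  = refl
      f-inj {zero}        {suc zero}    eq = contradiction eq b≢b′
      f-inj {zero}        {suc (suc k)} eq = contradiction (sym eq) (mb (toℕ k))
      f-inj {suc zero}    {zero}        eq = contradiction (sym eq) b≢b′
      f-inj {suc zero}    {suc zero}    _  = refl
      f-inj {suc zero}    {suc (suc k)} eq = contradiction (sym eq) (mb′ (toℕ k))
      f-inj {suc (suc k)} {zero}        eq = contradiction eq (mb (toℕ k))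
      f-inj {suc (suc k)} {suc zero}    eq = contradiction eq (mb′ (toℕ k))
      f-inj {suc (suc k)} {suc (suc l)} eq = cong (λ i → suc (suc i)) (Finₚ.toℕ-injective
        (orbit-inj {y} pp yp ya≢a (Finₚ.toℕ<n k) (Finₚ.toℕ<n l) eq))

    missed⇒fixed : ∀ {b} → Missed b → y ⟨$⟩ʳ b ≡ b
    missed⇒fixed {b} mb = missed-unique missed-y mb
      where
      missed-y : Missed (y ⟨$⟩ʳ b)
      -- Modulo the period `p`, the exponent `k + pred p` is `k - 1`, so cancelling `y` would place
      -- `b` in the orbit of `a`.
      missed-y k eq = mb (k + pred p) (⟨$⟩-inj y (begin
        y ⟨$⟩ʳ (y ^′ (k + pred p) ⟨$⟩ʳ a)  ≡⟨ ^-suc y (k + pred p) a ⟨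
        y ^′ suc (k + pred p) ⟨$⟩ʳ a       ≡⟨ ^-≡ y (trans (cong suc (ℕₚ.+-comm k (pred p))) (cong (_+ k) (ℕₚ.suc-pred p {{>-nonZero (prime>0 pp)}}))) a ⟩
        y ^′ (p + k) ⟨$⟩ʳ a                ≡⟨ ^-+ y p k a ⟩
        y ^′ k ⟨$⟩ʳ (y ^′ p ⟨$⟩ʳ a)        ≡⟨ cong (y ^′ k ⟨$⟩ʳ_) (yp a) ⟩
        y ^′ k ⟨$⟩ʳ a                      ≡⟨ eq ⟩
        y ⟨$⟩ʳ b                           ∎))
        where open ≡-Reasoning

    reached⇒moved : ∀ {b} → Reached b → y ⟨$⟩ʳ b ≢ b
    reached⇒moved (k , refl) eq = ya≢a (⟨$⟩-inj (y ^′ k) (trans (sym (^-suc′ k)) eq))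
      where
      ^-suc′ : ∀ k → y ⟨$⟩ʳ (y ^′ k ⟨$⟩ʳ a) ≡ y ^′ k ⟨$⟩ʳ (y ⟨$⟩ʳ a)
      ^-suc′ k = sym (^-suc y k a)

    fixed⇒missed : ∀ {b} → y ⟨$⟩ʳ b ≡ b → Missed b
    fixed⇒missed yb≡b k eq = reached⇒moved (k , eq) yb≡b

    fixed-unique : ∀ {b b′} → y ⟨$⟩ʳ b ≡ b → y ⟨$⟩ʳ b′ ≡ b′ → b ≡ b′
    fixed-unique yb yb′ = missed-unique (fixed⇒missed yb) (fixed⇒missed yb′)

    -- On the orbit of `a`, commutation carries the agreement at `a` to every point. The missed
    -- point, if there is one, is the only fixed point of `y`, so `x` must fix it too.
    agree : ∀ {x j} → y commutesWith x → y ^′ j ⟨$⟩ʳ a ≡ x ⟨$⟩ʳ a → x ≈ y ^′ j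
    agree {x} {j} yx eq i with reached-or-missed i
    ... | inj₁ (k , refl) = begin
          x ⟨$⟩ʳ (y ^′ k ⟨$⟩ʳ a)       ≡⟨ commute-^ {y} {x} k yx a ⟩
          y ^′ k ⟨$⟩ʳ (x ⟨$⟩ʳ a)       ≡⟨ cong (y ^′ k ⟨$⟩ʳ_) eq ⟨
          y ^′ k ⟨$⟩ʳ (y ^′ j ⟨$⟩ʳ a)  ≡⟨ ^-+ y j k a ⟨
          y ^′ (j + k) ⟨$⟩ʳ a          ≡⟨ ^-≡ y (ℕₚ.+-comm j k) a ⟩
          y ^′ (k + j) ⟨$⟩ʳ a          ≡⟨ ^-+ y k j a ⟩
          y ^′ j ⟨$⟩ʳ (y ^′ k ⟨$⟩ʳ a)  ∎
      where open ≡-Reasoning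
    ... | inj₂ mi = trans (sym (fixed-unique yi (trans (sym (yx i)) (cong (x ⟨$⟩ʳ_) yi)))) (sym (fixed-^ {y} j yi))
      where
      yi : y ⟨$⟩ʳ i ≡ i
      yi = missed⇒fixed mi

    -- `x` cannot send the moved point `a` to a fixed point of `y`, so `x ⟨$⟩ʳ a` is in the orbit of
    -- `a` and `agree` applies.
    centralizer : ∀ {x} → y commutesWith x → ∃ λ j → x ≈ y ^′ j
    centralizer {x} yx with reached-or-missed (x ⟨$⟩ʳ a)
    ... | inj₁ (j , eq) = j , agree {x} {j} yx eq
    ... | inj₂ missed   = contradiction
            (⟨$⟩-inj x (trans (yx a) (missed⇒fixed missed))) ya≢a

  -- Away from the identity this says that `x` has order `p`.
  IsCyclic : Π → Set
  IsCyclic x = x ^′ p ≈ ε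

  isCyclic? : ∀ x → Dec (IsCyclic x)
  isCyclic? x = (x ^′ p) ≟ ε

  isCyclic-down : ∀ {x y} k → x ≈ y ^′ k → ¬ x ≈ ε → IsCyclic y → IsCyclic x
  isCyclic-down {x} {y} k e _ yp i =
    trans (^-cong {x} p e i) (trans (^-swap y k p i) (^-ε {y ^′ p} k yp i))

  -- `y` centralizes its own power `x`, hence is itself a power of `x`. So the elements of order `p`
  -- form a union of components.
  isCyclic-up : ∀ {x y} k → x ≈ y ^′ k → ¬ x ≈ ε → IsCyclic x → IsCyclic y
  isCyclic-up {x} {y} k e x≉ε xp i =
    let a , xa≢a = ≉⇒moved {x} x≉ε
        j , y≈xj = centralizer {x} xp xa≢a {y} λ i →
          trans (cong (y ⟨$⟩ʳ_) (e i)) (trans (commute-^ {y} {y} k (λ _ → refl) i) (sym (e (y ⟨$⟩ʳ i))))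
    in trans (^-cong {y} p y≈xj i) (trans (^-swap x j p i) (^-ε {x ^′ p} j xp i))

-- Subgroups of order p in degree p

module PrimeDegree {m : ℕ} (pp : Prime (2+ m)) where
  private
    p = 2+ m
  open Exceptional {p} pp (ℕₚ.n≤1+n p)
  open Rotations p

  private
    𝟎 𝟏 : Fin p
    𝟎 = zero
    𝟏 = suc zero

  -- The orbit of any moved point fills all `p` points. In particular it contains 𝟎, which is
  -- therefore moved and can start the orbit instead.
  transitive : ∀ {x} → IsCyclic x → ¬ x ≈ ε → ∀ i → ∃ λ k → x ^′ toℕ {p} k ⟨$⟩ʳ 𝟎 ≡ i
  transitive {x} xp x≉ε = injective⇒surjective (λ k → x ^′ toℕ k ⟨$⟩ʳ 𝟎) λ {j} {k} eq →
      Finₚ.toℕ-injective (orbit-inj {x} pp xp moved (Finₚ.toℕ<n j) (Finₚ.toℕ<n k) eq)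
    where
    moved : x ⟨$⟩ʳ 𝟎 ≢ 𝟎
    moved = let a , xa≢a = ≉⇒moved {x} x≉ε
                onto = injective⇒surjective (λ k → x ^′ toℕ {p} k ⟨$⟩ʳ a) λ {j} {k} eq →
                  Finₚ.toℕ-injective (orbit-inj {x} pp xp xa≢a (Finₚ.toℕ<n j) (Finₚ.toℕ<n k) eq)
                k , eq = onto 𝟎
            in reached⇒moved {x} xp xa≢a (toℕ k , eq)

  -- A cyclic subgroup of order p contains exactly one element mapping 0 to 1.
  record Canonical (y : Π) : Set where
    field
      cyclic : IsCyclic y
      0↦1    : y ⟨$⟩ʳ 𝟎 ≡ 𝟏
    nontrivial : ¬ y ≈ ε
    nontrivial e = case trans (sym 0↦1) (e 𝟎) of λ ()
    moves0 : y ⟨$⟩ʳ 𝟎 ≢ 𝟎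
    moves0 eq = case trans (sym 0↦1) eq of λ ()
  open Canonical

  canonical-unique : ∀ {y z} → Canonical y → Canonical z → y commutesWith z → z ≈ y
  canonical-unique {y} {z} cy cz yz i =
    trans (agree {y} (cyclic cy) (moves0 cy) {z} {1} yz (trans (0↦1 cy) (sym (0↦1 cz))) i) (^-1 y i)

  canonicalPower : ∀ {x} → IsCyclic x → ¬ x ≈ ε → ∃ λ e → Canonical (x ^′ e)
  canonicalPower {x} xp x≉ε = let k , eq = transitive {x} xp x≉ε 𝟏 in
    toℕ k , record { cyclic = λ i → trans (^-swap x (toℕ k) p i) (^-ε {x ^′ p} (toℕ k) xp i) ; 0↦1 = eq }

  -- This permutation lists the cycle of `y` from 𝟎 on and conjugates `shift` to `y`.
  trajectory : ∀ {y} → Canonical y → Π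
  trajectory {y} cy = fromInjection (λ k → y ^′ toℕ k ⟨$⟩ʳ 𝟎) λ {j} {k} eq →
    Finₚ.toℕ-injective (orbit-inj {y} pp (cyclic cy) (moves0 cy) (Finₚ.toℕ<n j) (Finₚ.toℕ<n k) eq)

  unlift₂ : Π → Perm.Permutation′ m
  unlift₂ τ = Perm.remove zero (Perm.remove zero τ)

  lift₂ : Perm.Permutation′ m → Π
  lift₂ π = Perm.lift₀ (Perm.lift₀ π)

  lift₂-unlift₂ : ∀ {τ} → τ ⟨$⟩ʳ 𝟎 ≡ 𝟎 → τ ⟨$⟩ʳ 𝟏 ≡ 𝟏 → lift₂ (unlift₂ τ) ≈ τ
  lift₂-unlift₂ {τ} τ0 τ1 i = trans
    (Perm.lift₀-cong (Perm.lift₀ (unlift₂ τ)) (Perm.remove zero τ)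
      (Perm.lift₀-remove (Perm.remove zero τ) (Finₚ.suc-injective (trans (Perm.lift₀-remove τ τ0 𝟏) τ1))) i)
    (Perm.lift₀-remove τ τ0 i)

  lift₂-injective : ∀ {π ρ} → lift₂ π ≈ lift₂ ρ → π Perm.≈ ρ
  lift₂-injective e i = Finₚ.suc-injective (Finₚ.suc-injective (e (suc (suc i))))

  -- The conjugate of `shift` by `τ`, that is, the `p`-cycle that runs through the values of `τ` in
  -- order.
  fromTrajectory : Π → Π
  fromTrajectory τ = Perm.flip τ ∙ (shift ∙ τ)

  fromTrajectory-^ : ∀ τ k i → fromTrajectory τ ^′ k ⟨$⟩ʳ (τ ⟨$⟩ʳ i) ≡ τ ⟨$⟩ʳ (shift ^′ k ⟨$⟩ʳ i)
  fromTrajectory-^ τ zero    i = refl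
  fromTrajectory-^ τ (suc k) i = trans
    (cong (λ j → fromTrajectory τ ^′ k ⟨$⟩ʳ (τ ⟨$⟩ʳ (shift ⟨$⟩ʳ j))) (Perm.inverseˡ τ))
    (fromTrajectory-^ τ k (shift ⟨$⟩ʳ i))

  fromTrajectory-canonical : ∀ {τ} → τ ⟨$⟩ʳ 𝟎 ≡ 𝟎 → τ ⟨$⟩ʳ 𝟏 ≡ 𝟏 → Canonical (fromTrajectory τ)
  fromTrajectory-canonical {τ} τ0 τ1 = record
    { cyclic = λ i → begin
        fromTrajectory τ ^′ p ⟨$⟩ʳ i                     ≡⟨ cong (fromTrajectory τ ^′ p ⟨$⟩ʳ_) (Perm.inverseʳ τ) ⟨
        fromTrajectory τ ^′ p ⟨$⟩ʳ (τ ⟨$⟩ʳ (τ ⟨$⟩ˡ i))   ≡⟨ fromTrajectory-^ τ p (τ ⟨$⟩ˡ i) ⟩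
        τ ⟨$⟩ʳ (shift ^′ p ⟨$⟩ʳ (τ ⟨$⟩ˡ i))              ≡⟨ cong (τ ⟨$⟩ʳ_) (shift-^n (τ ⟨$⟩ˡ i)) ⟩
        τ ⟨$⟩ʳ (τ ⟨$⟩ˡ i)                                ≡⟨ Perm.inverseʳ τ ⟩
        i                                                ∎
    ; 0↦1 = begin
        fromTrajectory τ ⟨$⟩ʳ 𝟎            ≡⟨ cong (fromTrajectory τ ⟨$⟩ʳ_) τ0 ⟨
        fromTrajectory τ ⟨$⟩ʳ (τ ⟨$⟩ʳ 𝟎)   ≡⟨ fromTrajectory-^ τ 1 𝟎 ⟩
        τ ⟨$⟩ʳ 𝟏                           ≡⟨ τ1 ⟩
        𝟏                                  ∎
    }
    where open ≡-Reasoning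

  trajectory-fromTrajectory : ∀ {τ} τ0 τ1 → trajectory (fromTrajectory-canonical {τ} τ0 τ1) ≈ τ
  trajectory-fromTrajectory {τ} τ0 τ1 i = begin
    fromTrajectory τ ^′ toℕ i ⟨$⟩ʳ 𝟎            ≡⟨ cong (fromTrajectory τ ^′ toℕ i ⟨$⟩ʳ_) τ0 ⟨
    fromTrajectory τ ^′ toℕ i ⟨$⟩ʳ (τ ⟨$⟩ʳ 𝟎)   ≡⟨ fromTrajectory-^ τ (toℕ i) 𝟎 ⟩
    τ ⟨$⟩ʳ (shift ^′ toℕ i ⟨$⟩ʳ 𝟎)              ≡⟨ cong (τ ⟨$⟩ʳ_) (Finₚ.toℕ-injective (trans (toℕ-shift-^ (toℕ i) 𝟎)
                                                     (trans (cong (_% p) (ℕₚ.+-identityʳ (toℕ i))) (m<n⇒m%n≡m (Finₚ.toℕ<n i))))) ⟩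
    τ ⟨$⟩ʳ i                                    ∎
    where open ≡-Reasoning

  fromTrajectory-trajectory : ∀ {y} (cy : Canonical y) → fromTrajectory (trajectory cy) ≈ y
  fromTrajectory-trajectory {y} cy i = begin
    τ ⟨$⟩ʳ (shift ⟨$⟩ʳ j)                    ≡⟨⟩
    y ^′ toℕ (shift ⟨$⟩ʳ j) ⟨$⟩ʳ 𝟎           ≡⟨ ^-≡ y (toℕ-shift-^ 1 j) 𝟎 ⟩
    y ^′ (suc (toℕ j) % p) ⟨$⟩ʳ 𝟎            ≡⟨ ^-% {y} p (suc (toℕ j)) (cyclic cy) 𝟎 ⟨
    y ^′ suc (toℕ j) ⟨$⟩ʳ 𝟎                  ≡⟨ ^-suc y (toℕ j) 𝟎 ⟩
    y ⟨$⟩ʳ (τ ⟨$⟩ʳ j)                        ≡⟨ cong (y ⟨$⟩ʳ_) (Perm.inverseʳ τ) ⟩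
    y ⟨$⟩ʳ i                                 ∎
    where
    open ≡-Reasoning
    τ : Π
    τ = trajectory cy
    j = τ ⟨$⟩ˡ i

  module _ {y : Π} (cy : Canonical y) where
    trajectory-0 : trajectory cy ⟨$⟩ʳ 𝟎 ≡ 𝟎
    trajectory-0 = refl

    trajectory-1 : trajectory cy ⟨$⟩ʳ 𝟏 ≡ 𝟏
    trajectory-1 = 0↦1 cy

    -- The trajectory fixes 𝟎 and 𝟏, so it is determined by the permutation that it induces on the
    -- other `m` points; this accounts for `(p ∸ 2) !`.
    code : Fin (m !)
    code = permIndex m (unlift₂ (trajectory cy))

    lift₂-code : lift₂ (indexPerm m code) ≈ trajectory cy
    lift₂-code i = trans
      (Perm.lift₀-cong _ _ (Perm.lift₀-cong _ _ (indexPerm-permIndex m (unlift₂ (trajectory cy)))) i)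
      (lift₂-unlift₂ {trajectory cy} trajectory-0 trajectory-1 i)

  code-cong : ∀ {y z} (cy : Canonical y) (cz : Canonical z) → y ≈ z → code cy ≡ code cz
  code-cong {y} {z} cy cz y≈z = permIndex-cong m {unlift₂ (trajectory cy)} {unlift₂ (trajectory cz)}
    (lift₂-injective {unlift₂ (trajectory cy)} {unlift₂ (trajectory cz)} λ i →
      trans (lift₂-unlift₂ {trajectory cy} (trajectory-0 cy) (trajectory-1 cy) i)
        (trans (^-cong {y} (toℕ i) y≈z 𝟎)
          (sym (lift₂-unlift₂ {trajectory cz} (trajectory-0 cz) (trajectory-1 cz) i))))

  decode : Fin (m !) → Π
  decode l = fromTrajectory (lift₂ (indexPerm m l))

  decode-canonical : ∀ l → Canonical (decode l)
  decode-canonical l = fromTrajectory-canonical {lift₂ (indexPerm m l)} refl refl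

  code-decode : ∀ l → code (decode-canonical l) ≡ l
  code-decode l = trans
    (permIndex-cong m {unlift₂ (trajectory (decode-canonical l))} {indexPerm m l}
      (lift₂-injective {unlift₂ (trajectory (decode-canonical l))} {indexPerm m l} λ i →
        trans (lift₂-unlift₂ {trajectory (decode-canonical l)} refl (0↦1 (decode-canonical l)) i)
          (trajectory-fromTrajectory {lift₂ (indexPerm m l)} refl refl i)))
    (permIndex-indexPerm m l)

  decode-code : ∀ {y} (cy : Canonical y) → decode (code cy) ≈ y
  decode-code {y} cy i = trans (fromTrajectory-cong {lift₂ (indexPerm m (code cy))} {trajectory cy} (lift₂-code cy) i) (fromTrajectory-trajectory cy i)
    where
    fromTrajectory-cong : ∀ {τ ρ} → τ ≈ ρ → fromTrajectory τ ≈ fromTrajectory ρ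
    fromTrajectory-cong {τ} {ρ} e i = trans (e (shift ⟨$⟩ʳ (τ ⟨$⟩ˡ i)))
      (cong (λ j → ρ ⟨$⟩ʳ (shift ⟨$⟩ʳ j)) (trans (sym (Perm.inverseˡ ρ))
        (cong (ρ ⟨$⟩ˡ_) (trans (sym (e (τ ⟨$⟩ˡ i))) (Perm.inverseʳ τ)))))

  powers-commute : ∀ (x : Π) j k → x ^′ j commutesWith x ^′ k
  powers-commute x j k i = trans (sym (^-+ x j k i)) (trans (^-≡ x (ℕₚ.+-comm j k) i) (^-+ x k j i))

  abstract
    cyclicLabelling : Labelling p IsCyclic (Fin (m !))
    cyclicLabelling = record
      { label       = λ x x≉ε xp → code (proj₂ (canonicalPower {x} xp x≉ε))
      ; label-power = λ {x} {y} k e x≉ε xp y≉ε yp →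
          let i , cx = canonicalPower {x} xp x≉ε
              j , cy = canonicalPower {y} yp y≉ε
              -- The canonical powers of `x` and of `y` are both powers of `y`; they commute and
              -- hence coincide.
              x^i≈ : x ^′ i ≈ y ^′ (i * k)
              x^i≈ l = trans (^-cong {x} i e l) (^-* y i k l)
          in code-cong cx cy (canonical-unique {y ^′ j} {x ^′ i} cy cx λ l →
               trans (x^i≈ (y ^′ j ⟨$⟩ʳ l)) (trans (powers-commute y j (i * k) l) (cong (y ^′ j ⟨$⟩ʳ_) (sym (x^i≈ l)))))
      ; rep         = decode
      ; rep≉ε       = λ l → nontrivial (decode-canonical l)
      ; rep-Q       = λ l → cyclic (decode-canonical l)
      ; label-rep   = λ l →
          let x = decode l
              e , cx = canonicalPower {x} (cyclic (decode-canonical l)) (nontrivial (decode-canonical l))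
          in trans (code-cong cx (decode-canonical l)
               (canonical-unique {x} {x ^′ e} (decode-canonical l) cx
                 λ i → sym (commute-^ {x} {x} e (λ _ → refl) i)))
               (code-decode l)
      ; connect     = λ x x≉ε xp →
          let e , cx = canonicalPower {x} xp x≉ε
          in ∼-trans (^⇒∼ {x} x≉ε e (nontrivial cx)) (≈⇒∼ λ i → sym (decode-code cx i))
      }

-- Subgroups of order p in degree p + 1

module PrimeDegree+1 {m : ℕ} (pp : Prime (2+ m)) where
  private
    p = 2+ m
  open Exceptional {suc p} pp ℕₚ.≤-refl
  open Rotations (suc p)
  private
    module Λ = Labelling (PrimeDegree.cyclicLabelling pp)
    module S = Permutations p

  abstract
    -- The orbit of a moved point takes `p` of the `suc p` points, and the remaining one is missed,
    -- hence fixed.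
    fixedPoint : ∀ {x} → IsCyclic x → ¬ x ≈ ε → ∃ λ b → x ⟨$⟩ʳ b ≡ b
    fixedPoint {x} xp x≉ε = let a , xa≢a = ≉⇒moved {x} x≉ε
                                b , b∉ = fresh (orbit x p a) (ℕₚ.≤-reflexive (cong suc (length-tabulate λ (k : Fin p) → x ^′ toℕ k ⟨$⟩ʳ a)))
                            in b , missed⇒fixed {x} xp xa≢a λ k eq → b∉ (subst (_∈ orbit x p a) eq (∈-orbit {x} pp xp k))

  fixedPoint-unique : ∀ {x} → IsCyclic x → ¬ x ≈ ε → ∀ {b c} → x ⟨$⟩ʳ b ≡ b → x ⟨$⟩ʳ c ≡ c → b ≡ c
  fixedPoint-unique {x} xp x≉ε = fixed-unique {x} xp (proj₂ (≉⇒moved {x} x≉ε))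

  rep : Fin (suc p) × Fin (m !) → Π
  rep (b , l) = Insertion.ι b (Λ.rep l)

  rep≉ε : ∀ l → ¬ rep l ≈ ε
  rep≉ε (b , l) = Insertion.ι-≉ε b {Λ.rep l} (Λ.rep≉ε l)

  abstract
    labelAt : ∀ {x} b → x ⟨$⟩ʳ b ≡ b → ¬ x ≈ ε → IsCyclic x → Fin (m !)
    labelAt {x} b xb x≉ε xp = Λ.label (I.restrict x) (I.restrict-≉ε {x} xb x≉ε) (I.restrict-^ε {x} p xb xp)
      where module I = Insertion b

    -- The fixed points of `x` and `y` come from separate searches; once they are identified, both
    -- elements can be restricted to the same stabilizer.
    labelAt-power : ∀ {x y} k → x ≈ y ^′ k → ∀ {b c} (xb : x ⟨$⟩ʳ b ≡ b) (yc : y ⟨$⟩ʳ c ≡ c) → b ≡ c →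
                    ∀ x≉ε xp y≉ε yp → labelAt {x} b xb x≉ε xp ≡ labelAt {y} c yc y≉ε yp
    labelAt-power {x} {y} k e {b} xb yb refl _ _ _ _ = Λ.label-power k (Insertion.restrict-≈^ b {x} {y} k e xb yb) _ _ _ _

    labelAt-rep : ∀ b l (xb : rep (b , l) ⟨$⟩ʳ b ≡ b) x≉ε xp → labelAt {rep (b , l)} b xb x≉ε xp ≡ l
    labelAt-rep b l xb x≉ε xp = trans
      (Λ.label-power {I.restrict (I.ι (Λ.rep l))} {Λ.rep l} 1 (I.restrict-ι (Λ.rep l)) _ _ (Λ.rep≉ε l) (Λ.rep-Q l))
      (Λ.label-rep l)
      where module I = Insertion b

    connectAt : ∀ x b (xb : x ⟨$⟩ʳ b ≡ b) x≉ε xp →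
                (x , x≉ε) ∼ (rep (b , labelAt {x} b xb x≉ε xp) , rep≉ε (b , labelAt {x} b xb x≉ε xp))
    connectAt x b xb x≉ε xp = ∼-trans {x , x≉ε} {I.ι (I.restrict x) , I.ι-≉ε {I.restrict x} x′≉ε}
        (≈⇒∼ λ i → sym (I.ι-restrict {x} xb i))
        (I.ι-∼ {I.restrict x} {Λ.rep l} x′≉ε (Λ.rep≉ε l) (Λ.connect (I.restrict x) x′≉ε x′p))
      where
      module I = Insertion b
      x′≉ε : ¬ I.restrict x S.≈ S.ε
      x′≉ε = I.restrict-≉ε {x} xb x≉ε
      x′p : I.restrict x S.^′ p S.≈ S.ε
      x′p  = I.restrict-^ε {x} p xb xp
      l : Fin (m !)
      l    = Λ.label (I.restrict x) x′≉ε x′p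

  label : ∀ x → ¬ x ≈ ε → IsCyclic x → Fin (suc p) × Fin (m !)
  label x x≉ε xp = let b , xb = fixedPoint {x} xp x≉ε in b , labelAt {x} b xb x≉ε xp

  rep-cyclic : ∀ l → IsCyclic (rep l)
  rep-cyclic (b , l) = Insertion.ι-^ε b {Λ.rep l} p (Λ.rep-Q l)

  label-power : ∀ {x y} k → x ≈ y ^′ k → ∀ x≉ε xp y≉ε yp → label x x≉ε xp ≡ label y y≉ε yp
  label-power {x} {y} k e x≉ε xp y≉ε yp = cong₂ _,_ b≡c (labelAt-power {x} {y} k e xb yc b≡c x≉ε xp y≉ε yp)
    where
    b   = proj₁ (fixedPoint {x} xp x≉ε)
    xb  = proj₂ (fixedPoint {x} xp x≉ε)
    c   = proj₁ (fixedPoint {y} yp y≉ε)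
    yc  = proj₂ (fixedPoint {y} yp y≉ε)
    b≡c : b ≡ c
    b≡c = fixedPoint-unique {x} xp x≉ε xb (trans (e c) (fixed-^ {y} k yc))

  label-rep : ∀ l → label (rep l) (rep≉ε l) (rep-cyclic l) ≡ l
  label-rep (b , l) = cong₂ _,_ c≡b (trans
      (labelAt-power {x} {x} 1 (λ _ → refl) xc xb c≡b (rep≉ε (b , l)) (rep-cyclic (b , l)) (rep≉ε (b , l)) (rep-cyclic (b , l)))
      (labelAt-rep b l xb (rep≉ε (b , l)) (rep-cyclic (b , l))))
    where
    x   = rep (b , l)
    c   = proj₁ (fixedPoint {x} (rep-cyclic (b , l)) (rep≉ε (b , l)))
    xc  = proj₂ (fixedPoint {x} (rep-cyclic (b , l)) (rep≉ε (b , l)))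
    xb  : x ⟨$⟩ʳ b ≡ b
    xb  = Insertion.ι-b b (Λ.rep l)
    c≡b : c ≡ b
    c≡b = fixedPoint-unique {x} (rep-cyclic (b , l)) (rep≉ε (b , l)) xc xb

  connect : ∀ x x≉ε xp → (x , x≉ε) ∼ (rep (label x x≉ε xp) , rep≉ε (label x x≉ε xp))
  connect x x≉ε xp = connectAt x (proj₁ (fixedPoint {x} xp x≉ε)) (proj₂ (fixedPoint {x} xp x≉ε)) x≉ε xp

  -- For `n = suc p` there are `n` choices of the fixed point and `m ! = (n ∸ 3) !` subgroups of
  -- order `p` in each stabilizer.
  cyclicLabelling : Labelling (suc p) IsCyclic (Fin (suc p) × Fin (m !))
  cyclicLabelling = record
    { label       = label
    ; label-power = label-power
    ; rep         = rep
    ; rep≉ε       = rep≉ε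
    ; rep-Q       = rep-cyclic
    ; label-rep   = label-rep
    ; connect     = connect
    }

-- Orders

even-or-odd : ∀ k → 2 ∣ k ⊎ 2 ∣ suc k
even-or-odd zero    = inj₁ (2 ∣0)
even-or-odd (suc k) with even-or-odd k
... | inj₁ 2∣k  = inj₂ (∣m∣n⇒∣m+n (∣-refl {2}) 2∣k)
... | inj₂ 2∣1+k = inj₁ 2∣1+k

consecutive-primes : ∀ {q} → Prime q → Prime (suc q) → q ≡ 2
consecutive-primes {q} pq pq+1 with even-or-odd q
... | inj₁ 2∣q   = sym (prime-∣-prime prime[2] pq 2∣q)
... | inj₂ 2∣1+q with prime-∣-prime prime[2] pq+1 2∣1+q
...   | refl = contradiction pq ¬prime[1]

Near : ℕ → ℕ → Set
Near n q = n ≡ q ⊎ n ≡ suc q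

near⇒≤ : ∀ {n q} → Near n q → n ≤ suc q
near⇒≤ (inj₁ refl) = ℕₚ.n≤1+n _
near⇒≤ (inj₂ refl) = ℕₚ.≤-refl

near⇒≥ : ∀ {n q} → Near n q → q ≤ n
near⇒≥ (inj₁ refl) = ℕₚ.≤-refl
near⇒≥ (inj₂ refl) = ℕₚ.n≤1+n _

far-or-near : ∀ {n q} → q ≤ n → q + 2 ≤ n ⊎ Near n q
far-or-near {n} {q} q≤n with ℕₚ.m≤n⇒m<n∨m≡n q≤n
... | inj₂ refl = inj₂ (inj₁ refl)
... | inj₁ q<n with ℕₚ.m≤n⇒m<n∨m≡n q<n
...   | inj₂ refl = inj₂ (inj₂ refl)
...   | inj₁ 1+q<n = inj₁ (subst (_≤ n) (ℕₚ.+-comm 2 q) 1+q<n)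

-- Two different primes near `n` would be consecutive numbers, which forces one of them to be 2.
near-odd-unique : ∀ {n p q} → Prime p → p ≢ 2 → Near n p → Prime q → q ≢ 2 → Near n q → p ≡ q
near-odd-unique pp p≢2 (inj₁ refl) pq q≢2 (inj₁ refl) = refl
near-odd-unique pp p≢2 (inj₁ refl) pq q≢2 (inj₂ refl) = contradiction (consecutive-primes pq pp) q≢2
near-odd-unique pp p≢2 (inj₂ refl) pq q≢2 (inj₁ refl) = contradiction (consecutive-primes pp pq) p≢2
near-odd-unique pp p≢2 (inj₂ refl) pq q≢2 (inj₂ refl) = refl

mark : ∀ {A : Set} → Dec A → Fin 2
mark (yes _) = suc zero
mark (no _)  = zero

mark-⇔ : ∀ {A B : Set} → (A → B) → (B → A) → (d : Dec A) (d′ : Dec B) → mark d ≡ mark d′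
mark-⇔ f g (yes _) (yes _) = refl
mark-⇔ f g (yes a) (no ¬b) = contradiction (f a) ¬b
mark-⇔ f g (no ¬a) (yes b) = contradiction (g b) ¬a
mark-⇔ f g (no _)  (no _)  = refl

module Orders (n : ℕ) (2≤n : 2 ≤ n) where
  open Rotations n

  cyclicOrder : ∀ {r} → Prime (2+ r) → 2+ r ≤ n → ordersVertex
  cyclicOrder {r} pp r≤n = 2+ r , cycle₀ a a-inj , prime-order {cycle a a-inj} pp (cycle≉ε a a-inj) (cycle-^ a a-inj)
    where
    a : Fin (2+ r) → Fin n
    a i = inject≤ i r≤n
    a-inj : Inj a
    a-inj = Finₚ.inject≤-injective r≤n r≤n _ _

  two : ordersVertex
  two = cyclicOrder prime[2] 2≤n

  data Reduced (v : ordersVertex) : Set where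
    to-two : v ∼ₒ two → Reduced v
    near   : ∀ {q} → Prime q → q ≢ 2 → Near n q → (y : G₀ (Sym n)) (oy : HasOrder (Sym n) (proj₁ y) q) →
             q ∣ proj₁ v → v ∼ₒ (q , y , oy) → Reduced v

  same-order : ∀ {u v : ordersVertex} → proj₁ u ≡ proj₁ v → u ∼ₒ v
  same-order {u} {v} eq = ∣⇒∼ₒ {u} {v} (∣-reflexive eq)

  -- A power of prime order `q` provides a divisor `q` of the order. Unless `q` is 2 or near `n`,
  -- `oddPrime∼involution` leads to order 2; that step has no lower bound 8, so one argument serves
  -- all degrees from 2 on.
  reduce : ∀ v → Reduced v
  reduce v@(m , (x , x≉ε) , ox) with primePower {x} x≉ε
  ... | q , k , pq , xk≉ε , xkq = helper (q ℕₚ.≟ 2) (far-or-near (primeOrder≤n {y} pq xkq xk≉ε))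
    where
    y : Π
    y = x ^′ k
    oy : HasOrder (Sym n) y q
    oy = prime-order {y} pq xk≉ε xkq
    q∣m : q ∣ m
    q∣m = power⇒order-∣ {y} {x} (k , positive-^ {x} k xk≉ε , λ _ → refl) oy ox
    v∼q : v ∼ₒ (q , (y , xk≉ε) , oy)
    v∼q = ∼ₒ-sym {q , (y , xk≉ε) , oy} {v} (∣⇒∼ₒ {q , (y , xk≉ε) , oy} {v} q∣m)
    helper : Dec (q ≡ 2) → q + 2 ≤ n ⊎ Near n q → Reduced v
    helper (yes q≡2) _ = to-two (∼ₒ-trans {v} {_ , _ , oy} {two} v∼q (same-order {_ , _ , oy} {two} q≡2))
    helper (no q≢2) (inj₂ nq)    = near pq q≢2 nq (y , xk≉ε) oy q∣m v∼q
    helper (no q≢2) (inj₁ q+2≤n) =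
      let z , z2 , y∼z = oddPrime∼involution {y} pq q≢2 q+2≤n xkq xk≉ε
          oz = prime-order {proj₁ z} prime[2] (proj₂ z) z2
      in to-two (∼ₒ-trans {v} {_ , _ , oy} {two} v∼q
           (∼ₒ-trans {_ , _ , oy} {_ , _ , oz} {two} (∼⇒∼ₒ {y , xk≉ε} {z} y∼z oy oz) (same-order {_ , _ , oz} {two} refl)))

  O₀-connected : (∀ q → Prime q → q ≢ 2 → ¬ Near n q) → O₀ (Sym n) HasComponents 1
  O₀-connected none = hasComponents-by {G = O₀ (Sym n)} {L = Fin 1} (mk↔ₛ′ id id (λ _ → refl) (λ _ → refl))
    (λ _ → zero) (λ _ → refl) (λ _ → refl) (λ _ → two) (λ { zero → refl }) (λ v → only v (reduce v))
    where
    only : ∀ v → Reduced v → v ∼ₒ two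
    only v (to-two v∼) = v∼
    only v (near pq q≢2 nq _ _ _ _) = contradiction nq (none _ pq q≢2)

  module _ {r : ℕ} (pp : Prime (2+ r)) (p≢2 : 2+ r ≢ 2) (np : Near n (2+ r)) where
    private
      p = 2+ r
      module E = Exceptional {n} pp (near⇒≤ np)

      vp : ordersVertex
      vp = cyclicOrder pp (near⇒≥ np)

      rep : Fin 2 → ordersVertex
      rep zero    = two
      rep (suc _) = vp

      label : ordersVertex → Fin 2
      label (m , _) = mark (m ℕₚ.≟ p)

      -- If `x` has order `j * p`, then `x ^′ j` has order `p`, and by `isCyclic-up` already the
      -- `p`-th power of `x` is trivial.
      multiple-of-p : ∀ (v : ordersVertex) → p ∣ proj₁ v → proj₁ v ≡ p
      multiple-of-p (m , (x , x≉ε) , ox@(m>0 , xm , least)) (divides j refl) =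
        ∣-antisym (order-∣ {x} {k = p} ox (E.isCyclic-up {x ^′ j} {x} j (λ _ → refl) xj≉ε xjp)) (n∣m*n j)
        where
        j>0 : 0 < j
        j>0 = ℕₚ.n≢0⇒n>0 λ { refl → ℕₚ.<-irrefl refl m>0 }
        xj≉ε : ¬ x ^′ j ≈ ε
        xj≉ε e = ℕₚ.<⇒≱ (ℕₚ.m<m*n j p {{>-nonZero j>0}} (prime>1 pp)) (least j j>0 e)
        xjp : (x ^′ j) ^′ p ≈ ε
        xjp i = trans (^-* x p j i) (trans (^-≡ x (ℕₚ.*-comm p j) i) (xm i))

      divisor-of-p : ∀ (v : ordersVertex) → proj₁ v ∣ p → proj₁ v ≡ p
      divisor-of-p (m , (x , x≉ε) , (_ , xm , _)) m∣p with prime⇒irreducible pp m∣p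
      ... | inj₁ refl = contradiction (λ i → trans (sym (^-1 x i)) (xm i)) x≉ε
      ... | inj₂ eq   = eq

      label-∣ : ∀ u v → proj₁ u ∣ proj₁ v → label u ≡ label v
      label-∣ u@(m , _) v@(m′ , _) d = mark-⇔ (λ { refl → multiple-of-p v d }) (λ { refl → divisor-of-p u d })
        (m ℕₚ.≟ p) (m′ ℕₚ.≟ p)

      mark-rep : ∀ l (d : Dec (proj₁ (rep l) ≡ p)) → mark d ≡ l
      mark-rep zero       (yes eq) = contradiction (sym eq) p≢2
      mark-rep zero       (no _)   = refl
      mark-rep (suc zero) (yes _)  = refl
      mark-rep (suc zero) (no ne)  = contradiction refl ne

      connect : ∀ v (d : Dec (proj₁ v ≡ p)) → v ∼ₒ rep (mark d)
      connect v (yes eq) = same-order {v} {vp} eq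
      connect v (no ne)  = helper (reduce v)
        where
        helper : Reduced v → v ∼ₒ two
        helper (to-two v∼) = v∼
        helper (near pq q≢2 nq _ _ q∣m _) =
          contradiction (multiple-of-p v (subst (_∣ proj₁ v) (near-odd-unique pq q≢2 nq pp p≢2 np) q∣m)) ne

    O₀-two-components : O₀ (Sym n) HasComponents 2
    O₀-two-components = hasComponents-by {G = O₀ (Sym n)} {L = Fin 2} (mk↔ₛ′ id id (λ _ → refl) (λ _ → refl))
      label (λ {u} {v} eq → label-∣ u v (∣-reflexive eq))
      (λ { {u} {v} (_ , inj₁ d) → label-∣ u v d ; {u} {v} (_ , inj₂ d) → sym (label-∣ v u d) })
      rep (λ l → mark-rep l _) (λ v → connect v _)

-- Joining the labellings, and degree at least 8

module _ {n : ℕ} where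
  open Rotations n

  singleLabelling : ∀ {Q : Π → Set} (z : G₀ (Sym n)) → Q (proj₁ z) →
                    (∀ x (x≉ε : ¬ x ≈ ε) → Q x → (x , x≉ε) ∼ z) → Labelling n Q (Fin 1)
  singleLabelling z qz connected = record
    { label       = λ _ _ _ → zero
    ; label-power = λ _ _ _ _ _ _ → refl
    ; rep         = λ _ → proj₁ z
    ; rep≉ε       = λ _ → proj₂ z
    ; rep-Q       = λ _ → qz
    ; label-rep   = λ { zero → refl }
    ; connect     = connected
    }

dec-⊎ : ∀ {A : Set} → Dec A → A ⊎ ¬ A
dec-⊎ (yes a) = inj₁ a
dec-⊎ (no ¬a) = inj₂ ¬a

module _ {n p : ℕ} (pp : Prime p) (np : Near n p) where
  open Exceptional {n} pp (near⇒≤ np)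

  -- `isCyclic-up` and `isCyclic-down` keep the elements of order `p` apart from all others, so the
  -- two counts add.
  P₀-combine : ∀ {a b c} {L M : Set} → Labelling n IsCyclic L → L ↔ Fin a →
               Labelling n (λ x → ¬ IsCyclic x) M → M ↔ Fin b → a + b ≡ c → P₀ (Sym n) HasComponents c
  P₀-combine Λ f Μ g refl = labelling⇒hasComponents
    (labelling-⊎ (λ x _ _ → dec-⊎ (isCyclic? x)) (λ _ → tt) (λ _ → tt)
      (λ {x} {y} k e x≉ε cx ¬cy → ¬cy (isCyclic-up {x} {y} k e x≉ε cx))
      (λ {x} {y} k e x≉ε ¬cx cy → ¬cx (isCyclic-down {x} {y} k e x≉ε cy)) Λ Μ)
    (↔-sym Finₚ.+↔⊎ ↔-∘ (f ⊎-↔ g))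

module LargeDegree {n : ℕ} (8≤n : 8 ≤ n) where
  open Rotations n
  open Main (ℕₚ.≤-trans (ℕₚ.m≤n+m 6 2) 8≤n)
  open Large 8≤n

  -- The hypothesis forces a power of prime order `q` to satisfy `q + 2 ≤ n`, and `∼transposition`
  -- takes over from there.
  connected : ∀ x (x≉ε : ¬ x ≈ ε) →
    (∀ q k → Prime q → Near n q → ¬ x ^′ k ≈ ε → ¬ (x ^′ k) ^′ q ≈ ε) → (x , x≉ε) ∼ transposition₀
  connected x x≉ε noNear = via (primePower {x} x≉ε)
    where
    via : PrimePower x → (x , x≉ε) ∼ transposition₀
    via (q , k , pq , xk≉ε , xkq) = case far-or-near (primeOrder≤n {x ^′ k} pq xkq xk≉ε) of λ
      { (inj₁ q+2≤n) → ∼-trans {x , x≉ε} {x ^′ k , xk≉ε} {transposition₀} (^⇒∼ {x} x≉ε k xk≉ε)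
                         (∼transposition {x ^′ k} pq q+2≤n xkq xk≉ε)
      ; (inj₂ nq)    → contradiction xkq (noNear q k pq nq xk≉ε)
      }

  notTwo : ∀ {q} → Near n q → q ≢ 2
  notTwo nq refl with ℕₚ.≤-trans 8≤n (near⇒≤ nq)
  ... | s≤s (s≤s (s≤s ()))

  P₀-connected : (∀ q → Prime q → ¬ Near n q) → P₀ (Sym n) HasComponents 1
  P₀-connected none = labelling⇒hasComponents
    (singleLabelling transposition₀ tt λ x x≉ε _ → connected x x≉ε λ q _ pq nq → contradiction nq (none q pq))
    (mk↔ₛ′ id id (λ _ → refl) (λ _ → refl))

  module _ {p : ℕ} (pp : Prime p) (np : Near n p) where
    open Exceptional {n} pp (near⇒≤ np)

    mainLabelling : Labelling n (λ x → ¬ IsCyclic x) (Fin 1)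
    mainLabelling = singleLabelling transposition₀
      (λ e → proj₂ transposition₀ (coprime-trivial {proj₁ transposition₀}
        (primes-coprime prime[2] pp (notTwo np ∘ sym)) transposition-^2 e))
      λ x x≉ε ¬cyclic → connected x x≉ε λ q k pq nq xk≉ε xkq → ¬cyclic
        (isCyclic-up {x ^′ k} {x} k (λ _ → refl) xk≉ε
          -- Both `q` and `p` are odd primes near `n`, hence equal.
          (subst (λ q → (x ^′ k) ^′ q ≈ ε) (near-odd-unique pq (notTwo nq) nq pp (notTwo np) np) xkq))

    P₀-prime-split : ∀ {k} {L : Set} → Labelling n IsCyclic L → L ↔ Fin k → P₀ (Sym n) HasComponents (k + 1)
    P₀-prime-split Λ bij = P₀-combine pp np Λ bij mainLabelling (↔-id _) refl

-- Exhaustive evaluation in small degrees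

Code : ℕ → Set
Code n = Vec (Fin n) n

-- Dropping repeated letters while the words are built keeps `codes n` at `n !` entries instead of
-- `n ^ n`.
codesAvoiding : ∀ {n} k → List (Fin n) → List (Vec (Fin n) k)
codesAvoiding         zero    used = Vec.[] ∷ []
codesAvoiding {n} (suc k) used = concatMap (λ i → if does (member Finₚ._≟_ i used) then [] else
  map (i Vec.∷_) (codesAvoiding k (i ∷ used))) (allFin n)

tabulate∈codesAvoiding : ∀ {n} k used (f : Fin k → Fin n) → Inj f → (∀ i → f i ∉ used) →
                         Vec.tabulate f ∈ codesAvoiding k used
tabulate∈codesAvoiding zero    used f f-inj f∉ = here refl
tabulate∈codesAvoiding (suc k) used f f-inj f∉ =
    ∈-concatMap⁺ (λ i → if does (member Finₚ._≟_ i used) then [] else map (i Vec.∷_) (codesAvoiding k (i ∷ used)))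
      (lose (∈-allFin (f zero)) first)
  where
  first : Vec.tabulate f ∈ (if does (member Finₚ._≟_ (f zero) used) then [] else
                            map (f zero Vec.∷_) (codesAvoiding k (f zero ∷ used)))
  first with member Finₚ._≟_ (f zero) used
  ... | yes f0∈ = contradiction f0∈ (f∉ zero)
  ... | no  _   = ∈-map⁺ (f zero Vec.∷_) (tabulate∈codesAvoiding k (f zero ∷ used) (f ∘ suc)
          (λ eq → Finₚ.suc-injective (f-inj eq))
          λ { i (here eq) → case f-inj eq of λ () ; i (there fi∈) → f∉ (suc i) fi∈ })

codes : ∀ n → List (Code n)
codes n = codesAvoiding n []

module Codes (n : ℕ) where
  open Permutations n

  infix 4 _≟ᶜ_
  _≟ᶜ_ : (v w : Code n) → Dec (v ≡ w)
  _≟ᶜ_ = Vecₚ.≡-dec Finₚ._≟_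

  infixl 7 _⊙_
  _⊙_ : Code n → Code n → Code n
  v ⊙ w = Vec.map (Vec.lookup w) v

  identity : Code n
  identity = Vec.tabulate id

  pow : ℕ → Code n → Code n
  pow zero    v = identity
  pow (suc k) v = v ⊙ pow k v

  encode : Π → Code n
  encode x = Vec.tabulate (x ⟨$⟩ʳ_)

  encode∈codes : ∀ x → encode x ∈ codes n
  encode∈codes x = tabulate∈codesAvoiding n [] (x ⟨$⟩ʳ_) (⟨$⟩-inj x) λ _ ()

  encode-cong : ∀ {x y} → x ≈ y → encode x ≡ encode y
  encode-cong = Vecₚ.tabulate-cong

  encode-injective : ∀ {x y} → encode x ≡ encode y → x ≈ y
  encode-injective {x} {y} eq i = trans (sym (Vecₚ.lookup∘tabulate (x ⟨$⟩ʳ_) i))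
    (trans (cong (λ v → Vec.lookup v i) eq) (Vecₚ.lookup∘tabulate (y ⟨$⟩ʳ_) i))

  encode-∙ : ∀ x y → encode (x ∙ y) ≡ encode x ⊙ encode y
  encode-∙ x y = trans (Vecₚ.tabulate-cong λ i → sym (Vecₚ.lookup∘tabulate (y ⟨$⟩ʳ_) (x ⟨$⟩ʳ i)))
    (Vecₚ.tabulate-∘ (Vec.lookup (encode y)) (x ⟨$⟩ʳ_))

  encode-^ : ∀ x k → encode (x ^′ k) ≡ pow k (encode x)
  encode-^ x zero    = refl
  encode-^ x (suc k) = trans (encode-∙ x (x ^′ k)) (cong (encode x ⊙_) (encode-^ x k))

  ^-fromCode : ∀ {x} k → pow k (encode x) ≡ identity → x ^′ k ≈ ε
  ^-fromCode {x} k eq = encode-injective {x ^′ k} {ε} (trans (encode-^ x k) eq)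

  ^-toCode : ∀ {x} k → x ^′ k ≈ ε → pow k (encode x) ≡ identity
  ^-toCode {x} k e = trans (sym (encode-^ x k)) (encode-cong {x ^′ k} {ε} e)

  -- Conditions that are cheap to evaluate and put two non-identity elements into one component: a
  -- power with exponent at most 3, where exponent 1 is equality, or commuting elements killed by 2
  -- and by 3.
  Link : Code n → Code n → Set
  Link v w = (pow 1 v ≡ w ⊎ pow 2 v ≡ w ⊎ pow 3 v ≡ w)
           ⊎ (pow 2 v ≡ identity × pow 3 w ≡ identity × v ⊙ w ≡ w ⊙ v)
           ⊎ (pow 3 v ≡ identity × pow 2 w ≡ identity × v ⊙ w ≡ w ⊙ v)

  link? : ∀ v w → Dec (Link v w)
  link? v w = ((pow 1 v ≟ᶜ w) ⊎-dec (pow 2 v ≟ᶜ w) ⊎-dec (pow 3 v ≟ᶜ w))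
            ⊎-dec ((pow 2 v ≟ᶜ identity) ×-dec (pow 3 w ≟ᶜ identity) ×-dec (v ⊙ w ≟ᶜ w ⊙ v))
            ⊎-dec ((pow 3 v ≟ᶜ identity) ×-dec (pow 2 w ≟ᶜ identity) ×-dec (v ⊙ w ≟ᶜ w ⊙ v))

  link⇒∼ : ∀ {x y} (x≉ε : ¬ x ≈ ε) (y≉ε : ¬ y ≈ ε) → Link (encode x) (encode y) → (x , x≉ε) ∼ (y , y≉ε)
  link⇒∼ {x} {y} x≉ε y≉ε = λ
      { (inj₁ (inj₁ eq))        → viaPower 1 eq
      ; (inj₁ (inj₂ (inj₁ eq))) → viaPower 2 eq
      ; (inj₁ (inj₂ (inj₂ eq))) → viaPower 3 eq
      ; (inj₂ (inj₁ (x2 , y3 , xy))) → commuting⇒∼ {x} {y} 2⊥3 (^-fromCode {x} 2 x2) (^-fromCode {y} 3 y3) (commute xy) x≉ε y≉ε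
      ; (inj₂ (inj₂ (x3 , y2 , xy))) → commuting⇒∼ {x} {y} 3⊥2 (^-fromCode {x} 3 x3) (^-fromCode {y} 2 y2) (commute xy) x≉ε y≉ε
      }
    where
    open Rotations n using (2⊥3; 3⊥2)
    viaPower : ∀ k → pow k (encode x) ≡ encode y → (x , x≉ε) ∼ (y , y≉ε)
    viaPower k eq = ∼-trans {x , x≉ε} {x ^′ k , xk≉ε} {y , y≉ε} (^⇒∼ {x} x≉ε k xk≉ε) (≈⇒∼ xk≈y)
      where
      xk≈y : x ^′ k ≈ y
      xk≈y = encode-injective {x ^′ k} {y} (trans (encode-^ x k) eq)
      xk≉ε : ¬ x ^′ k ≈ ε
      xk≉ε e = y≉ε λ i → trans (sym (xk≈y i)) (e i)
    commute : encode x ⊙ encode y ≡ encode y ⊙ encode x → x ∙ y ≈ y ∙ x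
    commute eq = encode-injective {x ∙ y} {y ∙ x} (trans (encode-∙ x y) (trans eq (sym (encode-∙ y x))))

  Valid : Code n → Set
  Valid v = (∀ i j → Vec.lookup v i ≡ Vec.lookup v j → i ≡ j) × v ≢ identity

  valid? : ∀ v → Dec (Valid v)
  valid? v = (Finₚ.all? λ i → Finₚ.all? λ j → (Vec.lookup v i Finₚ.≟ Vec.lookup v j) →-dec (i Finₚ.≟ j))
             ×-dec ¬? (v ≟ᶜ identity)

  decode : ∀ {v} → Valid v → Π
  decode {v} (inj , _) = fromInjection (Vec.lookup v) λ {i} {j} → inj i j

  encode-decode : ∀ {v} (val : Valid v) → encode (decode val) ≡ v
  encode-decode {v} _ = Vecₚ.tabulate∘lookup v

  decode≉ε : ∀ {v} (val : Valid v) → ¬ decode val ≈ ε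
  decode≉ε val@(_ , v≢id) e = v≢id (trans (sym (encode-decode val)) (encode-cong {decode val} {ε} e))

  decode₀ : ∀ {v} → Valid v → G₀ (Sym n)
  decode₀ val = decode val , decode≉ε val

  -- A ball lists elements of one component, each linked to a later one; its centre comes last.
  Ball : Set
  Ball = List (Code n)

  IsBall : Ball → Set
  IsBall []       = ⊥
  IsBall (v ∷ []) = Valid v
  IsBall (v ∷ ws) = Valid v × Any (Link v) ws × IsBall ws

  isBall? : ∀ ws → Dec (IsBall ws)
  isBall? []               = no λ ()
  isBall? (v ∷ [])         = valid? v
  isBall? (v ∷ ws@(_ ∷ _)) = valid? v ×-dec Any.any? (link? v) ws ×-dec isBall? ws

  centre : Ball → Code n
  centre []               = identity
  centre (v ∷ [])         = v
  centre (_ ∷ ws@(_ ∷ _)) = centre ws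

  centre-valid : ∀ ws → IsBall ws → Valid (centre ws)
  centre-valid (v ∷ [])     val         = val
  centre-valid (_ ∷ w ∷ ws) (_ , _ , b) = centre-valid (w ∷ ws) b

  ball⇒∼ : ∀ ws (b : IsBall ws) {v} → v ∈ ws → ∀ x (x≉ε : ¬ x ≈ ε) → encode x ≡ v →
           (x , x≉ε) ∼ decode₀ (centre-valid ws b)
  linked⇒∼ : ∀ ws (b : IsBall ws) x (x≉ε : ¬ x ≈ ε) → Any (Link (encode x)) ws →
             (x , x≉ε) ∼ decode₀ (centre-valid ws b)

  ball⇒∼ (v ∷ [])     val         (here refl) x x≉ε eq =
    ≈⇒∼ (encode-injective {x} {decode val} (trans eq (sym (encode-decode val))))
  ball⇒∼ (v ∷ w ∷ ws) (_ , l , b) (here refl) x x≉ε eq =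
    linked⇒∼ (w ∷ ws) b x x≉ε (subst (λ v → Any (Link v) (w ∷ ws)) (sym eq) l)
  ball⇒∼ (_ ∷ w ∷ ws) (_ , _ , b) (there v∈)  x x≉ε eq = ball⇒∼ (w ∷ ws) b v∈ x x≉ε eq

  linked⇒∼ (v ∷ [])     val x x≉ε (here l) =
    link⇒∼ {x} {decode val} x≉ε (decode≉ε val) (subst (Link (encode x)) (sym (encode-decode val)) l)
  linked⇒∼ (v ∷ w ∷ ws) (val , l′ , b) x x≉ε (here l) = ∼-trans
    (link⇒∼ {x} {decode val} x≉ε (decode≉ε val) (subst (Link (encode x)) (sym (encode-decode val)) l))
    (linked⇒∼ (w ∷ ws) b (decode val) (decode≉ε val) (subst (λ v → Any (Link v) (w ∷ ws)) (sym (encode-decode val)) l′))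
  linked⇒∼ (_ ∷ w ∷ ws) (_ , _ , b) x x≉ε (there l) = linked⇒∼ (w ∷ ws) b x x≉ε l

module ClassLabelling {n p : ℕ} (pp : Prime p) (np : Near n p)
                      (class : Code n → Code n) (centres : List (Code n)) where
  open Codes n
  open Permutations n
  open Exceptional {n} pp (near⇒≤ np) using (IsCyclic)

  private
    centre′ : Fin (length centres) → Code n
    centre′ = List.lookup centres

  -- The codes that `classLabelling` leaves aside: the identity, and the elements of order `p`,
  -- which carry a label of their own.
  Exempt : Code n → Set
  Exempt v = v ≡ identity ⊎ pow p v ≡ identity

  exempt? : ∀ v → Dec (Exempt v)
  exempt? v = (v ≟ᶜ identity) ⊎-dec (pow p v ≟ᶜ identity)

  -- The exponents from 1 to 6 include all element orders in degree at most 6. Once one of them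
  -- kills `v`, the powers below it are all the powers.
  ConstantOnPowers : Code n → Code n → Set
  ConstantOnPowers v c = c ∈ centres × Any (λ m → pow (suc m) v ≡ identity ×
    All (λ k → pow k v ≡ identity ⊎ class (pow k v) ≡ c) (upTo (suc m))) (upTo 6)

  constantOnPowers? : ∀ v c → Dec (ConstantOnPowers v c)
  constantOnPowers? v c = Any.any? (c ≟ᶜ_) centres ×-dec Any.any? (λ m → (pow (suc m) v ≟ᶜ identity) ×-dec
    All.all? (λ k → (pow k v ≟ᶜ identity) ⊎-dec (class (pow k v) ≟ᶜ c)) (upTo (suc m))) (upTo 6)

  Consistent : Code n → Set
  Consistent v = Exempt v ⊎ ConstantOnPowers v (class v)

  consistent? : ∀ v → Dec (Consistent v)
  consistent? v = exempt? v ⊎-dec constantOnPowers? v (class v)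

  record Complete : Set where
    constructor complete
    field
      valid      : ∀ i → Valid (centre′ i)
      distinct   : ∀ i j → centre′ i ≡ centre′ j → i ≡ j
      idempotent : ∀ i → class (centre′ i) ≡ centre′ i
      noncyclic  : ∀ i → pow p (centre′ i) ≢ identity
      consistent : All Consistent (codes n)

  complete? : Dec Complete
  complete? = map′ (λ (a , b , c , d , e) → complete a b c d e) (λ (complete a b c d e) → a , b , c , d , e)
    ( (Finₚ.all? λ i → valid? (centre′ i))
      ×-dec (Finₚ.all? λ i → Finₚ.all? λ j → (centre′ i ≟ᶜ centre′ j) →-dec (i Finₚ.≟ j))
      ×-dec (Finₚ.all? λ i → class (centre′ i) ≟ᶜ centre′ i)
      ×-dec (Finₚ.all? λ i → ¬? (pow p (centre′ i) ≟ᶜ identity))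
      ×-dec All.all? consistent? (codes n) )

  not-exempt : ∀ {x} → ¬ x ≈ ε → ¬ IsCyclic x → ¬ Exempt (encode x)
  not-exempt {x} x≉ε ¬cx (inj₁ eq) = x≉ε (encode-injective {x} {ε} eq)
  not-exempt {x} x≉ε ¬cx (inj₂ eq) = ¬cx (^-fromCode {x} p eq)

  classOf : Π → Code n
  classOf x = class (encode x)

  module _ (C : Complete) where
    open Complete C

    private
      constant : ∀ x → ¬ x ≈ ε → ¬ IsCyclic x → ConstantOnPowers (encode x) (classOf x)
      constant x x≉ε ¬cx with All.lookup consistent (encode∈codes x)
      ... | inj₁ ex = contradiction ex (not-exempt {x} x≉ε ¬cx)
      ... | inj₂ c  = c

    class∈centres : ∀ x → ¬ x ≈ ε → ¬ IsCyclic x → classOf x ∈ centres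
    class∈centres x x≉ε ¬cx = proj₁ (constant x x≉ε ¬cx)

    class-power : ∀ {x y} k → x ≈ y ^′ k → ¬ x ≈ ε → ¬ y ≈ ε → ¬ IsCyclic y → classOf x ≡ classOf y
    class-power {x} {y} k x≈yk x≉ε y≉ε ¬cy =
      let m , ym , all = Any.satisfied (proj₂ (constant y y≉ε ¬cy))
          x≈ : x ≈ y ^′ (k % suc m)
          x≈ i = trans (x≈yk i) (^-% {y} (suc m) k (^-fromCode {y} (suc m) ym) i)
          code-x : encode x ≡ pow (k % suc m) (encode y)
          code-x = trans (encode-cong {x} {y ^′ (k % suc m)} x≈) (encode-^ y (k % suc m))
      in case All.lookup all (∈-upTo⁺ (m%n<n k (suc m))) of λ
        { (inj₁ eq) → contradiction (encode-injective {x} {ε} (trans code-x eq)) x≉ε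
        ; (inj₂ eq) → trans (cong class code-x) eq }

    rep : Fin (length centres) → Π
    rep i = decode (valid i)

    rep≉ε : ∀ i → ¬ rep i ≈ ε
    rep≉ε i = decode≉ε (valid i)

    rep-class : ∀ i → classOf (rep i) ≡ centre′ i
    rep-class i = trans (cong class (encode-decode (valid i))) (idempotent i)

    rep-noncyclic : ∀ i → ¬ IsCyclic (rep i)
    rep-noncyclic i c = noncyclic i (subst (λ v → pow p v ≡ identity) (encode-decode (valid i)) (^-toCode {rep i} p c))

    module _ (joined : ∀ x (x≉ε : ¬ x ≈ ε) → ¬ IsCyclic x → ∀ i → classOf x ≡ centre′ i → (x , x≉ε) ∼ (rep i , rep≉ε i)) where

      private
        label : ∀ x → ¬ x ≈ ε → ¬ IsCyclic x → Fin (length centres)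
        label x x≉ε ¬cx = Any.index (class∈centres x x≉ε ¬cx)

        lookup-label : ∀ x x≉ε ¬cx → classOf x ≡ centre′ (label x x≉ε ¬cx)
        lookup-label x x≉ε ¬cx = Anyₚ.lookup-index (class∈centres x x≉ε ¬cx)

      classLabelling : Labelling n (λ x → ¬ IsCyclic x) (Fin (length centres))
      classLabelling = record
        { label       = label
        ; label-power = λ {x} {y} k e x≉ε ¬cx y≉ε ¬cy → distinct _ _
            (trans (sym (lookup-label x x≉ε ¬cx)) (trans (class-power {x} {y} k e x≉ε y≉ε ¬cy) (lookup-label y y≉ε ¬cy)))
        ; rep         = rep
        ; rep≉ε       = rep≉ε
        ; rep-Q       = rep-noncyclic
        ; label-rep   = λ i → distinct _ _
            (trans (sym (lookup-label (rep i) (rep≉ε i) (rep-noncyclic i))) (rep-class i))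
        ; connect     = λ x x≉ε ¬cx → joined x x≉ε ¬cx _ (lookup-label x x≉ε ¬cx)
        }

  -- A single link to the centre suffices in degrees up to 5; degree 6 needs longer walks.
  LinkedToClass : Set
  LinkedToClass = All (λ v → Exempt v ⊎ Link v (class v)) (codes n)

  linkedToClass? : Dec LinkedToClass
  linkedToClass? = All.all? (λ v → exempt? v ⊎-dec link? v (class v)) (codes n)

  linkedLabelling : Complete → LinkedToClass → Labelling n (λ x → ¬ IsCyclic x) (Fin (length centres))
  linkedLabelling C linked = classLabelling C λ x x≉ε ¬cx i eq →
    link⇒∼ {x} {rep C i} x≉ε (rep≉ε C i) (subst (Link (encode x)) (trans eq (sym (encode-decode (Complete.valid C i))))
      (case All.lookup linked (encode∈codes x) of λ
        { (inj₁ ex) → contradiction ex (not-exempt {x} x≉ε ¬cx) ; (inj₂ l) → l }))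

module _ (n : ℕ) where
  open Codes n

  involutions : List (Code n)
  involutions = filter (λ v → ¬? (v ≟ᶜ identity) ×-dec (pow 2 v ≟ᶜ identity)) (codes n)

  -- In degrees 3 to 5 each component without elements of order `p` contains exactly one involution,
  -- and this serves as its name. The default `v` is returned where no link exists, as for a 3-cycle
  -- in degree 3.
  linkedInvolution : List (Code n) → Code n → Code n
  linkedInvolution zs v = Maybe.fromMaybe v (List.head (filter (link? v) zs))

module _ {n p : ℕ} (pp : Prime p) (np : Near n p) where
  open Exceptional {n} pp (near⇒≤ np)

  module _ (zs : List (Code n)) where
    open ClassLabelling {n} pp np (linkedInvolution n zs) zs

    InvolutionCentres : Set
    InvolutionCentres = Complete × LinkedToClass

    involutionCentres? : Dec InvolutionCentres
    involutionCentres? = complete? ×-dec linkedToClass?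

    involutionLabelling : InvolutionCentres → Labelling n (λ x → ¬ IsCyclic x) (Fin (length zs))
    involutionLabelling (C , l) = linkedLabelling C l

abstract
  centres₂ : List (Code 2)
  -- In degree 2 the only non-identity element has order `p` = 2, so nothing is left to label.
  centres₂ = []

  centres₃ : List (Code 3)
  centres₃ = involutions 3

  centres₄ : List (Code 4)
  centres₄ = involutions 4

  centres₅ : List (Code 5)
  centres₅ = involutions 5

  good₂ : InvolutionCentres prime[2] (inj₁ refl) centres₂
  good₂ = toWitness {a? = involutionCentres? prime[2] (inj₁ refl) centres₂} _

  good₃ : InvolutionCentres prime[3] (inj₁ refl) centres₃
  good₃ = toWitness {a? = involutionCentres? prime[3] (inj₁ refl) centres₃} _

  good₄ : InvolutionCentres prime[3] (inj₂ refl) centres₄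
  good₄ = toWitness {a? = involutionCentres? prime[3] (inj₂ refl) centres₄} _

  good₅ : InvolutionCentres prime[5] (inj₁ refl) centres₅
  good₅ = toWitness {a? = involutionCentres? prime[5] (inj₁ refl) centres₅} _

  count₂ : length centres₂ ≡ 0
  count₂ = refl

  count₃ : length centres₃ ≡ 3
  count₃ = refl

  count₄ : length centres₄ ≡ 9
  count₄ = refl

  count₅ : length centres₅ ≡ 25
  count₅ = toWitness {a? = length centres₅ ℕₚ.≟ 25} _

P₀-Sym2 : P₀ (Sym 2) HasComponents 1
P₀-Sym2 = P₀-combine prime[2] (inj₁ refl) (PrimeDegree.cyclicLabelling prime[2]) (↔-id _)
  (involutionLabelling prime[2] (inj₁ refl) centres₂ good₂) (↔-id _) (cong (1 +_) count₂)

P₀-Sym3 : P₀ (Sym 3) HasComponents 4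
P₀-Sym3 = P₀-combine prime[3] (inj₁ refl) (PrimeDegree.cyclicLabelling prime[3]) (↔-id _)
  (involutionLabelling prime[3] (inj₁ refl) centres₃ good₃) (↔-id _) (cong (1 +_) count₃)

P₀-Sym4 : P₀ (Sym 4) HasComponents 13
P₀-Sym4 = P₀-combine prime[3] (inj₂ refl) (PrimeDegree+1.cyclicLabelling prime[3]) (↔-sym Finₚ.*↔×)
  (involutionLabelling prime[3] (inj₂ refl) centres₄ good₄) (↔-id _) (cong (4 +_) count₄)

P₀-Sym5 : P₀ (Sym 5) HasComponents 31
P₀-Sym5 = P₀-combine prime[5] (inj₁ refl) (PrimeDegree.cyclicLabelling prime[5]) (↔-id _)
  (involutionLabelling prime[5] (inj₁ refl) centres₅ good₅) (↔-id _) (cong (6 +_) count₅)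

-- Fixed points of codes

triple : ∀ {A : Set} → A → A → A → Fin 3 → A
triple x y z zero          = x
triple x y z (suc zero)    = y
triple x y z (suc (suc _)) = z

triple-inj : ∀ {A : Set} {x y z : A} → x ≢ y → x ≢ z → y ≢ z → Inj (triple x y z)
triple-inj x≢y x≢z y≢z {zero}           {zero}           _  = refl
triple-inj x≢y x≢z y≢z {zero}           {suc zero}       eq = contradiction eq x≢y
triple-inj x≢y x≢z y≢z {zero}           {suc (suc zero)} eq = contradiction eq x≢z
triple-inj x≢y x≢z y≢z {suc zero}       {zero}           eq = contradiction (sym eq) x≢y
triple-inj x≢y x≢z y≢z {suc zero}       {suc zero}       _  = refl
triple-inj x≢y x≢z y≢z {suc zero}       {suc (suc zero)} eq = contradiction eq y≢z
triple-inj x≢y x≢z y≢z {suc (suc zero)} {zero}           eq = contradiction (sym eq) x≢z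
triple-inj x≢y x≢z y≢z {suc (suc zero)} {suc zero}       eq = contradiction (sym eq) y≢z
triple-inj x≢y x≢z y≢z {suc (suc zero)} {suc (suc zero)} _  = refl

module FixedPoints (n : ℕ) where
  open Codes n
  open Permutations n

  FixesTwo FixesThree : Code n → Set
  FixesTwo v   = ∃ λ i → Vec.lookup v i ≡ i × ∃ λ j → Vec.lookup v j ≡ j × i ≢ j
  FixesThree v = ∃ λ i → Vec.lookup v i ≡ i × ∃ λ j → Vec.lookup v j ≡ j × i ≢ j ×
                 ∃ λ k → Vec.lookup v k ≡ k × i ≢ k × j ≢ k

  fixesTwo? : ∀ v → Dec (FixesTwo v)
  fixesTwo? v = Finₚ.any? λ i → (Vec.lookup v i Finₚ.≟ i) ×-dec Finₚ.any? λ j → (Vec.lookup v j Finₚ.≟ j) ×-dec ¬? (i Finₚ.≟ j)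

  fixesThree? : ∀ v → Dec (FixesThree v)
  fixesThree? v = Finₚ.any? λ i → (Vec.lookup v i Finₚ.≟ i) ×-dec Finₚ.any? λ j → (Vec.lookup v j Finₚ.≟ j) ×-dec ¬? (i Finₚ.≟ j) ×-dec
    Finₚ.any? λ k → (Vec.lookup v k Finₚ.≟ k) ×-dec ¬? (i Finₚ.≟ k) ×-dec ¬? (j Finₚ.≟ k)

  Free : Code n → Set
  Free v = ∀ i → Vec.lookup v i ≢ i

  free? : ∀ v → Dec (Free v)
  free? v = Finₚ.all? λ i → ¬? (Vec.lookup v i Finₚ.≟ i)

  lookup-encode : ∀ (x : Π) {w} → encode x ≡ w → ∀ {i j} → Vec.lookup w i ≡ j → x ⟨$⟩ʳ i ≡ j
  lookup-encode x refl {i} eq = trans (sym (Vecₚ.lookup∘tabulate (x ⟨$⟩ʳ_) i)) eq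

  fixesTwo : ∀ x → FixesTwo (encode x) → Σ (Fin 2 → Fin n) λ a → Inj a × (∀ i → x ⟨$⟩ʳ a i ≡ a i)
  fixesTwo x (i , ei , j , ej , i≢j) = pair i j , pair-inj i≢j ,
    λ { zero → lookup-encode x refl ei ; (suc zero) → lookup-encode x refl ej }

  fixesThree : ∀ x → FixesThree (encode x) → Σ (Fin 3 → Fin n) λ a → Inj a × (∀ i → x ⟨$⟩ʳ a i ≡ a i)
  fixesThree x (i , ei , j , ej , i≢j , k , ek , i≢k , j≢k) = triple i j k , triple-inj i≢j i≢k j≢k ,
    λ { zero → lookup-encode x refl ei ; (suc zero) → lookup-encode x refl ej ; (suc (suc zero)) → lookup-encode x refl ek }

-- Degree 6

module Degree6 where
  open Codes 6
  open Permutations 6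
  open FixedPoints 6

  fixedCount : Code 6 → ℕ
  fixedCount v = length (filter (λ i → Vec.lookup v i Finₚ.≟ i) (allFin 6))

  private
    fromFirst : Fin 6 → Fin 6 → Fin 6 → Fin 6 → Fin 6 → Fin 6 → Code 6
    fromFirst a b c d e f = a Vec.∷ b Vec.∷ c Vec.∷ d Vec.∷ e Vec.∷ f Vec.∷ Vec.[]

  pattern 0F = zero
  pattern 1F = suc zero
  pattern 2F = suc (suc zero)
  pattern 3F = suc (suc (suc zero))
  pattern 4F = suc (suc (suc (suc zero)))
  pattern 5F = suc (suc (suc (suc (suc zero))))

  -- (0 1)(2 3)(4 5) and (0 1)
  freeCentre transpositionCentre : Code 6
  freeCentre          = fromFirst 1F 0F 3F 2F 5F 4F
  transpositionCentre = fromFirst 1F 0F 2F 3F 4F 5F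

  -- The number of fixed points tells the type of an involution. A double transposition, with two
  -- fixed points, is the only involution of its component and names it.
  classOfInvolution : ℕ → Code 6 → Code 6
  classOfInvolution 0 w = freeCentre
  classOfInvolution 2 w = w
  classOfInvolution _ w = transpositionCentre

  -- Elements of order 4 belong to their square. Among those of orders 3 and 6, the types 3,3 and 6
  -- have no fixed point and join the involutions of type 2,2,2, while the types 3,1,1,1 and 3,2,1
  -- join the transpositions.
  class : Code 6 → Code 6
  class v =
    if does (pow 2 v ≟ᶜ identity) then classOfInvolution (fixedCount v) v
    else if does (pow 4 v ≟ᶜ identity) then classOfInvolution (fixedCount (pow 2 v)) (pow 2 v)
    else if does (fixedCount v ℕₚ.≟ 0) then freeCentre
    else transpositionCentre

  -- New codes go to the front, so each one is linked to a later one and `v` stays last, as `IsBall`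
  -- and `centre` expect.
  growBall : Code 6 → List (Code 6) → Ball
  growBall v = foldl (λ ws w → if does (¬? (Any.any? (w ≟ᶜ_) ws) ×-dec Any.any? (link? w) ws) then w ∷ ws else ws) (v ∷ [])

  -- The hypotheses of `fixesThree⇒∼` and `fixesTwo⇒∼` in a form that can be evaluated.
  HasPoints : Code 6 → Set
  HasPoints w = w ≢ identity × ((pow 2 w ≡ identity × FixesThree w) ⊎ (pow 3 w ≡ identity × FixesTwo w))

  hasPoints? : ∀ w → Dec (HasPoints w)
  hasPoints? w = ¬? (w ≟ᶜ identity) ×-dec (((pow 2 w ≟ᶜ identity) ×-dec fixesThree? w) ⊎-dec ((pow 3 w ≟ᶜ identity) ×-dec fixesTwo? w))

  abstract
    freeBall : Ball
    -- The second pass takes in candidates that came too early in the first one to be linked to the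
    -- ball.
    freeBall = growBall freeCentre (candidates ++ candidates)
      where
      candidates : List (Code 6)
      candidates = filter (λ v → free? v ×-dec
        -- If the cycle through 0 is `0, a, b`, the inequality is `a < b`; it selects one of each
        -- element of order 3 and its inverse.
        ((pow 2 v ≟ᶜ identity) ⊎-dec ((Vec.lookup v 0F Finₚ.<? Vec.lookup v (Vec.lookup v 0F)) ×-dec (pow 3 v ≟ᶜ identity)))) (codes 6)

    otherCentres : List (Code 6)
    otherCentres = filter (λ v → fixedCount v ℕₚ.≟ 2) (involutions 6)

  centres : List (Code 6)
  centres = freeCentre ∷ transpositionCentre ∷ otherCentres

  abstract
    centreCount : length centres ≡ 47
    centreCount = toWitness {a? = length centres ℕₚ.≟ 47} _

  open ClassLabelling {6} prime[5] (inj₂ refl) class centres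

  -- How an element reaches its centre: through the ball around `freeCentre`, through one of its
  -- first three powers that is joined to transpositions, or by one link to a double transposition.
  Shape : Ball → Code 6 → Set
  Shape ball v = Exempt v
               ⊎ (class v ≡ freeCentre × Free v × Any (Link v) ball)
               ⊎ (class v ≡ transpositionCentre × Any (λ k → HasPoints (pow k v)) (1 ∷ 2 ∷ 3 ∷ []))
               ⊎ (class v ≢ freeCentre × class v ≢ transpositionCentre × Link v (class v))

  shape? : ∀ ball v → Dec (Shape ball v)
  shape? ball v = exempt? v
    ⊎-dec ((class v ≟ᶜ freeCentre) ×-dec free? v ×-dec Any.any? (link? v) ball)
    ⊎-dec ((class v ≟ᶜ transpositionCentre) ×-dec Any.any? (λ k → hasPoints? (pow k v)) (1 ∷ 2 ∷ 3 ∷ []))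
    ⊎-dec (¬? (class v ≟ᶜ freeCentre) ×-dec ¬? (class v ≟ᶜ transpositionCentre) ×-dec link? v (class v))

  -- Prepared for degree 7, where an element of order 2 or 3 with exactly one fixed point restricts
  -- to such a code.
  FreeClass : Code 6 → Set
  FreeClass v = Free v → pow 2 v ≡ identity ⊎ pow 3 v ≡ identity → class v ≡ freeCentre

  freeClass? : ∀ v → Dec (FreeClass v)
  freeClass? v = free? v →-dec ((pow 2 v ≟ᶜ identity) ⊎-dec (pow 3 v ≟ᶜ identity)) →-dec (class v ≟ᶜ freeCentre)

  Facts : Ball → Set
  Facts ball = IsBall ball × centre ball ≡ freeCentre × All (Shape ball) (codes 6)

  facts? : ∀ ball → Dec (Facts ball)
  facts? ball = isBall? ball ×-dec (centre ball ≟ᶜ freeCentre) ×-dec All.all? (shape? ball) (codes 6)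

  abstract
    good : Complete
    good = toWitness {a? = complete?} _

    facts : Facts freeBall
    facts = toWitness {a? = facts? freeBall} _

    freeClass : All FreeClass (codes 6)
    freeClass = toWitness {a? = All.all? freeClass? (codes 6)} _

  open Exceptional {6} prime[5] (near⇒≤ (inj₂ refl)) using (IsCyclic)
  open Rotations 6 using (module Main)
  open Main ℕₚ.≤-refl

  hasPoints⇒∼ : ∀ {w} x → encode x ≡ w → (x≉ε : ¬ x ≈ ε) → HasPoints w → (x , x≉ε) ∼ transposition₀
  hasPoints⇒∼ x refl x≉ε (_ , inj₁ (x2 , fix)) = let a , a-inj , xa = fixesThree x fix in
    fixesThree⇒∼ {x} (^-fromCode {x} 2 x2) x≉ε a a-inj xa
  hasPoints⇒∼ x refl x≉ε (_ , inj₂ (x3 , fix)) = let a , a-inj , xa = fixesTwo x fix in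
    fixesTwo⇒∼ {x} (Rotations.3⊥2 6) (^-fromCode {x} 3 x3) x≉ε a a-inj xa

  power-hasPoints⇒∼ : ∀ x (x≉ε : ¬ x ≈ ε) → Any (λ k → HasPoints (pow k (encode x))) (1 ∷ 2 ∷ 3 ∷ []) → (x , x≉ε) ∼ transposition₀
  power-hasPoints⇒∼ x x≉ε a = let k , hp = Any.satisfied a in via k hp
    where
    via : ∀ k → HasPoints (pow k (encode x)) → (x , x≉ε) ∼ transposition₀
    via k hp@(w≢id , _) = ∼-trans {x , x≉ε} {x ^′ k , xk≉ε} {transposition₀} (^⇒∼ {x} x≉ε k xk≉ε)
        (hasPoints⇒∼ (x ^′ k) (encode-^ x k) xk≉ε hp)
      where
      xk≉ε : ¬ x ^′ k ≈ ε
      xk≉ε e = w≢id (^-toCode {x} k e)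

  shapeOf : ∀ x → Shape freeBall (encode x)
  shapeOf x = All.lookup (proj₂ (proj₂ facts)) (encode∈codes x)

  private
    c : Fin (length centres) → Code 6
    c = List.lookup centres

  free≢transposition : freeCentre ≢ transpositionCentre
  free≢transposition ()

  joined : ∀ x (x≉ε : ¬ x ≈ ε) → ¬ IsCyclic x → ∀ i → classOf x ≡ c i → (x , x≉ε) ∼ (rep good i , rep≉ε good i)
  joined x x≉ε ¬cx i eq = byShape (shapeOf x)
    where
    y : Π
    y = rep good i
    y≉ε : ¬ y ≈ ε
    y≉ε = rep≉ε good i
    class-y : class (encode y) ≡ c i
    class-y = rep-class good i
    encode-y : encode y ≡ c i
    encode-y = encode-decode (Complete.valid good i)
    freeValid : Valid (centre freeBall)
    freeValid = centre-valid freeBall (proj₁ facts)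
    -- `transposition₀` need not be the centre `(0 1)`, so the representative is joined to it by its
    -- own shape.
    rep-transposition : class (encode y) ≡ transpositionCentre → (y , y≉ε) ∼ transposition₀
    rep-transposition ey = case shapeOf y of λ
      { (inj₁ ex)                            → contradiction ex (not-exempt {y} y≉ε (rep-noncyclic good i))
      ; (inj₂ (inj₁ (e , _)))                → contradiction (trans (sym e) ey) free≢transposition
      ; (inj₂ (inj₂ (inj₁ (_ , hp))))        → power-hasPoints⇒∼ y y≉ε hp
      ; (inj₂ (inj₂ (inj₂ (_ , ne , _))))    → contradiction ey ne
      }
    byShape : Shape freeBall (encode x) → (x , x≉ε) ∼ (y , y≉ε)
    byShape (inj₁ ex) = contradiction ex (not-exempt {x} x≉ε ¬cx)
    byShape (inj₂ (inj₁ (ex , _ , l))) = ∼-trans {x , x≉ε} {decode₀ freeValid} {y , y≉ε}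
      (linked⇒∼ freeBall (proj₁ facts) x x≉ε l)
      (≈⇒∼ (encode-injective {decode freeValid} {y} (trans (encode-decode freeValid)
        (trans (proj₁ (proj₂ facts)) (trans (sym ex) (trans eq (sym encode-y)))))))
    byShape (inj₂ (inj₂ (inj₁ (ex , hp)))) = ∼-trans {x , x≉ε} {transposition₀} {y , y≉ε}
      (power-hasPoints⇒∼ x x≉ε hp)
      (∼-sym {y , y≉ε} {transposition₀} (rep-transposition (trans class-y (trans (sym eq) ex))))
    byShape (inj₂ (inj₂ (inj₂ (_ , _ , l)))) =
      link⇒∼ {x} {y} x≉ε y≉ε (subst (Link (encode x)) (trans eq (sym encode-y)) l)

  labelling : Labelling 6 (λ x → ¬ IsCyclic x) (Fin (length centres))
  labelling = classLabelling good joined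

  inFreeClass⇒free : ∀ {x} → ¬ x ≈ ε → ¬ IsCyclic x → classOf x ≡ freeCentre → ∀ i → x ⟨$⟩ʳ i ≢ i
  inFreeClass⇒free {x} x≉ε ¬cx eq i xi≡i = case shapeOf x of λ
    { (inj₁ ex)                         → not-exempt {x} x≉ε ¬cx ex
    ; (inj₂ (inj₁ (_ , free , _)))      → free i (trans (Vecₚ.lookup∘tabulate (x ⟨$⟩ʳ_) i) xi≡i)
    ; (inj₂ (inj₂ (inj₁ (e , _))))      → free≢transposition (trans (sym eq) e)
    ; (inj₂ (inj₂ (inj₂ (ne , _ , _)))) → ne eq
    }

P₀-Sym6 : P₀ (Sym 6) HasComponents 83
P₀-Sym6 = P₀-combine prime[5] (inj₂ refl) (PrimeDegree+1.cyclicLabelling prime[5]) (↔-sym Finₚ.*↔×)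
  Degree6.labelling (↔-id _) (cong (36 +_) Degree6.centreCount)

-- Degree 7

module Degree7 where
  open Codes 7
  open Permutations 7
  open FixedPoints 7
  open Rotations.Main 7 (ℕₚ.n≤1+n 6)
  open Exceptional {7} prime[7] (ℕₚ.n≤1+n 7)
  private
    module S₆ = Permutations 6
    module F₆ = FixedPoints 6
    module C₆ = Codes 6
    module D₆ = Degree6
    module L₆ = ClassLabelling {6} prime[5] (inj₂ refl) Degree6.class Degree6.centres
    module E₆ = Exceptional {6} prime[5] (near⇒≤ (inj₂ refl))

  FixesOnlyOne : Code 7 → Set
  FixesOnlyOne v = ∃ λ b → Vec.lookup v b ≡ b × (∀ c → Vec.lookup v c ≡ c → c ≡ b)

  -- The first alternative discards codes that no exponent 2, 3 or 5 kills. Among elements of order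
  -- 2, 3 or 5, the last one is met exactly by the cycle types 2,2,2,1 and 3,3,1.
  Trichotomy : Code 7 → Set
  Trichotomy v = (pow 2 v ≢ identity × pow 3 v ≢ identity × pow 5 v ≢ identity)
               ⊎ FixesThree v
               ⊎ (pow 2 v ≢ identity × FixesTwo v)
               ⊎ (pow 5 v ≢ identity × FixesOnlyOne v)

  trichotomy? : ∀ v → Dec (Trichotomy v)
  trichotomy? v =
    (¬? (pow 2 v ≟ᶜ identity) ×-dec ¬? (pow 3 v ≟ᶜ identity) ×-dec ¬? (pow 5 v ≟ᶜ identity))
    ⊎-dec fixesThree? v
    ⊎-dec (¬? (pow 2 v ≟ᶜ identity) ×-dec fixesTwo? v)
    ⊎-dec (¬? (pow 5 v ≟ᶜ identity) ×-dec Finₚ.any? λ b → (Vec.lookup v b Finₚ.≟ b) ×-dec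
      Finₚ.all? λ c → (Vec.lookup v c Finₚ.≟ c) →-dec (c Finₚ.≟ b))

  abstract
    trichotomy : All Trichotomy (codes 7)
    trichotomy = toWitness {a? = All.all? trichotomy? (codes 7)} _

  FreeAt : Π → Fin 7 → Set
  FreeAt x b = x ⟨$⟩ʳ b ≡ b × ¬ E₆.IsCyclic (Perm.remove b x) × L₆.classOf (Perm.remove b x) ≡ D₆.freeCentre

  -- x permutes six of the points as an element of the component of (0 1)(2 3)(4 5) in degree 6.
  AlmostFree : Π → Set
  AlmostFree x = ∃ (FreeAt x)

  almostFree? : ∀ x → Dec (AlmostFree x)
  almostFree? x = Finₚ.any? λ b → ((x ⟨$⟩ʳ b) Finₚ.≟ b) ×-dec ¬? (E₆.isCyclic? (Perm.remove b x))
    ×-dec (L₆.classOf (Perm.remove b x) C₆.≟ᶜ D₆.freeCentre)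

  -- The component of `freeCentre` in degree 6 consists of elements without fixed points, so `x`
  -- fixes nothing besides `b`.
  freeAt-unique : ∀ {x b} → ¬ x ≈ ε → FreeAt x b → ∀ {c} → x ⟨$⟩ʳ c ≡ c → c ≡ b
  freeAt-unique {x} {b} x≉ε (xb , ¬c , eq) {c} = byView c (I.view c)
    where
    module I = Insertion b
    byView : ∀ c → I.View c → x ⟨$⟩ʳ c ≡ c → c ≡ b
    byView _ I.at-b      _  = refl
    byView _ (I.other j) xc = contradiction
      (Finₚ.punchIn-injective b _ _ (trans (sym (I.ι-punchIn (I.restrict x) j)) (trans (I.ι-restrict {x} xb (punchIn b j)) xc)))
      (D₆.inFreeClass⇒free {I.restrict x} (I.restrict-≉ε {x} xb x≉ε) ¬c eq j)

  module _ {x y : Π} (k : ℕ) (x≈yk : x ≈ y ^′ k) (x≉ε : ¬ x ≈ ε) where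
    private
      y≉ε : ¬ y ≈ ε
      y≉ε e = x≉ε λ i → trans (x≈yk i) (^-ε {y} k e i)

      module _ {b : Fin 7} (xb : x ⟨$⟩ʳ b ≡ b) (yb : y ⟨$⟩ʳ b ≡ b) where
        module J = Insertion b
        x′≉ε : ¬ J.restrict x S₆.≈ S₆.ε
        x′≉ε = J.restrict-≉ε {x} xb x≉ε
        y′≉ε : ¬ J.restrict y S₆.≈ S₆.ε
        y′≉ε = J.restrict-≉ε {y} yb y≉ε
        x′≈y′k : J.restrict x S₆.≈ J.restrict y S₆.^′ k
        x′≈y′k = J.restrict-≈^ {x} {y} k x≈yk xb yb

    almostFree-down : AlmostFree y → AlmostFree x
    almostFree-down (b , yb , ¬cy , eq) = b , xb ,
        (λ cx → ¬cy (E₆.isCyclic-up {I.restrict x} {I.restrict y} k (x′≈y′k xb yb) (x′≉ε xb yb) cx)) ,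
        trans (L₆.class-power D₆.good {I.restrict x} {I.restrict y} k (x′≈y′k xb yb) (x′≉ε xb yb) (y′≉ε xb yb) ¬cy) eq
      where
      module I = Insertion b
      xb : x ⟨$⟩ʳ b ≡ b
      xb = trans (x≈yk b) (fixed-^ {y} k yb)

    -- `y` commutes with its power `x` and so permutes the fixed points of `x`. The only one is `b`;
    -- thus `y` fixes `b` as well, and both elements can be compared in degree 6.
    almostFree-up : AlmostFree x → AlmostFree y
    almostFree-up (b , xb , ¬cx , eq) = b , yb , ¬cy ,
        trans (sym (L₆.class-power D₆.good {I.restrict x} {I.restrict y} k (x′≈y′k xb yb) (x′≉ε xb yb) (y′≉ε xb yb) ¬cy)) eq
      where
      module I = Insertion b
      yb : y ⟨$⟩ʳ b ≡ b
      yb = freeAt-unique {x} x≉ε (xb , ¬cx , eq) (begin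
        x ⟨$⟩ʳ (y ⟨$⟩ʳ b)        ≡⟨ x≈yk (y ⟨$⟩ʳ b) ⟩
        y ^′ k ⟨$⟩ʳ (y ⟨$⟩ʳ b)   ≡⟨ ^-suc y k b ⟩
        y ⟨$⟩ʳ (y ^′ k ⟨$⟩ʳ b)   ≡⟨ cong (y ⟨$⟩ʳ_) (trans (sym (x≈yk b)) xb) ⟩
        y ⟨$⟩ʳ b                 ∎)
        where open ≡-Reasoning
      ¬cy : ¬ E₆.IsCyclic (I.restrict y)
      ¬cy cy = ¬cx (E₆.isCyclic-down {I.restrict x} {I.restrict y} k (x′≈y′k xb yb) (x′≉ε xb yb) cy)

  private
    free₆ : S₆.Π
    free₆ = L₆.rep D₆.good zero

    free₆≉ε : ¬ free₆ S₆.≈ S₆.ε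
    free₆≉ε = L₆.rep≉ε D₆.good zero

    free : Fin 7 → Π
    free b = Insertion.ι b free₆

    free≉ε : ∀ b → ¬ free b ≈ ε
    free≉ε b = Insertion.ι-≉ε b {free₆} free₆≉ε

    free-freeAt : ∀ b → FreeAt (free b) b
    free-freeAt b = I.ι-b free₆ ,
        (λ c → L₆.rep-noncyclic D₆.good zero (λ i →
          trans (S₆.^-cong {free₆} {I.restrict (free b)} 5 (λ j → sym (I.restrict-ι free₆ j)) i) (c i))) ,
        trans (cong D₆.class (C₆.encode-cong {I.restrict (free b)} {free₆} (I.restrict-ι free₆))) (L₆.rep-class D₆.good zero)
      where module I = Insertion b

    -- An element of order 7 would restrict to one of degree 6, where prime orders are at most 6.
    free-noncyclic : ∀ b → ¬ IsCyclic (free b)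
    free-noncyclic b c = ℕₚ.<-irrefl refl (Rotations.primeOrder≤n 6 {free₆} prime[7] (λ i →
        Insertion.ι-injective b {free₆ S₆.^′ 7} {S₆.ε} (λ j → trans (Insertion.ι-^ b 7 free₆ j) (trans (c j) (sym (Insertion.ι-ε b j)))) i)
        free₆≉ε)

  almostFreeLabelling : Labelling 7 (λ x → ¬ IsCyclic x × AlmostFree x) (Fin 7)
  almostFreeLabelling = record
    { label       = λ _ _ (_ , b , _) → b
    ; label-power = λ {x} {y} k e x≉ε (_ , b , fb) y≉ε (_ , c , yc , _) →
        sym (freeAt-unique {x} x≉ε fb (trans (e c) (fixed-^ {y} k yc)))
    ; rep         = free
    ; rep≉ε       = free≉ε
    ; rep-Q       = λ b → free-noncyclic b , b , free-freeAt b
    ; label-rep   = λ _ → refl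
    ; connect     = λ x x≉ε (_ , b , xb , ¬c , eq) → joinedAt x x≉ε b xb ¬c eq
    }
    where
    joinedAt : ∀ x (x≉ε : ¬ x ≈ ε) b → x ⟨$⟩ʳ b ≡ b → ¬ E₆.IsCyclic (Perm.remove b x) →
               L₆.classOf (Perm.remove b x) ≡ D₆.freeCentre → (x , x≉ε) ∼ (free b , free≉ε b)
    joinedAt x x≉ε b xb ¬c eq = ∼-trans {x , x≉ε} {I.ι (I.restrict x) , I.ι-≉ε {I.restrict x} x′≉ε} {free b , free≉ε b}
        (≈⇒∼ λ i → sym (I.ι-restrict {x} xb i))
        (I.ι-∼ {I.restrict x} {free₆} x′≉ε free₆≉ε (D₆.joined (I.restrict x) x′≉ε ¬c zero eq))
      where
      module I = Insertion b
      x′≉ε : ¬ I.restrict x S₆.≈ S₆.ε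
      x′≉ε = I.restrict-≉ε {x} xb x≉ε

  dropThird : ∀ {v} → FixesThree v → FixesTwo v
  dropThird (i , ei , j , ej , i≢j , _) = i , ei , j , ej , i≢j

  Outcome : (y : Π) → ¬ y ≈ ε → Set
  Outcome y y≉ε = (y , y≉ε) ∼ transposition₀ ⊎ AlmostFree y

  fixesTwo-outcome : ∀ {q} y (y≉ε : ¬ y ≈ ε) → Prime q → q ≢ 2 → y ^′ q ≈ ε → FixesTwo (encode y) → Outcome y y≉ε
  fixesTwo-outcome y y≉ε pq q≢2 yq fix = let a , a-inj , ya = fixesTwo y fix in
    inj₁ (fixesTwo⇒∼ {y} (primes-coprime pq prime[2] q≢2) yq y≉ε a a-inj ya)

  -- Off its only fixed point `y` acts on six points without fixed points and with order 2 or 3, the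
  -- situation of `freeClass`.
  fixesOne-outcome : ∀ {q} y (y≉ε : ¬ y ≈ ε) → Prime q → q ≢ 5 → q ≡ 2 ⊎ q ≡ 3 → y ^′ q ≈ ε →
                     FixesOnlyOne (encode y) → Outcome y y≉ε
  fixesOne-outcome {q} y y≉ε pq q≢5 q23 yq (b , eb , only) = inj₂ (b , yb ,
      -- An element killed by both `q` and 5 would be trivial.
      (λ c → y′≉ε (S₆.coprime-trivial {I.restrict y} (primes-coprime pq prime[5] q≢5) y′q c)) ,
      All.lookup D₆.freeClass (C₆.encode∈codes (I.restrict y)) isFree
        ([ (λ { refl → inj₁ (C₆.^-toCode {I.restrict y} 2 y′q) }) , (λ { refl → inj₂ (C₆.^-toCode {I.restrict y} 3 y′q) }) ]′ q23))
    where
    module I = Insertion b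
    yb : y ⟨$⟩ʳ b ≡ b
    yb = lookup-encode y refl eb
    y′≉ε : ¬ I.restrict y S₆.≈ S₆.ε
    y′≉ε = I.restrict-≉ε {y} yb y≉ε
    y′q : I.restrict y S₆.^′ q S₆.≈ S₆.ε
    y′q = I.restrict-^ε {y} q yb yq
    isFree : F₆.Free (C₆.encode (I.restrict y))
    isFree j eq = Finₚ.punchInᵢ≢i b j (only (punchIn b j) (trans (Vecₚ.lookup∘tabulate (y ⟨$⟩ʳ_) (punchIn b j)) (begin
      y ⟨$⟩ʳ punchIn b j                      ≡⟨ I.ι-restrict {y} yb (punchIn b j) ⟨
      I.ι (I.restrict y) ⟨$⟩ʳ punchIn b j     ≡⟨ I.ι-punchIn (I.restrict y) j ⟩
      punchIn b (I.restrict y ⟨$⟩ʳ j)         ≡⟨ cong (punchIn b) (F₆.lookup-encode (I.restrict y) refl eq) ⟩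
      punchIn b j                             ∎)))
      where open ≡-Reasoning

  outcome : ∀ q y (y≉ε : ¬ y ≈ ε) → Prime q → q ≡ 2 ⊎ q ≡ 3 ⊎ q ≡ 5 → y ^′ q ≈ ε → Outcome y y≉ε
  outcome q y y≉ε pq cases yq = via cases (All.lookup trichotomy (encode∈codes y))
    where
    code : ∀ {r} → q ≡ r → pow r (encode y) ≡ identity
    code refl = ^-toCode {y} q yq
    via : q ≡ 2 ⊎ q ≡ 3 ⊎ q ≡ 5 → Trichotomy (encode y) → Outcome y y≉ε
    via (inj₁ q≡2)        (inj₁ (n2 , _ , _)) = contradiction (code q≡2) n2
    via (inj₂ (inj₁ q≡3)) (inj₁ (_ , n3 , _)) = contradiction (code q≡3) n3
    via (inj₂ (inj₂ q≡5)) (inj₁ (_ , _ , n5)) = contradiction (code q≡5) n5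
    via (inj₁ refl)       (inj₂ (inj₁ fix))   = let a , a-inj , ya = fixesThree y fix in
      inj₁ (fixesThree⇒∼ {y} yq y≉ε a a-inj ya)
    via (inj₂ (inj₁ refl)) (inj₂ (inj₁ fix))  = fixesTwo-outcome y y≉ε pq (λ ()) yq (dropThird {encode y} fix)
    via (inj₂ (inj₂ refl)) (inj₂ (inj₁ fix))  = fixesTwo-outcome y y≉ε pq (λ ()) yq (dropThird {encode y} fix)
    via (inj₁ q≡2)        (inj₂ (inj₂ (inj₁ (n2 , _)))) = contradiction (code q≡2) n2
    via (inj₂ (inj₁ refl)) (inj₂ (inj₂ (inj₁ (_ , fix)))) = fixesTwo-outcome y y≉ε pq (λ ()) yq fix
    via (inj₂ (inj₂ refl)) (inj₂ (inj₂ (inj₁ (_ , fix)))) = fixesTwo-outcome y y≉ε pq (λ ()) yq fix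
    via (inj₁ refl)        (inj₂ (inj₂ (inj₂ (_ , one))))  = fixesOne-outcome y y≉ε pq (λ ()) (inj₁ refl) yq one
    via (inj₂ (inj₁ refl)) (inj₂ (inj₂ (inj₂ (_ , one))))  = fixesOne-outcome y y≉ε pq (λ ()) (inj₂ refl) yq one
    via (inj₂ (inj₂ q≡5))  (inj₂ (inj₂ (inj₂ (n5 , _))))   = contradiction (code q≡5) n5

  smallPrimes : ∀ q → Prime q → q ≤ 7 → (q ≡ 2 ⊎ q ≡ 3 ⊎ q ≡ 5) ⊎ q ≡ 7
  smallPrimes 0 pq _ = contradiction pq ¬prime[0]
  smallPrimes 1 pq _ = contradiction pq ¬prime[1]
  smallPrimes 2 _  _ = inj₁ (inj₁ refl)
  smallPrimes 3 _  _ = inj₁ (inj₂ (inj₁ refl))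
  smallPrimes 4 pq _ = contradiction pq (from-no (prime? 4))
  smallPrimes 5 _  _ = inj₁ (inj₂ (inj₂ refl))
  smallPrimes 6 pq _ = contradiction pq (from-no (prime? 6))
  smallPrimes 7 _  _ = inj₂ refl
  smallPrimes (suc (suc (suc (suc (suc (suc (suc (suc q)))))))) _ (s≤s (s≤s (s≤s (s≤s (s≤s (s≤s (s≤s ())))))))

  mainLabelling : Labelling 7 (λ x → ¬ IsCyclic x × ¬ AlmostFree x) (Fin 1)
  mainLabelling = singleLabelling transposition₀ (noncyclic , notAlmostFree) λ x x≉ε (¬c , ¬f) → connect x x≉ε ¬c ¬f (primePower {x} x≉ε)
    where
    noncyclic : ¬ IsCyclic (proj₁ transposition₀)
    noncyclic c = proj₂ transposition₀ (coprime-trivial {proj₁ transposition₀}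
      (primes-coprime prime[2] prime[7] λ ()) transposition-^2 c)
    notAlmostFree : ¬ AlmostFree (proj₁ transposition₀)
    notAlmostFree (b , f) = let a , a-inj , ta = transposition-fixesTwo
                                unique = freeAt-unique {proj₁ transposition₀} (proj₂ transposition₀) f
                            in case a-inj (trans (unique (ta zero)) (sym (unique (ta (suc zero))))) of λ ()
    connect : ∀ x (x≉ε : ¬ x ≈ ε) → ¬ IsCyclic x → ¬ AlmostFree x → PrimePower x → (x , x≉ε) ∼ transposition₀
    connect x x≉ε ¬c ¬f (q , k , pq , xk≉ε , xkq) = case smallPrimes q pq (Rotations.primeOrder≤n 7 {x ^′ k} pq xkq xk≉ε) of λ
      { (inj₂ refl)  → contradiction (isCyclic-up {x ^′ k} {x} k (λ _ → refl) xk≉ε xkq) ¬c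
      ; (inj₁ cases) → case outcome q (x ^′ k) xk≉ε pq cases xkq of λ
          { (inj₁ y∼t) → ∼-trans {x , x≉ε} {x ^′ k , xk≉ε} {transposition₀} (^⇒∼ {x} x≉ε k xk≉ε) y∼t
          ; (inj₂ f)   → contradiction (almostFree-up {x ^′ k} {x} k (λ _ → refl) xk≉ε f) ¬f } }

  noncyclicLabelling : Labelling 7 (λ x → ¬ IsCyclic x) (Fin 7 ⊎ Fin 1)
  noncyclicLabelling = labelling-⊎
    (λ x _ ¬c → [ (λ f → inj₁ (¬c , f)) , (λ ¬f → inj₂ (¬c , ¬f)) ]′ (dec-⊎ (almostFree? x)))
    proj₁ proj₁
    (λ {x} {y} k e x≉ε (_ , f) (_ , ¬f) → ¬f (almostFree-up {x} {y} k e x≉ε f))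
    (λ {x} {y} k e x≉ε (_ , ¬f) (_ , f) → ¬f (almostFree-down {x} {y} k e x≉ε f))
    almostFreeLabelling mainLabelling

P₀-Sym7 : P₀ (Sym 7) HasComponents 128
P₀-Sym7 = P₀-combine prime[7] (inj₁ refl) (PrimeDegree.cyclicLabelling prime[7]) (↔-id _)
  Degree7.noncyclicLabelling (↔-sym Finₚ.+↔⊎) refl

-- Powers of partitions

private
  variable
    xs ys zs : List ℕ

extract : ∀ {x : ℕ} {xs} → x ∈ xs → ∃ λ ys → xs ↭ x ∷ ys
extract {x} x∈ with ∈-∃++ x∈
... | ys , zs , refl = ys ++ zs , ↭-shift x ys zs

infix 4 _↭?_
_↭?_ : ∀ (xs ys : List ℕ) → Dec (xs ↭ ys)
[]       ↭? []      = yes ↭-refl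
[]       ↭? (_ ∷ _) = no λ p → ¬x∷xs↭[] (↭-sym p)
(x ∷ xs) ↭? ys with Any.any? (x ℕₚ.≟_) ys
... | no  x∉ = no λ p → x∉ (∈-resp-↭ p (here refl))
... | yes x∈ with extract x∈
...   | ys′ , ys↭ with xs ↭? ys′
...     | yes p = yes (↭-trans (↭-prep x p) (↭-sym ys↭))
...     | no ¬p = no λ q → ¬p (drop-∷ (↭-trans q ys↭))

AllOnes : List ℕ → Set
AllOnes = All (_≡ 1)

allOnes≡replicate : AllOnes xs → xs ≡ replicate (sum xs) 1
allOnes≡replicate []          = refl
allOnes≡replicate (refl ∷ os) = cong (1 ∷_) (allOnes≡replicate os)

sum-replicate-1 : ∀ k → sum (replicate k 1) ≡ k
sum-replicate-1 zero    = refl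
sum-replicate-1 (suc k) = cong suc (sum-replicate-1 k)

replicate-ones : ∀ k → AllOnes (replicate k 1)
replicate-ones k = Allₚ.replicate⁺ k refl

≤-sum : ∀ {m} → m ∈ xs → m ≤ sum xs
≤-sum (here refl) = ℕₚ.m≤m+n _ _
≤-sum {x ∷ xs} (there m∈) = ℕₚ.≤-trans (≤-sum m∈) (ℕₚ.m≤n+m _ x)

module _ (a : ℕ) .{{_ : NonZero a}} where

  pw : List ℕ → List ℕ
  pw = concatMap (powerOfPart a)

  private
    instance
      gcd≢0 : ∀ {m} → NonZero (gcd a m)
      gcd≢0 {m} = ≢-nonZero (gcd[m,n]≢0 a m (inj₁ (≢-nonZero⁻¹ a)))

    replicate-/ : ∀ m {g h k} .{{_ : NonZero g}} → g ≡ h → m ≡ h * k → replicate g (m / g) ≡ replicate h k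
    replicate-/ m {g} {k = k} refl m≡ = cong (replicate g) (trans (cong (_/ g) (trans m≡ (ℕₚ.*-comm g k))) (m*n/n≡m k g))

  powerOfPart-/ : ∀ {m h k} → gcd a m ≡ h → m ≡ h * k → powerOfPart a m ≡ replicate h k
  powerOfPart-/ {m} = replicate-/ m

  powerOfPart-coprime : ∀ {m} → Coprime a m → powerOfPart a m ≡ m ∷ []
  powerOfPart-coprime {m} c = powerOfPart-/ (coprime⇒gcd≡1 c) (sym (ℕₚ.*-identityˡ m))

  powerOfPart-multiple : ∀ k → powerOfPart a (a * k) ≡ replicate a k
  powerOfPart-multiple k = powerOfPart-/ (∣-antisym (gcd[m,n]∣m a (a * k)) (gcd-greatest ∣-refl (m∣m*n k))) refl

  powerOfPart-divisor : ∀ {m} → m ∣ a → powerOfPart a m ≡ replicate m 1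
  powerOfPart-divisor {m} m∣a = powerOfPart-/ (∣-antisym (gcd[m,n]∣n a m) (gcd-greatest m∣a ∣-refl)) (sym (ℕₚ.*-identityʳ m))

  ∈-powerOfPart : ∀ {m k} → k ∈ powerOfPart a m → m ≡ gcd a m * k
  ∈-powerOfPart {m} k∈ with All.lookup (Allₚ.replicate⁺ {P = _≡ m / gcd a m} (gcd a m) refl) k∈
  ... | refl = sym (m*[n/m]≡n (gcd[m,n]∣n a m))

  ∈-pw : ∀ {xs k} → k ∈ pw xs → ∃ λ m → m ∈ xs × m ≡ gcd a m * k
  ∈-pw {xs} k∈ = let m , m∈ , k∈m = find (∈-concatMap⁻ (powerOfPart a) {xs = xs} k∈) in m , m∈ , ∈-powerOfPart k∈m

  pw-coprime : All (Coprime a) xs → pw xs ≡ xs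
  pw-coprime []       = refl
  pw-coprime (c ∷ cs) = cong₂ _++_ (powerOfPart-coprime c) (pw-coprime cs)

  pw-divisors : All (_∣ a) xs → AllOnes (pw xs)
  pw-divisors []                 = []
  pw-divisors {x ∷ xs} (d ∷ ds) = Allₚ.++⁺ (subst AllOnes (sym (powerOfPart-divisor d)) (replicate-ones x)) (pw-divisors ds)

  pw-↭ : xs ↭ ys → pw xs ↭ pw ys
  pw-↭ Perm↭.refl            = ↭-refl
  pw-↭ (Perm↭.prep x p)      = ↭-++⁺ˡ (powerOfPart a x) (pw-↭ p)
  pw-↭ (Perm↭.swap {xs} {ys} x y p) = ↭-trans (↭-shifts (powerOfPart a x) (powerOfPart a y))
    (↭-++⁺ˡ (powerOfPart a y) (↭-++⁺ˡ (powerOfPart a x) (pw-↭ p)))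
  pw-↭ (Perm↭.trans p q)     = ↭-trans (pw-↭ p) (pw-↭ q)

OneOr : ℕ → ℕ → Set
OneOr p m = m ≡ 1 ⊎ m ≡ p

oneOr⇒replicate : ∀ {p} → All (OneOr p) xs → ∃₂ λ t r → xs ↭ replicate t p ++ replicate r 1
oneOr⇒replicate [] = 0 , 0 , ↭-refl
oneOr⇒replicate (inj₁ refl ∷ os) = let t , r , e = oneOr⇒replicate os in
  t , suc r , ↭-trans (↭-prep 1 e) (↭-sym (↭-shift 1 (replicate t _) (replicate r 1)))
oneOr⇒replicate {p = p} (inj₂ refl ∷ os) = let t , r , e = oneOr⇒replicate os in suc t , r , ↭-prep p e

oneOr-coprime : ∀ {a p} → Coprime a p → All (OneOr p) xs → All (Coprime a) xs
oneOr-coprime {a = a} c = All.map λ { (inj₁ refl) (_ , d∣1) → ∣1⇒≡1 d∣1 ; (inj₂ refl) → c }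

oneOr-divides : ∀ {p} → All (OneOr p) xs → All (_∣ p) xs
oneOr-divides {p = p} = All.map λ { (inj₁ refl) → 1∣ p ; (inj₂ refl) → ∣-refl }

oneOr-positive : ∀ {p} → 0 < p → All (OneOr p) xs → All (0 <_) xs
oneOr-positive p>0 = All.map λ { (inj₁ refl) → z<s ; (inj₂ refl) → p>0 }

module Partitions (n : ℕ) where
  open Graph (P₀𝒯 n) using () renaming (Vertex to V)

  infix 4 _∼_
  _∼_ : Rel V _
  _∼_ = Setoid._≈_ (components (P₀𝒯 n))

  open Setoid (components (P₀𝒯 n)) using ()
    renaming (refl to ∼-refl; sym to ∼-sym; trans to ∼-trans) public

  partsOf : V → List ℕ
  partsOf (T , _) = parts T

  nontrivial : ∀ {m} (T : Partition n) → m ∈ parts T → m ≢ 1 → ¬ (parts T ↭ replicate n 1)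
  nontrivial T m∈ m≢1 T↭ = m≢1 (All.lookup (replicate-ones n) (∈-resp-↭ T↭ m∈))

  vertex : ∀ {m} xs → All (0 <_) xs → sum xs ≡ n → m ∈ xs → m ≢ 1 → V
  vertex xs pos sm m∈ m≢1 = T , nontrivial T m∈ m≢1
    where
    T : Partition n
    T = record { parts = xs ; positive = pos ; sum-parts = sm }

  non-one : ∀ (T : V) → ∃ λ m → m ∈ partsOf T × m ≢ 1
  non-one (T , T≉1) with Any.any? (λ m → ¬? (m ℕₚ.≟ 1)) (parts T)
  ... | yes a = find a
  ... | no ¬a = contradiction (↭-reflexive (trans (allOnes≡replicate ones) (cong (λ s → replicate s 1) (sum-parts T)))) T≉1
    where
    ones : AllOnes (parts T)
    ones = All.map (λ {m} ¬≢ → case m ℕₚ.≟ 1 of λ { (yes e) → e ; (no ne) → contradiction ne ¬≢ }) (Allₚ.¬Any⇒All¬ (parts T) ¬a)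

  ↭⇒∼ : ∀ {T U} → partsOf T ↭ partsOf U → T ∼ U
  ↭⇒∼ e = EqClosure.return (inj₁ e)

  pw⇒∼ : ∀ {T U} a .{{_ : NonZero a}} → partsOf T ↭ pw a (partsOf U) → T ∼ U
  pw⇒∼ {T} {U} a e with partsOf T ↭? partsOf U
  ... | yes e′ = ↭⇒∼ {T} {U} e′
  ... | no ¬e′ = EqClosure.return (inj₂ (¬e′ , inj₁ (a , >-nonZero⁻¹ a , e)))

  powerVertex : ∀ a .{{_ : NonZero a}} (T : V) {m} → m ∈ pw a (partsOf T) → m ≢ 1 → V
  powerVertex a (T , _) m∈ m≢1 = power a T , nontrivial (power a T) m∈ m≢1

  powerVertex-∼ : ∀ a .{{_ : NonZero a}} T {m} (m∈ : m ∈ pw a (partsOf T)) (m≢1 : m ≢ 1) → T ∼ powerVertex a T m∈ m≢1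
  powerVertex-∼ a T m∈ m≢1 = ∼-sym {powerVertex a T m∈ m≢1} {T} (pw⇒∼ {powerVertex a T m∈ m≢1} {T} a ↭-refl)

  record PrimeForm (T : V) : Set where
    field
      p       : ℕ
      isPrime : Prime p
      form    : V
      T∼form  : T ∼ form
      oneOr   : All (OneOr p) (partsOf form)
      p∈form  : p ∈ partsOf form

  -- Descend along an exponent N killing T: for N = p j, either j kills T too, or the j-th power has all parts 1 or p.
  primeForm : ∀ T → PrimeForm T
  primeForm T = <-rec (λ N → 0 < N → All (_∣ N) (partsOf T) → PrimeForm T) step
      (product (partsOf T)) (product>0 (positive (proj₁ T))) (All.tabulate ∈⇒∣product)
    where
    product>0 : All (0 <_) xs → 0 < product xs
    product>0 []               = z<s
    product>0 {x ∷ xs} (p ∷ ps) = ℕₚ.*-mono-≤ {1} {x} p (product>0 ps)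
    step : ∀ N → (∀ {j} → j < N → 0 < j → All (_∣ j) (partsOf T) → PrimeForm T) →
           0 < N → All (_∣ N) (partsOf T) → PrimeForm T
    step 1 _ _ all∣ = let m , m∈ , m≢1 = non-one T in contradiction (∣1⇒≡1 (All.lookup all∣ m∈)) m≢1
    step N@(2+ _) rec _ all∣ with primeDivisor N (s≤s (s≤s z≤n))
    ... | p , pp , divides j N≡ = by (All.all? (_∣? j) (partsOf T))
      where
      instance
        j≢0 : NonZero j
        j≢0 = ≢-nonZero λ { refl → case N≡ of λ () }
      j<N : j < N
      j<N = subst (j <_) (sym N≡) (ℕₚ.m<m*n j p (prime>1 pp))
      part-∣ : ∀ {m k} → m ∣ N → m ≡ gcd j m * k → k ∣ p
      -- With `g = gcd j m`, the quotient `m / g` divides `(j / g) * p` and is coprime to `j / g`.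
      part-∣ {m} {k} m∣N m≡ = subst (_∣ p) k≡ (coprime-divisor (Coprime-sym (coprime-/gcd j m)) (divides-after
          (m∣N′)))
        where
        g = gcd j m
        instance
          g≢0 : NonZero g
          g≢0 = ≢-nonZero (gcd[m,n]≢0 j m (inj₁ (≢-nonZero⁻¹ j)))
        k≡ : m / g ≡ k
        k≡ = trans (cong (_/ g) (trans m≡ (ℕₚ.*-comm g k))) (m*n/n≡m k g)
        m∣N′ : g * (m / g) ∣ g * ((j / g) * p)
        m∣N′ = subst (_∣ g * ((j / g) * p)) (sym (m*[n/m]≡n (gcd[m,n]∣n j m)))
                 (subst (m ∣_) (trans N≡ (trans (cong (_* p) (sym (m*[n/m]≡n (gcd[m,n]∣m j m)))) (ℕₚ.*-assoc g (j / g) p))) m∣N)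
        divides-after : g * (m / g) ∣ g * ((j / g) * p) → m / g ∣ (j / g) * p
        divides-after = *-cancelˡ-∣ g
      oneOr-p : ∀ {k} → k ∣ p → OneOr p k
      oneOr-p = prime⇒irreducible pp
      by : Dec (All (_∣ j) (partsOf T)) → PrimeForm T
      by (yes all∣j) = rec j<N (>-nonZero⁻¹ j) all∣j
      by (no ¬all∣j) with find (Allₚ.¬All⇒Any¬ (_∣? j) (partsOf T) ¬all∣j)
      ... | m , m∈ , m∤j = record
          { p = p ; isPrime = pp ; form = powerVertex j T p∈ p≢1 ; T∼form = powerVertex-∼ j T p∈ p≢1
          ; oneOr = All.tabulate each ; p∈form = p∈ }
        where
        each : ∀ {k} → k ∈ pw j (partsOf T) → OneOr p k
        each k∈ = let m , m∈ , m≡ = ∈-pw j {partsOf T} k∈ in oneOr-p (part-∣ (All.lookup all∣ m∈) m≡)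
        g = gcd j m
        instance
          g≢0 : NonZero g
          g≢0 = ≢-nonZero (gcd[m,n]≢0 j m (inj₁ (≢-nonZero⁻¹ j)))
        m≡g* : m ≡ g * (m / g)
        m≡g* = sym (m*[n/m]≡n (gcd[m,n]∣n j m))
        -- The quotient divides `p`; it is not 1, since `m` does not divide `j`.
        m/g≡p : m / g ≡ p
        m/g≡p = case oneOr-p (part-∣ (All.lookup all∣ m∈) m≡g*) of λ
          { (inj₁ e) → contradiction (subst (_∣ j) (sym (trans m≡g* (trans (cong (g *_) e) (ℕₚ.*-identityʳ g)))) (gcd[m,n]∣m j m)) m∤j
          ; (inj₂ e) → e }
        m/g∈ : m / g ∈ powerOfPart j m
        m/g∈ = subst (m / g ∈_) (sym (powerOfPart-/ j refl m≡g*)) (∈-replicate g)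
          where
          ∈-replicate : ∀ g .{{_ : NonZero g}} {x : ℕ} → x ∈ replicate g x
          ∈-replicate (suc g) = here refl
        p∈ : p ∈ pw j (partsOf T)
        p∈ = subst (_∈ pw j (partsOf T)) m/g≡p (∈-concatMap⁺ (powerOfPart j) (lose m∈ m/g∈))
        p≢1 : p ≢ 1
        p≢1 refl = ¬prime[1] pp

-- Partitions of n at least 8

module Chains {n : ℕ} (8≤n : 8 ≤ n) where
  open Partitions n
  open Graph (P₀𝒯 n) using () renaming (Vertex to V)

  sum-partsOf : ∀ (T : V) → sum (partsOf T) ≡ n
  sum-partsOf (T , _) = sum-parts T

  base : V
  base = vertex (2 ∷ replicate (n ∸ 2) 1) (z<s ∷ Allₚ.replicate⁺ (n ∸ 2) z<s)
      (trans (cong (2 +_) (sum-replicate-1 (n ∸ 2))) (ℕₚ.m+[n∸m]≡n (ℕₚ.≤-trans (ℕₚ.m≤n+m 2 6) 8≤n))) (here refl) λ ()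

  hub : ∀ {m} (T : V) a .{{_ : NonZero a}} xs → All (0 <_) xs → sum xs ≡ n → (m∈ : m ∈ xs) → m ≢ 1 →
        partsOf T ↭ pw a xs → ∃ λ R → T ∼ R × partsOf R ≡ xs
  hub T a xs pos sm m∈ m≢1 e = R , pw⇒∼ {T} {R} a e , refl
    where
    R : V
    R = vertex xs pos sm m∈ m≢1

  down : ∀ {m} (T : V) b .{{_ : NonZero b}} → (m∈ : m ∈ pw b (partsOf T)) → m ≢ 1 → ∃ λ U → T ∼ U × partsOf U ≡ pw b (partsOf T)
  down T b m∈ m≢1 = powerVertex b T m∈ m≢1 , powerVertex-∼ b T m∈ m≢1 , refl

  -- T = pw a R and U = pw b R, where R agrees with T up to the parts it merges.
  via : ∀ {m k} (T : V) a b .{{_ : NonZero a}} .{{_ : NonZero b}} xs {ts us} → All (0 <_) xs → sum xs ≡ sum ts →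
        m ∈ xs → m ≢ 1 → pw a xs ≡ ts → pw b xs ≡ us → k ∈ us → k ≢ 1 → partsOf T ↭ ts →
        ∃ λ U → T ∼ U × partsOf U ≡ us
  via T a b xs pos sm m∈ m≢1 refl refl k∈ k≢1 e =
    let R , T∼R , eR = hub T a xs pos (trans sm (trans (sym (sum-↭ e)) (sum-partsOf T))) m∈ m≢1 e
        U , R∼U , eU = down R b (subst (λ xs → _ ∈ pw b xs) (sym eR) k∈) k≢1
    in U , ∼-trans {T} {R} {U} T∼R R∼U , trans eU (cong (pw b) eR)

  ones-after : ∀ {x os} (T : V) → partsOf T ≡ x ∷ os → AllOnes os → os ≡ replicate (n ∸ x) 1
  ones-after {x} {os} T eq ones = trans (allOnes≡replicate ones) (cong (λ s → replicate s 1)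
    (trans (sym (ℕₚ.m+n∸m≡n x (sum os))) (cong (_∸ x) (trans (sym (cong sum eq)) (sum-partsOf T)))))

  3⊥ : ∀ {q} → Prime q → q ≢ 3 → Coprime 3 q
  3⊥ pq q≢3 = primes-coprime prime[3] pq (q≢3 ∘ sym)

  2⊥ : ∀ {q} → Prime q → q ≢ 2 → Coprime 2 q
  2⊥ pq q≢2 = primes-coprime prime[2] pq (q≢2 ∘ sym)

  -- Merge the two ones into a 2. The square of `2 ∷ xs` is `T`, because 2 is coprime to the parts
  -- of `xs`, and its `p`-th power is a 2 followed by ones.
  twoOnes⇒∼base : ∀ {p xs} T → Prime p → p ≢ 2 → All (OneOr p) xs → partsOf T ↭ 1 ∷ 1 ∷ xs → T ∼ base
  twoOnes⇒∼base {p} {xs} T pp p≢2 oneOr e =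
    let instance p≢0 = >-nonZero (prime>0 pp)
        ones = pw-divisors p (oneOr-divides oneOr)
        U , T∼U , eU = via T 2 p (2 ∷ xs) (z<s ∷ oneOr-positive (prime>0 pp) oneOr) refl (here refl) (λ ())
          (cong₂ _++_ (powerOfPart-divisor 2 ∣-refl) (pw-coprime 2 (oneOr-coprime (2⊥ pp p≢2) oneOr)))
          (cong (_++ pw p xs) (powerOfPart-coprime p (Coprime-sym (2⊥ pp p≢2))))
          (here refl) (λ ()) e
    in ∼-trans {T} {U} {base} T∼U (↭⇒∼ {U} {base} (↭-reflexive (trans eU (cong (2 ∷_) (ones-after U eU ones)))))

  -- The cube of `3 ∷ xs` is `T` and its square is a 3 followed by ones, at least two of them, so
  -- `twoOnes⇒∼base` with the prime 3 finishes.
  threeOnesTwos⇒∼base : ∀ {xs} T → All (OneOr 2) xs → partsOf T ↭ 1 ∷ 1 ∷ 1 ∷ xs → T ∼ base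
  threeOnesTwos⇒∼base {xs} T oneOr e =
    let ones = pw-divisors 2 (oneOr-divides oneOr)
        U , T∼U , eU = via T 3 2 (3 ∷ xs) (z<s ∷ oneOr-positive z<s oneOr) refl (here refl) (λ ())
          (cong₂ _++_ (powerOfPart-divisor 3 ∣-refl) (pw-coprime 3 (oneOr-coprime (3⊥ prime[2] λ ()) oneOr)))
          (cong (_++ pw 2 xs) (powerOfPart-coprime 2 (2⊥ prime[3] λ ())))
          (here refl) (λ ()) e
        eU′ = trans eU (cong (3 ∷_) (trans (ones-after U eU ones) (cong (λ k → replicate k 1) (sym (ℕₚ.m+[n∸m]≡n {2} {n ∸ 3} (ℕₚ.≤-trans (ℕₚ.m≤n+m 2 3) (ℕₚ.∸-monoˡ-≤ 3 8≤n)))))))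
    in ∼-trans {T} {U} {base} T∼U (twoOnes⇒∼base U prime[3] (λ ())
         (inj₂ refl ∷ Allₚ.replicate⁺ (n ∸ 3 ∸ 2) (inj₁ refl))
         (↭-trans (↭-reflexive eU′) (↭-sym (↭-shift 3 (1 ∷ 1 ∷ []) (replicate (n ∸ 3 ∸ 2) 1)))))

  -- Three twos merge into a 6: the cube of `6 ∷ xs` is `T` and its square is 3, 3 and ones. Here
  -- `8 ≤ n` ensures two ones for `twoOnes⇒∼base`.
  threeTwos⇒∼base : ∀ {xs} T → All (OneOr 2) xs → partsOf T ↭ 2 ∷ 2 ∷ 2 ∷ xs → T ∼ base
  threeTwos⇒∼base {xs} T oneOr e =
    let ones = pw-divisors 2 (oneOr-divides oneOr)
        U , T∼U , eU = via T 3 2 (6 ∷ xs) (z<s ∷ oneOr-positive z<s oneOr) refl (here refl) (λ ())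
          (cong₂ _++_ (powerOfPart-multiple 3 2) (pw-coprime 3 (oneOr-coprime (3⊥ prime[2] λ ()) oneOr)))
          (cong (_++ pw 2 xs) (powerOfPart-multiple 2 3))
          (here refl) (λ ()) e
        6+ones : 3 + (3 + sum (pw 2 xs)) ≡ n
        6+ones = trans (sym (cong sum eU)) (sum-partsOf U)
        s≥2 : 2 ≤ sum (pw 2 xs)
        s≥2 = ℕₚ.+-cancelˡ-≤ 6 2 _ (subst (8 ≤_) (sym 6+ones) 8≤n)
        eU′ = trans eU (cong (λ os → 3 ∷ 3 ∷ os) (trans (allOnes≡replicate ones)
                (cong (λ k → replicate k 1) (sym (ℕₚ.m+[n∸m]≡n s≥2)))))
        k = sum (pw 2 xs) ∸ 2
    in ∼-trans {T} {U} {base} T∼U (twoOnes⇒∼base U prime[3] (λ ())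
         (inj₂ refl ∷ inj₂ refl ∷ Allₚ.replicate⁺ k (inj₁ refl))
         (↭-trans (↭-reflexive eU′) (↭-shifts (3 ∷ 3 ∷ []) (1 ∷ 1 ∷ []) {replicate k 1})))

  -- Two parts `p` merge into `2 * p`: the square gives `T`, and the `p`-th power gives `p` twos and
  -- ones. As `p` is at least 3, `threeTwos⇒∼base` applies.
  twoEqual⇒∼base : ∀ {p xs} T → Prime p → p ≢ 2 → All (OneOr p) xs → partsOf T ↭ p ∷ p ∷ xs → T ∼ base
  twoEqual⇒∼base {0} T pp _ _ _ = contradiction pp ¬prime[0]
  twoEqual⇒∼base {1} T pp _ _ _ = contradiction pp ¬prime[1]
  twoEqual⇒∼base {2} T _ p≢2 _ _ = contradiction refl p≢2
  twoEqual⇒∼base {p@(suc (suc (suc q)))} {xs} T pp p≢2 oneOr e =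
    let ones = pw-divisors p (oneOr-divides oneOr)
        U , T∼U , eU = via T 2 p (2 * p ∷ xs) (z<s ∷ oneOr-positive z<s oneOr)
          (trans (cong (λ k → p + k + sum xs) (ℕₚ.+-identityʳ p)) (ℕₚ.+-assoc p p (sum xs))) (here refl)
          (λ 2p≡1 → case trans (sym (ℕₚ.+-suc (2+ q) (2+ q + 0))) (ℕₚ.suc-injective 2p≡1) of λ ())
          (cong₂ _++_ (powerOfPart-multiple 2 p) (pw-coprime 2 (oneOr-coprime (2⊥ pp p≢2) oneOr)))
          (cong (_++ pw p xs) (trans (cong (powerOfPart p) (ℕₚ.*-comm 2 p)) (powerOfPart-multiple p 2)))
          (here refl) (λ ()) e
    in ∼-trans {T} {U} {base} T∼U (threeTwos⇒∼base U
         (Allₚ.++⁺ (Allₚ.replicate⁺ q (inj₂ refl)) (All.map inj₁ ones)) (↭-reflexive eU))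

  IsNear : ℕ → V → Set
  IsNear p T = p ≢ 2 × Near n p × p ∈ partsOf T

  -- `T` consists of `t` parts `p` and `r` ones. For `p` = 2, the cases with `t` and `r` at most 2
  -- have sum at most 6 and contradict `8 ≤ n`. For odd `p`, the only case that no merging covers is
  -- `t` = 1 with `r` at most 1, where `p` is near `n`.
  primeForm⇒∼base : ∀ {p} T → Prime p → All (OneOr p) (partsOf T) → p ∈ partsOf T → T ∼ base ⊎ IsNear p T
  primeForm⇒∼base {p} T pp oneOr p∈ = let t , r , e = oneOr⇒replicate oneOr in by (p ℕₚ.≟ 2) t r e
    where
    ps-ones : ∀ t r → All (OneOr p) (replicate t p ++ replicate r 1)
    ps-ones t r = Allₚ.++⁺ (Allₚ.replicate⁺ t (inj₂ refl)) (Allₚ.replicate⁺ r (inj₁ refl))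
    total : ∀ {xs} → partsOf T ↭ xs → sum xs ≡ n
    total e = trans (sym (sum-↭ e)) (sum-partsOf T)
    by : Dec (p ≡ 2) → ∀ t r → partsOf T ↭ replicate t p ++ replicate r 1 → T ∼ base ⊎ IsNear p T
    by (yes refl) (suc (suc (suc t))) r e = inj₁ (threeTwos⇒∼base T (ps-ones t r) e)
    by (yes refl) t (suc (suc (suc r))) e = inj₁ (threeOnesTwos⇒∼base T (ps-ones t r)
      (↭-trans e (↭-shifts (replicate t 2) (1 ∷ 1 ∷ 1 ∷ []) {replicate r 1})))
    by (yes refl) 0 0 e = contradiction (subst (8 ≤_) (sym (total e)) 8≤n) λ ()
    by (yes refl) 0 1 e = contradiction (subst (8 ≤_) (sym (total e)) 8≤n) λ { (s≤s ()) }
    by (yes refl) 0 2 e = contradiction (subst (8 ≤_) (sym (total e)) 8≤n) λ { (s≤s (s≤s ())) }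
    by (yes refl) 1 0 e = contradiction (subst (8 ≤_) (sym (total e)) 8≤n) λ { (s≤s (s≤s ())) }
    by (yes refl) 1 1 e = contradiction (subst (8 ≤_) (sym (total e)) 8≤n) λ { (s≤s (s≤s (s≤s ()))) }
    by (yes refl) 1 2 e = contradiction (subst (8 ≤_) (sym (total e)) 8≤n) λ { (s≤s (s≤s (s≤s (s≤s ())))) }
    by (yes refl) 2 0 e = contradiction (subst (8 ≤_) (sym (total e)) 8≤n) λ { (s≤s (s≤s (s≤s (s≤s ())))) }
    by (yes refl) 2 1 e = contradiction (subst (8 ≤_) (sym (total e)) 8≤n) λ { (s≤s (s≤s (s≤s (s≤s (s≤s ()))))) }
    by (yes refl) 2 2 e = contradiction (subst (8 ≤_) (sym (total e)) 8≤n) λ { (s≤s (s≤s (s≤s (s≤s (s≤s (s≤s ())))))) }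
    by (no p≢2) t (suc (suc r)) e = inj₁ (twoOnes⇒∼base T pp p≢2 (ps-ones t r)
      (↭-trans e (↭-shifts (replicate t p) (1 ∷ 1 ∷ []) {replicate r 1})))
    by (no p≢2) (suc (suc t)) r e = inj₁ (twoEqual⇒∼base T pp p≢2 (ps-ones t r) e)
    by (no p≢2) 0 0 e = contradiction (subst (8 ≤_) (sym (total e)) 8≤n) λ ()
    by (no p≢2) 0 1 e = contradiction (subst (8 ≤_) (sym (total e)) 8≤n) λ { (s≤s ()) }
    by (no p≢2) 1 0 e = inj₂ (p≢2 , inj₁ (trans (sym (total e)) (ℕₚ.+-identityʳ p)) , p∈)
    by (no p≢2) 1 1 e = inj₂ (p≢2 , inj₂ (trans (sym (total e)) (ℕₚ.+-comm p 1)) , p∈)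

  base-or-near : ∀ T → T ∼ base ⊎ ∃₂ λ p U → Prime p × T ∼ U × IsNear p U
  base-or-near T = case primeForm⇒∼base F.form F.isPrime F.oneOr F.p∈form of λ
      { (inj₁ ∼b)   → inj₁ (∼-trans {T} {F.form} {base} F.T∼form ∼b)
      ; (inj₂ near) → inj₂ (F.p , F.form , F.isPrime , F.T∼form , near) }
    where module F = PrimeForm (primeForm T)

  P₀𝒯-connected : (∀ q → Prime q → ¬ Near n q) → P₀𝒯 n HasComponents 1
  P₀𝒯-connected none = hasComponents-by {G = P₀𝒯 n} {L = Fin 1} (↔-id _)
    (λ _ → zero) (λ _ → refl) (λ _ → refl) (λ _ → base) (λ { zero → refl })
    λ T → case base-or-near T of λ
      { (inj₁ ∼b) → ∼b
      ; (inj₂ (p , _ , pp , _ , _ , np , _)) → contradiction np (none p pp) }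

  module _ {p : ℕ} (pp : Prime p) (p≢2 : p ≢ 2) (np : Near n p) where
    private
      p>1 : 1 < p
      p>1 = prime>1 pp

      instance
        p≢0 : NonZero p
        p≢0 = >-nonZero (prime>0 pp)

    part≤n : ∀ (T : V) {m} → m ∈ partsOf T → m ≤ n
    part≤n T m∈ = subst (_ ≤_) (sum-partsOf T) (≤-sum m∈)

    -- A part p leaves at most one further part, a 1.
    rest : ∀ (T : V) → p ∈ partsOf T → partsOf T ↭ p ∷ replicate (n ∸ p) 1
    rest T p∈ = let os , e = extract p∈ in ↭-trans e (↭-prep p (↭-reflexive (ones os e)))
      where
      ones : ∀ os → partsOf T ↭ p ∷ os → os ≡ replicate (n ∸ p) 1
      ones os e = trans (allOnes≡replicate (All.tabulate small)) (cong (λ s → replicate s 1)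
          (trans (sym (ℕₚ.m+n∸m≡n p (sum os))) (cong (_∸ p) total)))
        where
        total : p + sum os ≡ n
        total = trans (sym (sum-↭ e)) (sum-partsOf T)
        small : ∀ {m} → m ∈ os → m ≡ 1
        small {m} m∈ = ℕₚ.≤-antisym
          (ℕₚ.+-cancelˡ-≤ p m 1 (ℕₚ.≤-trans (ℕₚ.+-monoʳ-≤ p (≤-sum m∈))
            (ℕₚ.≤-trans (ℕₚ.≤-reflexive total) (ℕₚ.≤-trans (near⇒≤ np) (ℕₚ.≤-reflexive (ℕₚ.+-comm 1 p))))))
          (All.lookup (All-resp-↭ e (positive (proj₁ T))) (there m∈))

    -- A part `p` of the power stems from a part `g * p` of `U`. This is at most `n`, hence at most
    -- `suc p` and below `2 * p`, so `g` is 1.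
    pw-up : ∀ {T U : V} a .{{_ : NonZero a}} → partsOf T ↭ pw a (partsOf U) → p ∈ partsOf T → p ∈ partsOf U
    pw-up {T} {U} a e p∈ = let m , m∈ , m≡ = ∈-pw a {partsOf U} (∈-resp-↭ e p∈) in subst (_∈ partsOf U) (m≡p m m∈ (gcd a m) m≡) m∈
      where
      m≡p : ∀ m → m ∈ partsOf U → ∀ g → m ≡ g * p → m ≡ p
      m≡p m m∈ 0 eq = contradiction (All.lookup (positive (proj₁ U)) m∈) (subst (λ m → ¬ 0 < m) (sym eq) (ℕₚ.<-irrefl refl))
      m≡p m m∈ 1 eq = trans eq (ℕₚ.*-identityˡ p)
      m≡p m m∈ (suc (suc g)) refl = contradiction (ℕₚ.≤-trans (part≤n U m∈) (near⇒≤ np))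
        (ℕₚ.<⇒≱ (ℕₚ.<-≤-trans (subst (_< p + p) (ℕₚ.+-comm p 1) (ℕₚ.+-monoʳ-< p p>1)) (ℕₚ.+-monoʳ-≤ p (ℕₚ.m≤m+n p (g * p)))))

    -- By `rest`, `U` is `p` followed by ones. A part of `T` other than 1 divides a part of `U`,
    -- which must be `p`, and so equals `p`.
    pw-down : ∀ {T U : V} a .{{_ : NonZero a}} → partsOf T ↭ pw a (partsOf U) → p ∈ partsOf U → p ∈ partsOf T
    pw-down {T} {U} a e p∈ =
      let k , k∈ , k≢1 = non-one T
          m , m∈ , m≡ = ∈-pw a {partsOf U} (∈-resp-↭ e k∈)
      in subst (_∈ partsOf T) (k≡p k m (gcd a m) k≢1 m≡ (∈-resp-↭ (rest U p∈) m∈)) k∈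
      where
      k≡p : ∀ k m g → k ≢ 1 → m ≡ g * k → m ∈ p ∷ replicate (n ∸ p) 1 → k ≡ p
      k≡p k m g k≢1 m≡ (here refl) = case prime⇒irreducible pp (divides g m≡) of λ
        { (inj₁ k≡1) → contradiction k≡1 k≢1 ; (inj₂ k≡p) → k≡p }
      k≡p k m g k≢1 m≡ (there m∈) = contradiction
        (ℕₚ.m*n≡1⇒n≡1 g k (trans (sym m≡) (All.lookup (replicate-ones (n ∸ p)) m∈))) k≢1

    private
      nearVertex : V
      nearVertex = vertex (p ∷ replicate (n ∸ p) 1) (prime>0 pp ∷ Allₚ.replicate⁺ (n ∸ p) z<s)
          (trans (cong (p +_) (sum-replicate-1 (n ∸ p))) (ℕₚ.m+[n∸m]≡n (near⇒≥ np))) (here refl) λ { refl → ¬prime[1] pp }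

      has-p? : ∀ (T : V) → Dec (p ∈ partsOf T)
      has-p? T = Any.any? (p ℕₚ.≟_) (partsOf T)

      label : V → Fin 2
      label T = mark (has-p? T)

      label-≈ : ∀ {T U} → partsOf T ↭ partsOf U → label T ≡ label U
      label-≈ {T} {U} e = mark-⇔ (∈-resp-↭ e) (∈-resp-↭ (↭-sym e)) (has-p? T) (has-p? U)

      label-power : ∀ {T U : V} → _IsPowerOf_ n (proj₁ T) (proj₁ U) → label T ≡ label U
      label-power {T} {U} (a , a>0 , e) = mark-⇔ (pw-up {T} {U} a {{>-nonZero a>0}} e) (pw-down {T} {U} a {{>-nonZero a>0}} e) (has-p? T) (has-p? U)

      label-∼ : ∀ {T U} → T ∼ U → label T ≡ label U
      label-∼ = EqClosure.gfold ≡ₚ.isEquivalence label λ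
        { {T} {U} (inj₁ e)            → label-≈ {T} {U} e
        ; {T} {U} (inj₂ (_ , inj₁ r)) → label-power {T} {U} r
        ; {T} {U} (inj₂ (_ , inj₂ r)) → sym (label-power {U} {T} r) }

      rep : Fin 2 → V
      rep zero    = base
      rep (suc _) = nearVertex

      base-lacks-p : ¬ p ∈ partsOf base
      base-lacks-p (here p≡2) = p≢2 p≡2
      base-lacks-p (there p∈) = ¬prime[1] (subst Prime (All.lookup (replicate-ones (n ∸ 2)) p∈) pp)

      mark-rep : ∀ l (d : Dec (p ∈ partsOf (rep l))) → mark d ≡ l
      mark-rep zero       (yes p∈) = contradiction p∈ base-lacks-p
      mark-rep zero       (no _)   = refl
      mark-rep (suc zero) (yes _)  = refl
      mark-rep (suc zero) (no ¬p∈) = contradiction (here refl) ¬p∈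

      marked : ∀ {A : Set} {d : Dec A} → A → mark d ≡ suc zero
      marked {d = yes _} _ = refl
      marked {d = no ¬a} a = contradiction a ¬a

      connect : ∀ T (d : Dec (p ∈ partsOf T)) → T ∼ rep (mark d)
      connect T (yes p∈) = ↭⇒∼ {T} {nearVertex} (rest T p∈)
      connect T (no ¬p∈) = case base-or-near T of λ
        { (inj₁ ∼b) → ∼b
        ; (inj₂ (q , U , pq , T∼U , q≢2 , nq , q∈)) → contradiction
            (has-p (trans (label-∼ {T} {U} T∼U) (marked {d = has-p? U} (subst (_∈ partsOf U) (near-odd-unique pq q≢2 nq pp p≢2 np) q∈)))) ¬p∈ }
        where
        has-p : label T ≡ suc zero → p ∈ partsOf T
        has-p eq with has-p? T
        ... | yes p∈ = p∈

    P₀𝒯-two-components : P₀𝒯 n HasComponents 2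
    P₀𝒯-two-components = hasComponents-by {G = P₀𝒯 n} {L = Fin 2} (↔-id _)
      label (λ {T} {U} e → label-≈ {T} {U} e)
      (λ { {T} {U} (_ , inj₁ r) → label-power {T} {U} r ; {T} {U} (_ , inj₂ r) → sym (label-power {U} {T} r) })
      rep (λ l → mark-rep l (has-p? (rep l))) (λ T → connect T (has-p? T))

-- Partitions of n at most 7

bump : List ℕ → List (List ℕ)
bump []       = []
bump (x ∷ xs) = (suc x ∷ xs) ∷ []

-- A composition of `suc n` begins with 1, which can be removed, or with a larger part, which can be
-- lowered by 1. Listing ordered partitions makes every list of positive parts occur literally.
compositions : ℕ → List (List ℕ)
compositions zero    = [] ∷ []
compositions (suc n) = concatMap (λ xs → (1 ∷ xs) ∷ bump xs) (compositions n)

∈-compositions : ∀ n {xs} → All (0 <_) xs → sum xs ≡ n → xs ∈ compositions n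
∈-compositions zero    {[]}               _              _  = here refl
∈-compositions zero    {zero ∷ _}         (() ∷ _)       _
∈-compositions zero    {suc _ ∷ _}        _              ()
∈-compositions (suc n) {[]}               _              ()
∈-compositions (suc n) {zero ∷ xs}        (() ∷ _)       _
∈-compositions (suc n) {1 ∷ xs}           (_ ∷ pos)      eq =
  ∈-concatMap⁺ _ (lose (∈-compositions n pos (ℕₚ.suc-injective eq)) (here refl))
∈-compositions (suc n) {suc (suc x) ∷ xs} (_ ∷ pos)      eq =
  ∈-concatMap⁺ _ (lose (∈-compositions n {suc x ∷ xs} (z<s ∷ pos) (ℕₚ.suc-injective eq)) (there (here refl)))

-- `E` is a common multiple of the parts that occur, which makes the exponents to be tested finite
-- in number: its divisors.
module SmallPartitions (n E : ℕ) .{{_ : NonZero E}} (balls : List (List (List ℕ))) where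
  open Partitions n
  open Graph (P₀𝒯 n) using () renaming (Vertex to V)

  private
    ball : Fin (length balls) → List (List ℕ)
    ball = List.lookup balls

  -- The largest order of a permutation of at most 7 points is 12, so the exponents from 1 to 12
  -- yield every power of these cycle types.
  Link : List ℕ → List ℕ → Set
  Link xs ys = Any (λ k → pw (suc k) xs ↭ ys ⊎ xs ↭ pw (suc k) ys) (upTo 12)

  link? : ∀ xs ys → Dec (Link xs ys)
  link? xs ys = Any.any? (λ k → (pw (suc k) xs ↭? ys) ⊎-dec (xs ↭? pw (suc k) ys)) (upTo 12)

  Valid : List ℕ → Set
  Valid xs = All (0 <_) xs × sum xs ≡ n × Any (_≢ 1) xs

  valid? : ∀ xs → Dec (Valid xs)
  valid? xs = All.all? (0 ℕₚ.<?_) xs ×-dec (sum xs ℕₚ.≟ n) ×-dec Any.any? (λ m → ¬? (m ℕₚ.≟ 1)) xs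

  toVertex : ∀ {xs} → Valid xs → V
  toVertex {xs} (pos , sm , a) = let m , m∈ , m≢1 = find a in vertex xs pos sm m∈ m≢1

  -- Each list is linked to a later one; the centre comes last.
  IsBall : List (List ℕ) → Set
  IsBall []         = ⊥
  IsBall (x ∷ [])   = Valid x
  IsBall (x ∷ xss)  = Valid x × Any (Link x) xss × IsBall xss

  isBall? : ∀ xss → Dec (IsBall xss)
  isBall? []                = no λ ()
  isBall? (x ∷ [])          = valid? x
  isBall? (x ∷ xss@(_ ∷ _)) = valid? x ×-dec Any.any? (link? x) xss ×-dec isBall? xss

  centre : ∀ xss → IsBall xss → V
  centre (x ∷ [])     val         = toVertex val
  centre (_ ∷ y ∷ ys) (_ , _ , b) = centre (y ∷ ys) b

  centre-∈ : ∀ xss b → Any (partsOf (centre xss b) ↭_) xss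
  centre-∈ (x ∷ [])     val         = here ↭-refl
  centre-∈ (_ ∷ y ∷ ys) (_ , _ , b) = there (centre-∈ (y ∷ ys) b)

  link⇒∼ : ∀ T U → Link (partsOf T) (partsOf U) → T ∼ U
  link⇒∼ T U l = case Any.satisfied l of λ
    { (k , inj₁ e) → ∼-sym {U} {T} (pw⇒∼ {U} {T} (suc k) (↭-sym e))
    ; (k , inj₂ e) → pw⇒∼ {T} {U} (suc k) e }

  inBall⇒∼ : ∀ xss (b : IsBall xss) T → Any (partsOf T ↭_) xss → T ∼ centre xss b
  linked⇒∼ : ∀ xss (b : IsBall xss) T → Any (Link (partsOf T)) xss → T ∼ centre xss b

  inBall⇒∼ (x ∷ [])     val           T (here e)  = ↭⇒∼ {T} {toVertex val} e
  inBall⇒∼ (x ∷ y ∷ ys) (val , l , b) T (here e)  = ∼-trans {T} {toVertex val} {centre (y ∷ ys) b}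
    (↭⇒∼ {T} {toVertex val} e) (linked⇒∼ (y ∷ ys) b (toVertex val) l)
  inBall⇒∼ (x ∷ y ∷ ys) (_ , _ , b)   T (there a) = inBall⇒∼ (y ∷ ys) b T a

  linked⇒∼ (x ∷ [])     val           T (here l)  = link⇒∼ T (toVertex val) l
  linked⇒∼ (x ∷ y ∷ ys) (val , l′ , b) T (here l) = ∼-trans {T} {toVertex val} {centre (y ∷ ys) b}
    (link⇒∼ T (toVertex val) l) (linked⇒∼ (y ∷ ys) b (toVertex val) l′)
  linked⇒∼ (x ∷ y ∷ ys) (_ , _ , b)   T (there a) = linked⇒∼ (y ∷ ys) b T a

  -- With `pw-gcd`, the divisors of `E` stand for all exponents, so this test shows that non-trivial
  -- powers remain in the ball.
  PowersStay : List (List ℕ) → List ℕ → Set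
  PowersStay xss xs = All (_∣ E) xs ×
    All (λ k → suc k ∣ E → AllOnes (pw (suc k) xs) ⊎ Any (pw (suc k) xs ↭_) xss) (upTo E)

  powersStay? : ∀ xss xs → Dec (PowersStay xss xs)
  powersStay? xss xs = All.all? (_∣? E) xs ×-dec
    All.all? (λ k → (suc k ∣? E) →-dec (All.all? (ℕₚ._≟ 1) (pw (suc k) xs) ⊎-dec Any.any? (pw (suc k) xs ↭?_) xss)) (upTo E)

  record Complete : Set where
    constructor complete
    field
      isBall   : ∀ i → IsBall (ball i)
      disjoint : ∀ i j → Any (λ xs → Any (xs ↭_) (ball j)) (ball i) → i ≡ j
      stay     : ∀ i → All (PowersStay (ball i)) (ball i)
      cover    : All (λ xs → AllOnes xs ⊎ ∃ λ i → Any (xs ↭_) (ball i)) (compositions n)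

  complete? : Dec Complete
  complete? = map′ (λ (a , b , c , d) → complete a b c d) (λ (complete a b c d) → a , b , c , d)
    ( (Finₚ.all? λ i → isBall? (ball i))
      ×-dec (Finₚ.all? λ i → Finₚ.all? λ j → Any.any? (λ xs → Any.any? (xs ↭?_) (ball j)) (ball i) →-dec (i Finₚ.≟ j))
      ×-dec (Finₚ.all? λ i → All.all? (powersStay? (ball i)) (ball i))
      ×-dec All.all? (λ xs → All.all? (ℕₚ._≟ 1) xs ⊎-dec Finₚ.any? λ i → Any.any? (xs ↭?_) (ball i)) (compositions n) )

  -- The power of a part `m` depends on `gcd a m` alone, and for `m ∣ E` this is unchanged when `a`
  -- is replaced by `gcd a E`.
  pw-gcd : ∀ a .{{_ : NonZero a}} g .{{_ : NonZero g}} → g ≡ gcd a E → ∀ {xs} → All (_∣ E) xs → pw a xs ≡ pw g xs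
  pw-gcd a g g≡ []               = refl
  pw-gcd a g g≡ {m ∷ _} (m∣E ∷ ds) = cong₂ _++_
      (trans (powerOfPart-/ a refl m≡) (sym (powerOfPart-/ g same m≡))) (pw-gcd a g g≡ ds)
    where
    m≡ : m ≡ gcd a m * quotient (gcd[m,n]∣n a m)
    m≡ = trans (_∣_.equality (gcd[m,n]∣n a m)) (ℕₚ.*-comm (quotient (gcd[m,n]∣n a m)) (gcd a m))
    g∣a : g ∣ a
    g∣a = subst (_∣ a) (sym g≡) (gcd[m,n]∣m a E)
    same : gcd g m ≡ gcd a m
    same = ∣-antisym (gcd-greatest (∣-trans (gcd[m,n]∣m g m) g∣a) (gcd[m,n]∣n g m))
      (gcd-greatest (subst (gcd a m ∣_) (sym g≡) (gcd-greatest (gcd[m,n]∣m a m) (∣-trans (gcd[m,n]∣n a m) m∣E))) (gcd[m,n]∣n a m))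

  module _ (C : Complete) where
    open Complete C

    InBall : V → Fin (length balls) → Set
    InBall T i = Any (partsOf T ↭_) (ball i)

    inBall-unique : ∀ {i j} T → InBall T i → InBall T j → i ≡ j
    inBall-unique {i} {j} T a b = disjoint i j (Any.map (λ e → Any.map (↭-trans (↭-sym e)) b) a)

    covered : ∀ T → ∃ (InBall T)
    covered T = case All.lookup cover (∈-compositions n (positive (proj₁ T)) (sum-parts (proj₁ T))) of λ
      { (inj₁ ones) → let m , m∈ , m≢1 = non-one T in contradiction (All.lookup ones m∈) m≢1
      ; (inj₂ i)    → i }

    power-inBall : ∀ {T U i} a .{{_ : NonZero a}} → partsOf T ↭ pw a (partsOf U) → InBall U i → InBall T i
    power-inBall {T} {U} {i} a e inU = let xs , xs∈ , U↭xs = find inU in by xs U↭xs (All.lookup (stay i) xs∈)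
      where
      by : ∀ xs → partsOf U ↭ xs → PowersStay (ball i) xs → InBall T i
      by xs U↭xs (divs , pows) = via (gcd a E) refl (gcd[m,n]∣n a E)
        where
        via : ∀ g → g ≡ gcd a E → g ∣ E → InBall T i
        via zero    _  0∣E = contradiction (0∣⇒≡0 0∣E) (≢-nonZero⁻¹ E)
        via (suc k) g≡ g∣E = case All.lookup pows (∈-upTo⁺ (∣⇒≤ g∣E)) g∣E of λ
            { (inj₁ ones) → let m , m∈ , m≢1 = non-one T in contradiction (All.lookup ones (∈-resp-↭ T↭ m∈)) m≢1
            ; (inj₂ l)    → Any.map (↭-trans T↭) l }
          where
          T↭ : partsOf T ↭ pw (suc k) xs
          T↭ = ↭-trans e (↭-trans (pw-↭ a U↭xs) (↭-reflexive (pw-gcd a (suc k) g≡ divs)))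

    private
      label : V → Fin (length balls)
      label T = proj₁ (covered T)

      label-power : ∀ {T U : V} → _IsPowerOf_ n (proj₁ T) (proj₁ U) → label T ≡ label U
      label-power {T} {U} (a , a>0 , e) = inBall-unique T (proj₂ (covered T))
        (power-inBall {T} {U} a {{>-nonZero a>0}} e (proj₂ (covered U)))

    P₀𝒯-balls : P₀𝒯 n HasComponents (length balls)
    P₀𝒯-balls = hasComponents-by {G = P₀𝒯 n} (↔-id _) label
      (λ {T} {U} e → inBall-unique T (proj₂ (covered T)) (Any.map (↭-trans e) (proj₂ (covered U))))
      (λ { {T} {U} (_ , inj₁ r) → label-power {T} {U} r ; {T} {U} (_ , inj₂ r) → sym (label-power {U} {T} r) })
      (λ i → centre (ball i) (isBall i))
      (λ i → let R = centre (ball i) (isBall i) in inBall-unique R (proj₂ (covered R)) (centre-∈ (ball i) (isBall i)))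
      (λ T → inBall⇒∼ (ball (label T)) (isBall (label T)) T (proj₂ (covered T)))

-- The components themselves, in an order in which each type is linked to a later one; for instance
-- 5,1,1 and 2,1,1,1,1,1 are the square and the fifth power of 5,2.
balls𝒯 : ℕ → List (List (List ℕ))
balls𝒯 2 = ((2 ∷ []) ∷ []) ∷ []
balls𝒯 3 = ((3 ∷ []) ∷ []) ∷ ((2 ∷ 1 ∷ []) ∷ []) ∷ []
balls𝒯 4 = ((3 ∷ 1 ∷ []) ∷ [])
         ∷ ((4 ∷ []) ∷ (2 ∷ 2 ∷ []) ∷ [])
         ∷ ((2 ∷ 1 ∷ 1 ∷ []) ∷ []) ∷ []
balls𝒯 5 = ((5 ∷ []) ∷ [])
         ∷ ((4 ∷ 1 ∷ []) ∷ (2 ∷ 2 ∷ 1 ∷ []) ∷ [])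
         ∷ ((3 ∷ 1 ∷ 1 ∷ []) ∷ (3 ∷ 2 ∷ []) ∷ (2 ∷ 1 ∷ 1 ∷ 1 ∷ []) ∷ []) ∷ []
balls𝒯 6 = ((5 ∷ 1 ∷ []) ∷ [])
         ∷ ((4 ∷ 2 ∷ []) ∷ (4 ∷ 1 ∷ 1 ∷ []) ∷ (2 ∷ 2 ∷ 1 ∷ 1 ∷ []) ∷ [])
         ∷ ((3 ∷ 3 ∷ []) ∷ (6 ∷ []) ∷ (2 ∷ 2 ∷ 2 ∷ []) ∷ [])
         ∷ ((3 ∷ 1 ∷ 1 ∷ 1 ∷ []) ∷ (3 ∷ 2 ∷ 1 ∷ []) ∷ (2 ∷ 1 ∷ 1 ∷ 1 ∷ 1 ∷ []) ∷ []) ∷ []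
balls𝒯 7 = ((7 ∷ []) ∷ [])
         ∷ ((3 ∷ 3 ∷ 1 ∷ []) ∷ (6 ∷ 1 ∷ []) ∷ (2 ∷ 2 ∷ 2 ∷ 1 ∷ []) ∷ [])
         ∷ ( (4 ∷ 1 ∷ 1 ∷ 1 ∷ []) ∷ (4 ∷ 2 ∷ 1 ∷ []) ∷ (2 ∷ 2 ∷ 1 ∷ 1 ∷ 1 ∷ []) ∷ (3 ∷ 2 ∷ 2 ∷ []) ∷ (4 ∷ 3 ∷ [])
           ∷ (3 ∷ 1 ∷ 1 ∷ 1 ∷ 1 ∷ []) ∷ (3 ∷ 2 ∷ 1 ∷ 1 ∷ []) ∷ (5 ∷ 1 ∷ 1 ∷ []) ∷ (5 ∷ 2 ∷ [])
           ∷ (2 ∷ 1 ∷ 1 ∷ 1 ∷ 1 ∷ 1 ∷ []) ∷ []) ∷ []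
balls𝒯 _ = []

abstract
  -- Here and in the next five degrees, `E` is the least common multiple of the numbers from 1 to
  -- `n`.
  P₀𝒯-2 : P₀𝒯 2 HasComponents 1
  P₀𝒯-2 = SmallPartitions.P₀𝒯-balls 2 2 (balls𝒯 2) (toWitness {a? = SmallPartitions.complete? 2 2 (balls𝒯 2)} _)

  P₀𝒯-3 : P₀𝒯 3 HasComponents 2
  P₀𝒯-3 = SmallPartitions.P₀𝒯-balls 3 6 (balls𝒯 3) (toWitness {a? = SmallPartitions.complete? 3 6 (balls𝒯 3)} _)

  P₀𝒯-4 : P₀𝒯 4 HasComponents 3
  P₀𝒯-4 = SmallPartitions.P₀𝒯-balls 4 12 (balls𝒯 4) (toWitness {a? = SmallPartitions.complete? 4 12 (balls𝒯 4)} _)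

  P₀𝒯-5 : P₀𝒯 5 HasComponents 3
  P₀𝒯-5 = SmallPartitions.P₀𝒯-balls 5 60 (balls𝒯 5) (toWitness {a? = SmallPartitions.complete? 5 60 (balls𝒯 5)} _)

  P₀𝒯-6 : P₀𝒯 6 HasComponents 4
  P₀𝒯-6 = SmallPartitions.P₀𝒯-balls 6 60 (balls𝒯 6) (toWitness {a? = SmallPartitions.complete? 6 60 (balls𝒯 6)} _)

  P₀𝒯-7 : P₀𝒯 7 HasComponents 3
  P₀𝒯-7 = SmallPartitions.P₀𝒯-balls 7 420 (balls𝒯 7) (toWitness {a? = SmallPartitions.complete? 7 420 (balls𝒯 7)} _)

-- Collecting the cases

notPrime⇒notNear : ∀ {n} → ¬ Prime n → ¬ Prime (n ∸ 1) → ∀ q → Prime q → ¬ Near n q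
notPrime⇒notNear ¬pn ¬pn-1 q pq (inj₁ refl) = ¬pn pq
notPrime⇒notNear ¬pn ¬pn-1 q pq (inj₂ refl) = ¬pn-1 pq

P₀-trivial : ∀ {n} → (∀ x → Permutations._≈_ n x (Permutations.ε n)) → P₀ (Sym n) HasComponents 0
P₀-trivial {n} trivial = labelling⇒hasComponents {L = Fin 0} (record
  { label       = λ x x≉ε _ → contradiction (trivial x) x≉ε
  ; label-power = λ {x} _ _ x≉ε → contradiction (trivial x) x≉ε
  ; rep         = λ ()
  ; rep≉ε       = λ ()
  ; rep-Q       = λ ()
  ; label-rep   = λ ()
  ; connect     = λ x x≉ε → contradiction (trivial x) x≉ε
  }) (↔-id _)

O₀-two : ∀ {n p} → Prime p → p ≢ 2 → Near n p → O₀ (Sym n) HasComponents 2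
O₀-two {n} {0}    pp _ _ = contradiction pp ¬prime[0]
O₀-two {n} {1}    pp _ _ = contradiction pp ¬prime[1]
O₀-two {n} {2+ r} pp p≢2 np = Orders.O₀-two-components n (ℕₚ.≤-trans (prime>1 pp) (near⇒≥ np)) pp p≢2 np

O₀-Sym2 : O₀ (Sym 2) HasComponents 1
O₀-Sym2 = Orders.O₀-connected 2 ℕₚ.≤-refl λ
  { q pq q≢2 (inj₁ 2≡q) → q≢2 (sym 2≡q)
  ; q pq q≢2 (inj₂ refl) → ¬prime[1] pq }

P₀-prime : ∀ n → 8 ≤ n → Prime n → P₀ (Sym n) HasComponents ((n ∸ 2) ! + 1)
P₀-prime (2+ m) 8≤n pp = LargeDegree.P₀-prime-split 8≤n pp (inj₁ refl) (PrimeDegree.cyclicLabelling pp) (↔-id _)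

P₀-prime+1 : ∀ n p → 8 ≤ n → Prime p → n ≡ suc p → P₀ (Sym n) HasComponents (n * (n ∸ 3) ! + 1)
P₀-prime+1 .1            0      _   pp refl = contradiction pp ¬prime[0]
P₀-prime+1 .2            1      _   pp refl = contradiction pp ¬prime[1]
P₀-prime+1 .(suc (2+ m)) (2+ m) 8≤n pp refl =
  LargeDegree.P₀-prime-split 8≤n pp (inj₂ refl) (PrimeDegree+1.cyclicLabelling pp) (↔-sym Finₚ.*↔×)

P₀-large : ∀ n → 8 ≤ n → ∃ λ k → P₀ (Sym n) HasComponents k
P₀-large n 8≤n with prime? n | prime? (n ∸ 1)
... | yes pn | _        = _ , P₀-prime n 8≤n pn
... | no _   | yes pn-1 = _ , P₀-prime+1 n (n ∸ 1) 8≤n pn-1 (sym (ℕₚ.m+[n∸m]≡n {1} (ℕₚ.≤-trans (s≤s z≤n) 8≤n)))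
... | no ¬pn | no ¬pn-1 = _ , LargeDegree.P₀-connected 8≤n (notPrime⇒notNear ¬pn ¬pn-1)

Fin1-unique : ∀ (i j : Fin 1) → i ≡ j
Fin1-unique zero zero = refl

-- The comparison of `P₀` with `P̃₀` is claimed for every `n`, so degrees 0 and 1, where the graph
-- is empty, are included.
P₀-components : ∀ n → ∃ λ k → P₀ (Sym n) HasComponents k
P₀-components 0 = _ , P₀-trivial λ _ ()
P₀-components 1 = _ , P₀-trivial λ x i → Fin1-unique (x ⟨$⟩ʳ i) i
P₀-components 2 = _ , P₀-Sym2
P₀-components 3 = _ , P₀-Sym3
P₀-components 4 = _ , P₀-Sym4
P₀-components 5 = _ , P₀-Sym5
P₀-components 6 = _ , P₀-Sym6
P₀-components 7 = _ , P₀-Sym7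
P₀-components n@(suc (suc (suc (suc (suc (suc (suc (suc m)))))))) = P₀-large n (ℕₚ.m≤m+n 8 m)

theoremB : ((n : ℕ) → ∃ λ k → P₀ (Sym n) HasComponents k × P̃₀ (Sym n) HasComponents k)
    × ( (P₀ (Sym 2) HasComponents 1   × P₀𝒯 2 HasComponents 1 × O₀ (Sym 2) HasComponents 1)
    × (P₀ (Sym 3) HasComponents 4   × P₀𝒯 3 HasComponents 2 × O₀ (Sym 3) HasComponents 2)
    × (P₀ (Sym 4) HasComponents 13  × P₀𝒯 4 HasComponents 3 × O₀ (Sym 4) HasComponents 2)
    × (P₀ (Sym 5) HasComponents 31  × P₀𝒯 5 HasComponents 3 × O₀ (Sym 5) HasComponents 2)
    × (P₀ (Sym 6) HasComponents 83  × P₀𝒯 6 HasComponents 4 × O₀ (Sym 6) HasComponents 2)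
    × (P₀ (Sym 7) HasComponents 128 × P₀𝒯 7 HasComponents 3 × O₀ (Sym 7) HasComponents 2))
    × ((n : ℕ) → 8 ≤ n →
    (Prime n →
    P₀ (Sym n) HasComponents ((n ∸ 2) ! + 1)
    × P₀𝒯 n HasComponents 2 × O₀ (Sym n) HasComponents 2)
    × ((p : ℕ) → Prime p → n ≡ p + 1 →
    P₀ (Sym n) HasComponents (n * (n ∸ 3) ! + 1)
    × P₀𝒯 n HasComponents 2 × O₀ (Sym n) HasComponents 2)
    × (¬ Prime n → ¬ Prime (n ∸ 1) →
    P₀ (Sym n) HasComponents 1
    × P₀𝒯 n HasComponents 1 × O₀ (Sym n) HasComponents 1))
theoremB =
    -- The equality of the two numbers of components is expressed by one `k` for both graphs.
    (λ n → let k , c = P₀-components n in k , c , Permutations.P̃₀-hasComponents n c)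
  , ( (P₀-Sym2 , P₀𝒯-2 , O₀-Sym2)
    , (P₀-Sym3 , P₀𝒯-3 , O₀-two prime[3] (λ ()) (inj₁ refl))
    , (P₀-Sym4 , P₀𝒯-4 , O₀-two prime[3] (λ ()) (inj₂ refl))
    , (P₀-Sym5 , P₀𝒯-5 , O₀-two prime[5] (λ ()) (inj₁ refl))
    , (P₀-Sym6 , P₀𝒯-6 , O₀-two prime[5] (λ ()) (inj₂ refl))
    , (P₀-Sym7 , P₀𝒯-7 , O₀-two prime[7] (λ ()) (inj₁ refl)))
  , λ n 8≤n →
      (λ pn → P₀-prime n 8≤n pn , near 8≤n pn (inj₁ refl))
    , (λ { p pp n≡p+1 → let n≡1+p = trans n≡p+1 (ℕₚ.+-comm p 1) in
           P₀-prime+1 n p 8≤n pp n≡1+p , near 8≤n pp (inj₂ n≡1+p) })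
    , (λ ¬pn ¬pn-1 → let none = notPrime⇒notNear ¬pn ¬pn-1 in
           LargeDegree.P₀-connected 8≤n none , Chains.P₀𝒯-connected 8≤n none
         , Orders.O₀-connected n (ℕₚ.≤-trans (ℕₚ.m≤n+m 2 6) 8≤n) λ q pq _ → none q pq)
  where
  near : ∀ {n p} → 8 ≤ n → Prime p → Near n p → P₀𝒯 n HasComponents 2 × O₀ (Sym n) HasComponents 2
  near 8≤n pp np = let p≢2 = LargeDegree.notTwo 8≤n np in
    Chains.P₀𝒯-two-components 8≤n pp p≢2 np , O₀-two pp p≢2 np
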